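{- Let $A$ be a punctual injection structure which is relatively $\Delta^0_2$-categorical but not relatively $\Delta^0_1$-categorical. Then $\mathrm{PRCatSpec}(A)=\mathrm{Cone}(\Delta^0_2)$.
   Context: A punctual structure is a structure with domain $\omega$ whose operations and relations are uniformly primitive recursive. An injection structure is a structure $(D,f)$ in the language of one unary function symbol, with $f:D\to D$ injective. A computable structure $A$ is relatively $\Delta^0_\alpha$-categorical if for every structure $B\cong A$ with domain $\omega$ (not necessarily computable) there is an isomorphism from $A$ to $B$ which is $\Delta^0_\alpha$ relative to the atomic diagram of $B$. For total functions $f,g:\omega\to\omega$, write $f\leq_{PR} g$ if there is a primitive recursive scheme $\Psi$ (a primitive recursive definition which may additionally use the oracle function as a basic function) with $\Psi^{g}=f$. Write $f\equiv_{PR}g$ if $f\leq_{PR}g$ and $g\leq_{PR}f$. The $\equiv_{PR}$-classes are the PR-degrees, ordered by $\leq_{PR}$. For a punctual structure $A$, $\mathrm{PRCatSpec}(A)$ is the set of all PR-degrees $\mathbf d$ such that for every punctual structure $B\cong A$ there is an isomorphism $f:A\to B$ with $f\leq_{PR}\mathbf d$ and $f^{ -1}\leq_{PR}\mathbf d$. For a computable ordinal $\alpha>0$, $\mathrm{Cone}(\Delta^0_\alpha)$ is the set of all PR-degrees $\mathbf d$ such that $f\leq_{PR}\mathbf d$ for every total $\Delta^0_\alpha$ function $f:\omega\to\omega$. -}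

module Defs where

open import Data.Bool.Base using (if_then_else_)
open import Data.Empty using (⊥)
open import Data.Fin.Base using (Fin)
open import Data.Nat.Base using (ℕ; zero; suc; _+_; _<_)
open import Data.Nat.GeneralisedArithmetic using (fold)
open import Data.Nat.Properties using (_≟_)
open import Data.Product.Base using (Σ; ∃; _×_; _,_)
open import Data.Vec.Base using (Vec; []; _∷_; lookup; tabulate)
open import Data.Vec.Properties using (tabulate-cong)
open import Function.Base using (_∘_)
open import Function.Bundles using (_⇔_; _↔_; Inverse)
open import Function.Definitions using (Injective)
open import Level using (0ℓ)
open import Relation.Binary.Bundles using (Setoid)
open import Relation.Binary.Core using (Rel)
open import Relation.Binary.Definitions using (Reflexive; Transitive; _Respects_)
open import Relation.Binary.PropositionalEquality
open import Relation.Nullary.Decidable.Core using (does)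
open import Relation.Unary using (Pred)

private
  variable
    k m n : ℕ
    O O′ : ℕ → Set

------------------------------------------------------------------------
-- Oracles

-- `O n` is the type of names for the additional basic functions of arity n.

Oracle : (ℕ → Set) → Set
Oracle O = ∀ {n} → O n → Vec ℕ n → ℕ

none : Oracle (λ _ → ⊥)
none ()

single : (Vec ℕ k → ℕ) → Oracle (k ≡_)
single g refl = g

unary : (ℕ → ℕ) → Vec ℕ 1 → ℕ
unary f (x ∷ []) = f x

------------------------------------------------------------------------
-- Primitive recursive schemes

data PR (O : ℕ → Set) : ℕ → Set where
  basic : O n → PR O n
  zer   : PR O 0
  succ  : PR O 1
  proj  : Fin n → PR O n
  comp  : PR O m → (Fin m → PR O n) → PR O n
  rec   : PR O n → PR O (2 + n) → PR O (1 + n)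

primrec : (Vec ℕ n → ℕ) → (Vec ℕ (2 + n) → ℕ) → Vec ℕ (1 + n) → ℕ
primrec a s (zero  ∷ xs) = a xs
primrec a s (suc i ∷ xs) = s (i ∷ primrec a s (i ∷ xs) ∷ xs)

⟦_⟧ : PR O n → Oracle O → Vec ℕ n → ℕ
⟦ basic o   ⟧ α xs       = α o xs
⟦ zer       ⟧ α xs       = 0
⟦ succ      ⟧ α (x ∷ []) = suc x
⟦ proj i    ⟧ α xs       = lookup xs i
⟦ comp p qs ⟧ α xs       = ⟦ p ⟧ α (tabulate λ i → ⟦ qs i ⟧ α xs)
⟦ rec p q   ⟧ α xs       = primrec (⟦ p ⟧ α) (⟦ q ⟧ α) xs

PrimitiveRecursive : (Vec ℕ n → ℕ) → Set
PrimitiveRecursive {n} f = Σ (PR (λ _ → ⊥) n) λ p → ∀ xs → ⟦ p ⟧ none xs ≡ f xs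

------------------------------------------------------------------------
-- Recursive functions relative to an oracle

data Rec (O : ℕ → Set) : ℕ → Set where
  basic : O n → Rec O n
  zer   : Rec O 0
  succ  : Rec O 1
  proj  : Fin n → Rec O n
  comp  : Rec O m → (Fin m → Rec O n) → Rec O n
  rec   : Rec O n → Rec O (2 + n) → Rec O (1 + n)
  mu    : Rec O (1 + n) → Rec O n

-- `α ⊢ c · xs ⇓ y`: with oracle α, the program c halts on xs with value y.

infix 4 _⊢_·_⇓_

data _⊢_·_⇓_ (α : Oracle O) : Rec O n → Vec ℕ n → ℕ → Set where
  basic : (o : O n) (xs : Vec ℕ n) → α ⊢ basic o · xs ⇓ α o xs
  zer   : α ⊢ zer · [] ⇓ 0
  succ  : ∀ x → α ⊢ succ · x ∷ [] ⇓ suc x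
  proj  : (i : Fin n) (xs : Vec ℕ n) → α ⊢ proj i · xs ⇓ lookup xs i
  comp  : {c : Rec O m} {ds : Fin m → Rec O n} {xs : Vec ℕ n} (ys : Vec ℕ m) {z : ℕ} →
          (∀ i → α ⊢ ds i · xs ⇓ lookup ys i) →
          α ⊢ c · ys ⇓ z →
          α ⊢ comp c ds · xs ⇓ z
  rec₀  : {c : Rec O n} {d : Rec O (2 + n)} {xs : Vec ℕ n} {y : ℕ} →
          α ⊢ c · xs ⇓ y →
          α ⊢ rec c d · zero ∷ xs ⇓ y
  rec₊  : {c : Rec O n} {d : Rec O (2 + n)} {xs : Vec ℕ n} {i y z : ℕ} →
          α ⊢ rec c d · i ∷ xs ⇓ y →
          α ⊢ d · i ∷ y ∷ xs ⇓ z →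
          α ⊢ rec c d · suc i ∷ xs ⇓ z
  mu    : {c : Rec O (1 + n)} {xs : Vec ℕ n} {y : ℕ} →
          α ⊢ c · y ∷ xs ⇓ 0 →
          (∀ z → z < y → ∃ λ v → α ⊢ c · z ∷ xs ⇓ suc v) →
          α ⊢ mu c · xs ⇓ y

Computable : Oracle O → (Vec ℕ n → ℕ) → Set
Computable {O} {n} α f = Σ (Rec O n) λ c → ∀ xs → α ⊢ c · xs ⇓ f xs

------------------------------------------------------------------------
-- The arithmetical hierarchy relative to an oracle

-- Prefixes of n alternating quantifiers; the outermost quantified variable is
-- the first argument of the matrix, which is the decidable relation h v ≡ 1.

∃∀ ∀∃ : ∀ n → (Vec ℕ (n + k) → ℕ) → Pred (Vec ℕ k) 0ℓ
∃∀ zero    h xs = h xs ≡ 1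
∃∀ (suc n) h xs = ∃ λ y → ∀∃ n (h ∘ (y ∷_)) xs
∀∃ zero    h xs = h xs ≡ 1
∀∃ (suc n) h xs = ∀ y → ∃∀ n (h ∘ (y ∷_)) xs

Σ⁰ Π⁰ Δ⁰ : ℕ → Oracle O → Pred (Vec ℕ k) 0ℓ → Set
Σ⁰ {k = k} n α R =
  Σ (Vec ℕ (n + k) → ℕ) λ h → Computable α h × (∀ xs → R xs ⇔ ∃∀ n h xs)
Π⁰ {k = k} n α R =
  Σ (Vec ℕ (n + k) → ℕ) λ h → Computable α h × (∀ xs → R xs ⇔ ∀∃ n h xs)
Δ⁰ n α R = Σ⁰ n α R × Π⁰ n α R

graph : (ℕ → ℕ) → Pred (Vec ℕ 2) 0ℓ
graph f (x ∷ y ∷ []) = f x ≡ y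

Δ⁰-function : ℕ → Oracle O → (ℕ → ℕ) → Set
Δ⁰-function n α f = Δ⁰ n α (graph f)

------------------------------------------------------------------------
-- Structures with domain ω in the language of one unary function symbol

record Structure : Set where
  constructor ⟨ω,_⟩
  field
    op : ℕ → ℕ

open Structure public

IsInjectionStructure : Pred Structure 0ℓ
IsInjectionStructure A = Injective _≡_ _≡_ (op A)

Punctual : Pred Structure 0ℓ
Punctual A = PrimitiveRecursive (unary (op A))

infix 4 _≅_

record _≅_ (A B : Structure) : Set where
  field
    bijection : ℕ ↔ ℕ
  open Inverse bijection public using (to; from)
  field
    homo : ∀ x → to (op A x) ≡ op B (to x)

-- With a constant for every element of ω, the atomic sentences are
-- fᵐ(a) = fⁿ(b); the diagram is the characteristic function, on the codes
-- (m , a , n , b), of those that are true.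

atomicDiagram : Structure → Vec ℕ 4 → ℕ
atomicDiagram B (m ∷ a ∷ n ∷ b ∷ []) =
  if does (fold a (op B) m ≟ fold b (op B) n) then 1 else 0

RelativelyΔ⁰Categorical : ℕ → Pred Structure 0ℓ
RelativelyΔ⁰Categorical n A = ∀ B → B ≅ A →
  Σ (A ≅ B) λ φ → Δ⁰-function n (single (atomicDiagram B)) (_≅_.to φ)

------------------------------------------------------------------------
-- PR-degrees

infix 4 _≤PR_ _≡PR_

_≤PR_ : Rel (ℕ → ℕ) 0ℓ
f ≤PR g = Σ (PR (1 ≡_) 1) λ Ψ → ∀ x → ⟦ Ψ ⟧ (single (unary g)) (x ∷ []) ≡ f x

_≡PR_ : Rel (ℕ → ℕ) 0ℓ
f ≡PR g = f ≤PR g × g ≤PR f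

private
  primrec-cong : ∀ {a a′ : Vec ℕ n → ℕ} {s s′ : Vec ℕ (2 + n) → ℕ} →
                 a ≗ a′ → s ≗ s′ → primrec a s ≗ primrec a′ s′
  primrec-cong a≗ s≗ (zero  ∷ xs) = a≗ xs
  primrec-cong {s = s} a≗ s≗ (suc i ∷ xs) =
    trans (cong (λ r → s (i ∷ r ∷ xs)) (primrec-cong a≗ s≗ (i ∷ xs))) (s≗ _)

  substitute : (∀ {n} → O n → PR O′ n) → PR O m → PR O′ m
  substitute σ (basic o)   = σ o
  substitute σ zer         = zer
  substitute σ succ        = succ
  substitute σ (proj i)    = proj i
  substitute σ (comp p qs) = comp (substitute σ p) (λ i → substitute σ (qs i))
  substitute σ (rec p q)   = rec (substitute σ p) (substitute σ q)

  substitute-correct :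
    {α : Oracle O} {β : Oracle O′} (σ : ∀ {n} → O n → PR O′ n) →
    (∀ {n} (o : O n) → ⟦ σ o ⟧ β ≗ α o) →
    (p : PR O m) → ⟦ substitute σ p ⟧ β ≗ ⟦ p ⟧ α
  substitute-correct σ σ≗ (basic o) xs       = σ≗ o xs
  substitute-correct σ σ≗ zer xs             = refl
  substitute-correct σ σ≗ succ (x ∷ [])      = refl
  substitute-correct σ σ≗ (proj i) xs        = refl
  substitute-correct {β = β} σ σ≗ (comp p qs) xs =
    trans (cong (⟦ substitute σ p ⟧ β)
                (tabulate-cong λ i → substitute-correct σ σ≗ (qs i) xs))
          (substitute-correct σ σ≗ p _)
  substitute-correct σ σ≗ (rec p q) xs =
    primrec-cong (substitute-correct σ σ≗ p) (substitute-correct σ σ≗ q) xs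

≤PR-refl : Reflexive _≤PR_
≤PR-refl = basic refl , λ _ → refl

≤PR-trans : Transitive _≤PR_
≤PR-trans {f} {g} {h} (Ψ , Ψ≗) (Φ , Φ≗) =
  substitute σ Ψ , λ x → trans (substitute-correct σ σ≗ Ψ (x ∷ [])) (Ψ≗ x)
  where
  σ : ∀ {n} → 1 ≡ n → PR (1 ≡_) n
  σ refl = Φ

  σ≗ : ∀ {n} (o : 1 ≡ n) → ⟦ σ o ⟧ (single (unary h)) ≗ single (unary g) o
  σ≗ refl (x ∷ []) = Φ≗ x

-- A PR-degree is represented by any of its members, and a set of PR-degrees by
-- a predicate on functions that respects _≡PR_.

PRDegrees : Setoid 0ℓ 0ℓ
PRDegrees = record
  { Carrier       = ℕ → ℕ
  ; _≈_           = _≡PR_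
  ; isEquivalence = record
    { refl  = ≤PR-refl , ≤PR-refl
    ; sym   = λ (p , q) → q , p
    ; trans = λ (p , q) (p′ , q′) → ≤PR-trans p p′ , ≤PR-trans q′ q
    }
  }

open Setoid PRDegrees using () renaming (Carrier to PRDegree)

PRCatSpec : Structure → Pred PRDegree 0ℓ
PRCatSpec A d = ∀ B → Punctual B → B ≅ A →
  Σ (A ≅ B) λ φ → _≅_.to φ ≤PR d × _≅_.from φ ≤PR d

Cone : ℕ → Pred PRDegree 0ℓ
Cone n d = ∀ f → Δ⁰-function n none f → f ≤PR d

PRCatSpec-respects : ∀ A → PRCatSpec A Respects _≡PR_
PRCatSpec-respects A (d≤e , _) d∈ B pB B≅A with d∈ B pB B≅A
... | φ , to≤ , from≤ = φ , ≤PR-trans to≤ d≤e , ≤PR-trans from≤ d≤e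

Cone-respects : ∀ n → Cone n Respects _≡PR_
Cone-respects n (d≤e , _) d∈ f Δf = ≤PR-trans (d∈ f Δf) d≤e

{-# OPTIONS --safe #-}

-- If only finitely many orbits of A were infinite, A would be relatively
-- Δ⁰₁-categorical: match the infinite orbits by a finite table and the cycles of each
-- length by rank.  So for ω or ζ (the order type of ℤ), say T, there are infinitely
-- many orbits of type T.  A total Δ⁰₂ function is a limit of a primitive recursive
-- G(x, s).  In a punctual copy of A, let the chain with index (x, t) guess that t is the
-- least stage from which on G(y, ·) is constant for all y ≤ x.  When the guess is seen to
-- be wrong, the chain, finite so far, is inserted into a single junk orbit, so that for
-- each x exactly one chain survives.  An isomorphism between the copies for G = 0 and
-- for G maps x + 2 elements that are known to lie in different orbits of type T to
-- x + 2 different orbits; one of these carries a right guess (y, t) with y ≥ x, and then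
-- t bounds the modulus of convergence at x.

module Submission where

open import Defs
open import Axiom.ExcludedMiddle using (ExcludedMiddle)
open import Level using (0ℓ)
open import Relation.Nullary using (¬_)
open import Relation.Unary using (_≐_)

open import Data.Bool.Base using (Bool; _∧_; _∨_; false; if_then_else_; not; true)
open import Data.Bool.Properties using (if-float)
open import Data.Empty using (⊥; ⊥-elim)
open import Data.Fin.Base using (Fin; fromℕ<; suc; toℕ; zero)
open import Data.Fin.Properties using (pigeonhole; toℕ-fromℕ<; toℕ<n)
open import Data.Nat.Base
open import Data.Nat.DivMod using (_%_; _/_; m%n<n; m≡m%n+[m/n]*n)
open import Data.Nat.GeneralisedArithmetic using (fold)
open import Data.Nat.Properties
open import Data.Product.Base using (_,_; _×_; proj₁; proj₂; Σ; ∃)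
open import Data.Sum.Base using (_⊎_; inj₁; inj₂)
open import Data.Vec.Base using (Vec; []; _∷_; lookup; map; tabulate; tail)
open import Data.Vec.Properties using (lookup∘tabulate; tabulate-cong; tabulate-∘; tabulate∘lookup)
open import Data.Vec.Relation.Unary.All using (All; []; _∷_)
open import Data.Vec.Relation.Unary.All.Properties using (lookup⁺)
open import Function.Base using (_∘_; flip)
open import Function.Bundles using (Equivalence; Inverse; _⇔_; mk↔ₛ′; mk⇔)
open import Function.Definitions using (Injective)
open import Relation.Binary.Definitions using (tri<; tri>; tri≈)
open import Relation.Binary.PropositionalEquality
open import Relation.Nullary using (Dec; does; no; yes)
open import Relation.Nullary.Decidable using (_×-dec_; _⊎-dec_; dec-false; decidable-stable; does-⇔; map′; ¬?)

-- The operation of a punctual copy has to answer without unbounded search, and the isomorphism type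
-- of A fixes the number of cycles of each length. So a refuted chain can neither be dropped nor
-- closed into a cycle; the junk orbit takes it up, along with every other number left without a
-- use. The junk orbit has type T itself, which is why x + 2 test elements are taken rather than x +
-- 1. Cycles are copied literally, since a given k is recognised as the period of a by finitely many
-- checks. Orbits of the other type are rebuilt by position, and whether there is an i-th one is
-- settled by a hard-wired constant. The detour through the copy for G = 0 has a reason: A itself
-- need not offer a primitive recursive list of elements in different orbits of type T, whereas in
-- that copy every guess (i, 0) is right. A degree in the spectrum bounds the isomorphisms from A to
-- both copies and their inverses, hence the composite. For the converse inclusion, the atomic
-- diagram of a punctual copy is primitive recursive, so an isomorphism that is Δ⁰₂ relative to it
-- is Δ⁰₂ outright, and so is its inverse.

private
  variable
    k m n : ℕ
    O O′ : ℕ → Set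
    X Y Z : Set
    P Q : ℕ → Set

-- Closure properties of the primitive recursive functions

natrec : ℕ → (ℕ → ℕ → ℕ) → ℕ → ℕ
natrec a s zero    = a
natrec a s (suc i) = s i (natrec a s i)

binary : (ℕ → ℕ → ℕ) → Vec ℕ 2 → ℕ
binary f (x ∷ y ∷ []) = f x y

indicator : Bool → ℕ
indicator b = if b then 1 else 0

primrec-cong : ∀ {a a′ : Vec ℕ n → ℕ} {s s′ : Vec ℕ (2 + n) → ℕ} →
               a ≗ a′ → s ≗ s′ → primrec a s ≗ primrec a′ s′
primrec-cong a≗ s≗ (zero  ∷ xs) = a≗ xs
primrec-cong {s = s} a≗ s≗ (suc i ∷ xs) =
  trans (cong (λ r → s (i ∷ r ∷ xs)) (primrec-cong a≗ s≗ (i ∷ xs))) (s≗ _)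

primrec-natrec : (a : Vec ℕ n → ℕ) (s : Vec ℕ (2 + n) → ℕ) → ∀ i xs →
                 primrec a s (i ∷ xs) ≡ natrec (a xs) (λ j r → s (j ∷ r ∷ xs)) i
primrec-natrec a s zero    xs = refl
primrec-natrec a s (suc i) xs = cong (λ r → s (i ∷ r ∷ xs)) (primrec-natrec a s i xs)

natrec-cong : ∀ {a a′} {s s′ : ℕ → ℕ → ℕ} → a ≡ a′ → (∀ i r → s i r ≡ s′ i r) →
              ∀ i → natrec a s i ≡ natrec a′ s′ i
natrec-cong a≡ s≡ zero    = a≡
natrec-cong {s = s} a≡ s≡ (suc i) = trans (cong (s i) (natrec-cong a≡ s≡ i)) (s≡ i _)

record IsPR {O : ℕ → Set} (α : Oracle O) {n : ℕ} (f : Vec ℕ n → ℕ) : Set where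
  constructor isPR
  field
    scheme  : PR O n
    correct : ⟦ scheme ⟧ α ≗ f

open IsPR

module _ {α : Oracle O} where

  ext : ∀ {f g : Vec ℕ n → ℕ} → IsPR α f → f ≗ g → IsPR α g
  ext (isPR p p≗) f≗g = isPR p (λ xs → trans (p≗ xs) (f≗g xs))

  var : (i : Fin n) → IsPR α (λ xs → lookup xs i)
  var i = isPR (proj i) (λ _ → refl)

  v₀ : IsPR α {suc n} (λ xs → lookup xs zero)
  v₀ = var zero
  v₁ : IsPR α {2 + n} (λ xs → lookup xs (suc zero))
  v₁ = var (suc zero)
  v₂ : IsPR α {3 + n} (λ xs → lookup xs (suc (suc zero)))
  v₂ = var (suc (suc zero))
  v₃ : IsPR α {4 + n} (λ xs → lookup xs (suc (suc (suc zero))))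
  v₃ = var (suc (suc (suc zero)))
  v₄ : IsPR α {5 + n} (λ xs → lookup xs (suc (suc (suc (suc zero)))))
  v₄ = var (suc (suc (suc (suc zero))))
  v₅ : IsPR α {6 + n} (λ xs → lookup xs (suc (suc (suc (suc (suc zero))))))
  v₅ = var (suc (suc (suc (suc (suc zero)))))
  v₆ : IsPR α {7 + n} (λ xs → lookup xs (suc (suc (suc (suc (suc (suc zero)))))))
  v₆ = var (suc (suc (suc (suc (suc (suc zero))))))
  v₇ : IsPR α {8 + n} (λ xs → lookup xs (suc (suc (suc (suc (suc (suc (suc zero))))))))
  v₇ = var (suc (suc (suc (suc (suc (suc (suc zero)))))))

  compose : ∀ {g : Vec ℕ m → ℕ} {fs : Fin m → Vec ℕ n → ℕ} →
            IsPR α g → (∀ i → IsPR α (fs i)) → IsPR α (λ xs → g (tabulate λ i → fs i xs))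
  compose {g = g} (isPR p p≗) qs = isPR (comp p (λ i → scheme (qs i))) λ xs →
    trans (p≗ _) (cong g (tabulate-cong λ i → correct (qs i) xs))

  apply : ∀ {g : Vec ℕ m → ℕ} {fs : Vec (Vec ℕ n → ℕ) m} →
          IsPR α g → All (IsPR α) fs → IsPR α (λ xs → g (map (λ f → f xs) fs))
  apply {g = g} {fs} p qs =
    ext (compose p (λ i → lookup⁺ qs i))
        (λ xs → cong g (trans (tabulate-∘ (λ f → f xs) (lookup fs)) (cong (map _) (tabulate∘lookup fs))))

  PR-suc : ∀ {f : Vec ℕ n → ℕ} → IsPR α f → IsPR α (λ xs → suc (f xs))
  PR-suc q = apply {g = unary suc} (isPR succ λ { (_ ∷ []) → refl }) (q ∷ [])

  const : ∀ k → IsPR α {n} (λ _ → k)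
  const zero    = isPR (comp zer λ ()) λ _ → refl
  const (suc k) = PR-suc (const k)

  weaken : ∀ {f : Vec ℕ n → ℕ} → IsPR α f → IsPR α (λ xs → f (tail xs))
  weaken {f = f} p = ext (compose p (λ i → var (suc i)))
    (λ { (x ∷ xs) → cong f (tabulate∘lookup xs) })

  PR-natrec : ∀ {a : Vec ℕ n → ℕ} {s : Vec ℕ (2 + n) → ℕ} {b : Vec ℕ n → ℕ} →
              IsPR α a → IsPR α s → IsPR α b →
              IsPR α (λ xs → natrec (a xs) (λ i r → s (i ∷ r ∷ xs)) (b xs))
  PR-natrec {n} {a} {s} {b} p q r =
    ext (compose {fs = fs} (isPR (rec (scheme p) (scheme q)) (primrec-cong (correct p) (correct q)))
                 λ { zero → r ; (suc i) → var i })
        (λ xs → trans (cong (λ ys → primrec a s (b xs ∷ ys)) (tabulate∘lookup xs))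
                      (primrec-natrec a s (b xs) xs))
    where
    fs : Fin (suc n) → Vec ℕ n → ℕ
    fs zero    = b
    fs (suc i) = λ xs → lookup xs i

  PR-+ : ∀ {f g : Vec ℕ n → ℕ} → IsPR α f → IsPR α g → IsPR α (λ xs → f xs + g xs)
  PR-+ {f = f} {g} p q = ext (PR-natrec q (PR-suc (var (suc zero))) p) (λ xs → lem (f xs) (g xs))
    where
    lem : ∀ x y → natrec y (λ _ → suc) x ≡ x + y
    lem zero    y = refl
    lem (suc x) y = cong suc (lem x y)

  PR-* : ∀ {f g : Vec ℕ n → ℕ} → IsPR α f → IsPR α g → IsPR α (λ xs → f xs * g xs)
  PR-* {f = f} {g} p q =
    ext (PR-natrec (const 0) (PR-+ (weaken (weaken q)) (var (suc zero))) p) (λ xs → lem (f xs) (g xs))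
    where
    lem : ∀ x y → natrec 0 (λ _ r → y + r) x ≡ x * y
    lem zero    y = refl
    lem (suc x) y = cong (y +_) (lem x y)

  PR-pred : ∀ {f : Vec ℕ n → ℕ} → IsPR α f → IsPR α (λ xs → pred (f xs))
  PR-pred {f = f} p = ext (PR-natrec (const 0) (var zero) p) (λ xs → lem (f xs))
    where
    lem : ∀ x → natrec 0 (λ i _ → i) x ≡ pred x
    lem zero    = refl
    lem (suc x) = refl

  PR-∸ : ∀ {f g : Vec ℕ n → ℕ} → IsPR α f → IsPR α g → IsPR α (λ xs → f xs ∸ g xs)
  PR-∸ {f = f} {g} p q = ext (PR-natrec p (PR-pred (var (suc zero))) q) (λ xs → lem (f xs) (g xs))
    where
    lem : ∀ x y → natrec x (λ _ → pred) y ≡ x ∸ y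
    lem x zero    = refl
    lem x (suc y) = trans (cong pred (lem x y)) (pred[m∸n]≡m∸[1+n] x y)

-- Primitive recursive relations

record PRel {O : ℕ → Set} (α : Oracle O) {n : ℕ} (P : Vec ℕ n → Set) : Set where
  constructor prel
  field
    decide : ∀ xs → Dec (P xs)
    char   : IsPR α (λ xs → indicator (does (decide xs)))

open PRel

sum< : ℕ → (ℕ → ℕ) → ℕ
sum< zero    f = 0
sum< (suc b) f = f b + sum< b f

module _ {α : Oracle O} where

  -- `map′` keeps the boolean, so the same characteristic function serves for every equivalent
  -- relation.
  retract : ∀ {P Q : Vec ℕ n → Set} → PRel α P →
            (∀ {xs} → P xs → Q xs) → (∀ {xs} → Q xs → P xs) → PRel α Q
  retract (prel d c) to from = prel (λ xs → map′ to from (d xs)) c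

  _because_ : ∀ {P : Vec ℕ n → Set} {h : Vec ℕ n → ℕ} (d : ∀ xs → Dec (P xs)) →
              IsPR α h × (∀ xs → h xs ≡ indicator (does (d xs))) → PRel α P
  d because (p , eq) = prel d (ext p eq)

  infixr 2 _×ᴿ_
  infixr 1 _⊎ᴿ_
  infixr 0 _→ᴿ_

  ¬ᴿ : ∀ {P : Vec ℕ n → Set} → PRel α P → PRel α (λ xs → ¬ P xs)
  ¬ᴿ (prel d c) = (λ xs → ¬? (d xs)) because (PR-∸ (const 1) c , λ xs → lem (does (d xs)))
    where
    lem : ∀ b → 1 ∸ indicator b ≡ indicator (not b)
    lem true  = refl
    lem false = refl

  _×ᴿ_ : ∀ {P Q : Vec ℕ n → Set} → PRel α P → PRel α Q → PRel α (λ xs → P xs × Q xs)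
  prel d c ×ᴿ prel d′ c′ =
    (λ xs → d xs ×-dec d′ xs) because (PR-* c c′ , λ xs → lem (does (d xs)) (does (d′ xs)))
    where
    lem : ∀ b b′ → indicator b * indicator b′ ≡ indicator (b ∧ b′)
    lem true  true  = refl
    lem true  false = refl
    lem false b′    = refl

  PR-if : ∀ {P : Vec ℕ n → Set} {f g : Vec ℕ n → ℕ} (R : PRel α P) → IsPR α f → IsPR α g →
          IsPR α (λ xs → if does (decide R xs) then f xs else g xs)
  PR-if {f = f} {g} (prel d c) p q =
    ext (PR-+ (PR-* c p) (PR-* (PR-∸ (const 1) c) q)) (λ xs → lem (does (d xs)) (f xs) (g xs))
    where
    lem : ∀ b x y → indicator b * x + (1 ∸ indicator b) * y ≡ (if b then x else y)
    lem true  x y = trans (+-identityʳ _) (+-identityʳ x)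
    lem false x y = +-identityʳ y

  _⊎ᴿ_ : ∀ {P Q : Vec ℕ n → Set} → PRel α P → PRel α Q → PRel α (λ xs → P xs ⊎ Q xs)
  R ⊎ᴿ prel d′ c′ =
    (λ xs → decide R xs ⊎-dec d′ xs) because (PR-if R (const 1) c′ , λ xs → lem (does (decide R xs)) _)
    where
    lem : ∀ b b′ → (if b then 1 else indicator b′) ≡ indicator (b ∨ b′)
    lem true  b′ = refl
    lem false b′ = refl

  _→ᴿ_ : ∀ {P Q : Vec ℕ n → Set} → PRel α P → PRel α Q → PRel α (λ xs → P xs → Q xs)
  _→ᴿ_ {P = P} {Q} R S = retract (¬ᴿ R ⊎ᴿ S) to from
    where
    to : ∀ {xs} → ¬ P xs ⊎ Q xs → P xs → Q xs
    to (inj₁ ¬p) p = ⊥-elim (¬p p)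
    to (inj₂ q)  _ = q
    from : ∀ {xs} → (P xs → Q xs) → ¬ P xs ⊎ Q xs
    from {xs} h with decide R xs
    ... | yes p = inj₂ (h p)
    ... | no ¬p = inj₁ ¬p

  _≡ᴿ_ : ∀ {f g : Vec ℕ n → ℕ} → IsPR α f → IsPR α g → PRel α (λ xs → f xs ≡ g xs)
  _≡ᴿ_ {f = f} {g} p q =
    (λ xs → f xs ≟ g xs) because
      (PR-∸ (const 1) (PR-+ (PR-∸ p q) (PR-∸ q p)) , λ xs → lem (f xs) (g xs) (f xs ≟ g xs))
    where
    lem : ∀ x y (d : Dec (x ≡ y)) → 1 ∸ ((x ∸ y) + (y ∸ x)) ≡ indicator (does d)
    lem x y (yes refl) = cong (λ z → 1 ∸ (z + z)) (n∸n≡0 x)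
    lem x y (no  x≢y)  with <-cmp x y
    ... | tri≈ _ x≡y _ = ⊥-elim (x≢y x≡y)
    ... | tri< x<y _ _ = m≤n⇒m∸n≡0 (≤-trans (m<n⇒0<n∸m x<y) (m≤n+m (y ∸ x) (x ∸ y)))
    ... | tri> _ _ y<x = m≤n⇒m∸n≡0 (≤-trans (m<n⇒0<n∸m y<x) (m≤m+n (x ∸ y) (y ∸ x)))

  _≤ᴿ_ : ∀ {f g : Vec ℕ n → ℕ} → IsPR α f → IsPR α g → PRel α (λ xs → f xs ≤ g xs)
  p ≤ᴿ q = retract (PR-∸ p q ≡ᴿ const 0) (λ {xs} → m∸n≡0⇒m≤n) (λ {xs} → m≤n⇒m∸n≡0)

  _<ᴿ_ : ∀ {f g : Vec ℕ n → ℕ} → IsPR α f → IsPR α g → PRel α (λ xs → f xs < g xs)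
  p <ᴿ q = PR-suc p ≤ᴿ q

  PR-sum : ∀ {f : Vec ℕ (suc n) → ℕ} {b : Vec ℕ n → ℕ} → IsPR α f → IsPR α b →
           IsPR α (λ xs → sum< (b xs) (λ y → f (y ∷ xs)))
  PR-sum {n} {f} {b} p q =
    ext (PR-natrec (const 0) (PR-+ (ext {g = g} (compose {fs = fs} p λ { zero → var zero ; (suc i) → var (suc (suc i)) })
                                        (λ { (i ∷ r ∷ xs) → cong (λ ys → f (i ∷ ys)) (tabulate∘lookup xs) }))
                                   (var (suc zero))) q)
        (λ xs → lem xs (b xs))
    where
    fs : Fin (suc n) → Vec ℕ (2 + n) → ℕ
    fs zero    xs = lookup xs zero
    fs (suc i) xs = lookup xs (suc (suc i))
    g : Vec ℕ (2 + n) → ℕ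
    g (i ∷ r ∷ xs) = f (i ∷ xs)
    lem : ∀ xs b → natrec 0 (λ i r → g (i ∷ r ∷ xs) + r) b ≡ sum< b (λ y → f (y ∷ xs))
    lem xs zero    = refl
    lem xs (suc b) = cong (f (b ∷ xs) +_) (lem xs b)

  composeᴿ : ∀ {P : Vec ℕ m → Set} {fs : Fin m → Vec ℕ n → ℕ} →
             PRel α P → (∀ i → IsPR α (fs i)) → PRel α (λ xs → P (tabulate λ i → fs i xs))
  composeᴿ (prel d c) ps = prel (λ xs → d _) (compose c ps)

  applyᴿ : ∀ {P : Vec ℕ m → Set} {fs : Vec (Vec ℕ n → ℕ) m} →
           PRel α P → All (IsPR α) fs → PRel α (λ xs → P (map (λ f → f xs) fs))
  applyᴿ (prel d c) ps = prel (λ xs → d _) (apply c ps)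

  ∃<ᴿ : ∀ {P : Vec ℕ (suc n) → Set} {b : Vec ℕ n → ℕ} → IsPR α b → PRel α P →
        PRel α (λ xs → ∃ λ y → y < b xs × P (y ∷ xs))
  ∃<ᴿ {P = P} {b} p R = retract (const 1 ≤ᴿ PR-sum (char R) p) (λ {xs} → to (b xs)) (λ {xs} → from (b xs))
    where
    χ : ∀ xs → ℕ → ℕ
    χ xs y = indicator (does (decide R (y ∷ xs)))
    to : ∀ {xs} b → 1 ≤ sum< b (χ xs) → ∃ λ y → y < b × P (y ∷ xs)
    to {xs} (suc b) h with decide R (b ∷ xs)
    ... | yes p = b , ≤-refl , p
    ... | no  _ with to b h
    ...   | y , y<b , py = y , m≤n⇒m≤1+n y<b , py
    from : ∀ {xs} b → (∃ λ y → y < b × P (y ∷ xs)) → 1 ≤ sum< b (χ xs)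
    from {xs} (suc b) (y , s≤s y≤b , py) with decide R (b ∷ xs)
    ... | yes _ = s≤s z≤n
    ... | no ¬p = from b (y , ≤∧≢⇒< y≤b (λ { refl → ¬p py }) , py)

  ∀<ᴿ : ∀ {P : Vec ℕ (suc n) → Set} {b : Vec ℕ n → ℕ} → IsPR α b → PRel α P →
        PRel α (λ xs → ∀ y → y < b xs → P (y ∷ xs))
  ∀<ᴿ {P = P} {b} p R = retract (¬ᴿ (∃<ᴿ p (¬ᴿ R))) (λ {xs} → to {xs}) (λ {xs} h (y , y< , ¬q) → ¬q (h y y<))
    where
    to : ∀ {xs} → ¬ (∃ λ y → y < b xs × ¬ P (y ∷ xs)) → ∀ y → y < b xs → P (y ∷ xs)
    to {xs} h y y< with decide R (y ∷ xs)
    ... | yes q = q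
    ... | no ¬q = ⊥-elim (h (y , y< , ¬q))

-- Cantor's pairing function

triangle : ℕ → ℕ
triangle = natrec 0 (λ i r → suc i + r)

-- The number of the antidiagonal that contains the argument; it grows by one exactly when the next
-- triangular number is reached.
diagonal : ℕ → ℕ
diagonal = natrec 0 (λ i r → if does (triangle (suc r) ≟ suc i) then suc r else r)

opaque
  pair : ℕ → ℕ → ℕ
  pair u v = triangle (u + v) + u

  π₁ π₂ : ℕ → ℕ
  π₁ z = z ∸ triangle (diagonal z)
  π₂ z = diagonal z ∸ π₁ z

triangle-mono : ∀ {s t} → s ≤ t → triangle s ≤ triangle t
triangle-mono {t = t}     z≤n       = z≤n
triangle-mono {t = suc t} (s≤s s≤t) = s≤s (+-mono-≤ s≤t (triangle-mono s≤t))

diagonal-bounds : ∀ z → triangle (diagonal z) ≤ z × z < triangle (suc (diagonal z))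
diagonal-bounds zero    = z≤n , s≤s z≤n
diagonal-bounds (suc z) = step (triangle (suc (diagonal z)) ≟ suc z)
  where
  step : (d : Dec (triangle (suc (diagonal z)) ≡ suc z)) → let r = if does d then suc (diagonal z) else diagonal z in
         triangle r ≤ suc z × suc z < triangle (suc r)
  step (yes e) = ≤-reflexive e , s≤s (≤-trans (≤-reflexive (sym e)) (m≤n+m _ (suc (diagonal z))))
  step (no ≢)  = m≤n⇒m≤1+n (proj₁ (diagonal-bounds z)) , ≤∧≢⇒< (proj₂ (diagonal-bounds z)) (≢ ∘ sym)

diagonal-unique : ∀ {s z} → triangle s ≤ z → z < triangle (suc s) → diagonal z ≡ s
diagonal-unique {s} {z} lo hi with <-cmp (diagonal z) s
... | tri≈ _ e _ = e
... | tri< l _ _ = ⊥-elim (<-irrefl refl (<-≤-trans (proj₂ (diagonal-bounds z)) (≤-trans (triangle-mono l) lo)))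
... | tri> _ _ l = ⊥-elim (<-irrefl refl (<-≤-trans hi (≤-trans (triangle-mono l) (proj₁ (diagonal-bounds z)))))

opaque
  unfolding pair

  diagonal-pair : ∀ u v → diagonal (pair u v) ≡ u + v
  diagonal-pair u v = diagonal-unique (m≤m+n _ u)
    (≤-trans (s≤s (+-monoʳ-≤ _ (m≤m+n u v))) (≤-reflexive (cong suc (+-comm (triangle (u + v)) (u + v)))))

  π₁-pair : ∀ u v → π₁ (pair u v) ≡ u
  π₁-pair u v = trans (cong (λ s → pair u v ∸ triangle s) (diagonal-pair u v)) (m+n∸m≡n (triangle (u + v)) u)

  π₂-pair : ∀ u v → π₂ (pair u v) ≡ v
  π₂-pair u v = trans (cong₂ _∸_ (diagonal-pair u v) (π₁-pair u v)) (m+n∸m≡n u v)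

  pair-π : ∀ z → pair (π₁ z) (π₂ z) ≡ z
  pair-π z = trans (cong (λ s → triangle s + π₁ z) (m+[n∸m]≡n π₁≤)) (m+[n∸m]≡n (proj₁ (diagonal-bounds z)))
    where
    π₁≤ : π₁ z ≤ diagonal z
    π₁≤ = ≤-trans (∸-monoˡ-≤ (triangle (diagonal z)) (s≤s⁻¹ (proj₂ (diagonal-bounds z))))
            (≤-reflexive (m+n∸n≡m (diagonal z) (triangle (diagonal z))))

module _ {α : Oracle O} where

  PR-triangle : ∀ {f : Vec ℕ n → ℕ} → IsPR α f → IsPR α (λ xs → triangle (f xs))
  PR-triangle p = PR-natrec (const 0) (PR-+ (PR-suc (var zero)) (var (suc zero))) p

  PR-diagonal : ∀ {f : Vec ℕ n → ℕ} → IsPR α f → IsPR α (λ xs → diagonal (f xs))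
  PR-diagonal p = PR-natrec (const 0)
    (PR-if (PR-triangle (PR-suc (var (suc zero))) ≡ᴿ PR-suc (var zero)) (PR-suc (var (suc zero))) (var (suc zero))) p

  opaque
    unfolding pair

    PR-pair : ∀ {f g : Vec ℕ n → ℕ} → IsPR α f → IsPR α g → IsPR α (λ xs → pair (f xs) (g xs))
    PR-pair p q = PR-+ (PR-triangle (PR-+ p q)) p

    PR-π₁ : ∀ {f : Vec ℕ n → ℕ} → IsPR α f → IsPR α (λ xs → π₁ (f xs))
    PR-π₁ p = PR-∸ p (PR-triangle (PR-diagonal p))

    PR-π₂ : ∀ {f : Vec ℕ n → ℕ} → IsPR α f → IsPR α (λ xs → π₂ (f xs))
    PR-π₂ p = PR-∸ (PR-diagonal p) (PR-π₁ p)

-- Programs and their oracles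

liftPR : PR (λ _ → ⊥) n → PR O n
liftPR (basic ())
liftPR zer         = zer
liftPR succ        = succ
liftPR (proj i)    = proj i
liftPR (comp p qs) = comp (liftPR p) (λ i → liftPR (qs i))
liftPR (rec p q)   = rec (liftPR p) (liftPR q)

liftPR-correct : {α : Oracle O} (p : PR (λ _ → ⊥) n) → ⟦ liftPR p ⟧ α ≗ ⟦ p ⟧ none
liftPR-correct zer         xs       = refl
liftPR-correct succ        (x ∷ []) = refl
liftPR-correct (proj i)    xs       = refl
liftPR-correct {α = α} (comp p qs) xs =
  trans (cong (⟦ liftPR p ⟧ α) (tabulate-cong λ i → liftPR-correct (qs i) xs)) (liftPR-correct p _)
liftPR-correct (rec p q)   xs       = primrec-cong (liftPR-correct p) (liftPR-correct q) xs

fromNone : {α : Oracle O} {f : Vec ℕ n → ℕ} → IsPR none f → IsPR α f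
fromNone (isPR p p≗) = isPR (liftPR p) (λ xs → trans (liftPR-correct p xs) (p≗ xs))

toRec : PR O n → Rec O n
toRec (basic o)   = basic o
toRec zer         = zer
toRec succ        = succ
toRec (proj i)    = proj i
toRec (comp p qs) = comp (toRec p) (λ i → toRec (qs i))
toRec (rec p q)   = rec (toRec p) (toRec q)

module _ {α : Oracle O} where

  toRec-correct : (p : PR O n) → ∀ xs → α ⊢ toRec p · xs ⇓ ⟦ p ⟧ α xs
  toRec-correct (basic o)   xs       = basic o xs
  toRec-correct zer         []       = zer
  toRec-correct succ        (x ∷ []) = succ x
  toRec-correct (proj i)    xs       = proj i xs
  toRec-correct (comp p qs) xs       = comp _
    (λ i → subst (α ⊢ toRec (qs i) · xs ⇓_) (sym (lookup∘tabulate (λ j → ⟦ qs j ⟧ α xs) i)) (toRec-correct (qs i) xs))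
    (toRec-correct p _)
  toRec-correct (rec p q) (zero  ∷ xs) = rec₀ (toRec-correct p xs)
  toRec-correct (rec p q) (suc i ∷ xs) = rec₊ (toRec-correct (rec p q) (i ∷ xs)) (toRec-correct q _)

  PR⇒computable : {f : Vec ℕ n → ℕ} → IsPR α f → Computable α f
  PR⇒computable (isPR p p≗) = toRec p , λ xs → subst (α ⊢ toRec p · xs ⇓_) (p≗ xs) (toRec-correct p xs)

  computable-permute : {f : Vec ℕ m → ℕ} (ι : Fin m → Fin n) →
                       Computable α f → Computable α (λ xs → f (tabulate λ i → lookup xs (ι i)))
  computable-permute ι (c , c⇓) = comp c (λ i → proj (ι i)) , λ xs → comp _
    (λ i → subst (α ⊢ proj (ι i) · xs ⇓_) (sym (lookup∘tabulate (λ j → lookup xs (ι j)) i)) (proj (ι i) xs))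
    (c⇓ _)

substRec : (∀ {n} → O n → Rec O′ n) → Rec O m → Rec O′ m
substRec σ (basic o)   = σ o
substRec σ zer         = zer
substRec σ succ        = succ
substRec σ (proj i)    = proj i
substRec σ (comp p qs) = comp (substRec σ p) (λ i → substRec σ (qs i))
substRec σ (rec p q)   = rec (substRec σ p) (substRec σ q)
substRec σ (mu p)      = mu (substRec σ p)

module _ {α : Oracle O} {β : Oracle O′} (σ : ∀ {n} → O n → Rec O′ n)
         (σ⇓ : ∀ {n} (o : O n) xs → β ⊢ σ o · xs ⇓ α o xs) where

  substRec-correct : ∀ {c : Rec O m} {xs y} → α ⊢ c · xs ⇓ y → β ⊢ substRec σ c · xs ⇓ y
  substRec-correct (basic o xs)   = σ⇓ o xs
  substRec-correct zer            = zer
  substRec-correct (succ x)       = succ x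
  substRec-correct (proj i xs)    = proj i xs
  substRec-correct (comp ys h c⇓) = comp ys (λ i → substRec-correct (h i)) (substRec-correct c⇓)
  substRec-correct (rec₀ c⇓)      = rec₀ (substRec-correct c⇓)
  substRec-correct (rec₊ c⇓ d⇓)   = rec₊ (substRec-correct c⇓) (substRec-correct d⇓)
  substRec-correct (mu c⇓ h)      = mu (substRec-correct c⇓)
    (λ z z<y → proj₁ (h z z<y) , substRec-correct (proj₂ (h z z<y)))

computable-trans : {g : Vec ℕ k → ℕ} {f : Vec ℕ m → ℕ} {β : Oracle O} →
                   Computable (single g) f → Computable β g → Computable β f
computable-trans {k} {g = g} {β = β} (c , c⇓) (d , d⇓) = substRec σ c , λ xs → substRec-correct σ σ⇓ (c⇓ xs)
  where
  σ : ∀ {n} → k ≡ n → Rec _ n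
  σ refl = d
  σ⇓ : ∀ {n} (o : k ≡ n) xs → β ⊢ σ o · xs ⇓ single g o xs
  σ⇓ refl = d⇓

-- Stage-bounded evaluation

-- Strictness: 0 stands for an undefined value, which has to propagate through compositions and
-- recursions.
guard : ℕ → ℕ → ℕ
guard zero    v = 0
guard (suc _) v = v

guardAll : (Fin m → ℕ) → ℕ → ℕ
guardAll {zero}  t v = v
guardAll {suc m} t v = guard (t zero) (guardAll (t ∘ suc) v)

-- The state is 0 while every value met so far was positive, 1 after meeting an
-- undefined value, and 2 + y once a zero has been found at y.
search : ℕ → ℕ → ℕ → ℕ
search y zero    zero          = 1
search y zero    (suc zero)    = 2 + y
search y zero    (suc (suc _)) = 0
search y (suc r) _             = suc r

-- The value at stage s, increased by 1; 0 if the program has not halted yet.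
eval : Rec (λ _ → ⊥) n → ℕ → Vec ℕ n → ℕ
searchState : Rec (λ _ → ⊥) (1 + n) → ℕ → Vec ℕ n → ℕ → ℕ

eval (basic ())
eval zer         s xs       = 1
eval succ        s (x ∷ []) = 2 + x
eval (proj i)    s xs       = suc (lookup xs i)
eval (comp c ds) s xs       =
  guardAll (λ i → eval (ds i) s xs) (eval c s (tabulate λ i → pred (eval (ds i) s xs)))
eval (rec c d)   s (i ∷ xs) = natrec (eval c s xs) (λ j r → guard r (eval d s (j ∷ pred r ∷ xs))) i
eval (mu c)      s xs       = pred (searchState c s xs s)

searchState c s xs = natrec 0 (λ y r → search y r (eval c s (y ∷ xs)))

module _ {α : Oracle O} where

  PR-guard : ∀ {f g : Vec ℕ n → ℕ} → IsPR α f → IsPR α g → IsPR α (λ xs → guard (f xs) (g xs))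
  PR-guard {f = f} {g} p q = ext (PR-if (p ≡ᴿ const 0) (const 0) q) (λ xs → lem (f xs) (g xs))
    where
    lem : ∀ x y → (if does (x ≟ 0) then 0 else y) ≡ guard x y
    lem zero    y = refl
    lem (suc x) y = refl

  PR-guardAll : ∀ m {t : Fin m → Vec ℕ n → ℕ} {v : Vec ℕ n → ℕ} → (∀ i → IsPR α (t i)) → IsPR α v →
                IsPR α (λ xs → guardAll (λ i → t i xs) (v xs))
  PR-guardAll zero    ps q = q
  PR-guardAll (suc m) ps q = PR-guard (ps zero) (PR-guardAll m (ps ∘ suc) q)

  PR-search : ∀ {f g h : Vec ℕ n → ℕ} → IsPR α f → IsPR α g → IsPR α h →
              IsPR α (λ xs → search (f xs) (g xs) (h xs))
  PR-search {f = f} {g} {h} p q r = ext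
    (PR-if (q ≡ᴿ const 0) (PR-if (r ≡ᴿ const 0) (const 1) (PR-if (r ≡ᴿ const 1) (PR-suc (PR-suc p)) (const 0))) q)
    (λ xs → lem (f xs) (g xs) (h xs))
    where
    lem : ∀ y r t → (if does (r ≟ 0) then (if does (t ≟ 0) then 1 else (if does (t ≟ 1) then 2 + y else 0)) else r)
                    ≡ search y r t
    lem y zero    zero          = refl
    lem y zero    (suc zero)    = refl
    lem y zero    (suc (suc t)) = refl
    lem y (suc r) t             = refl

  withTail : ∀ {f : Vec ℕ (suc k) → ℕ} {g : Vec ℕ n → ℕ} {hs : Fin k → Vec ℕ n → ℕ} →
             IsPR α f → IsPR α g → (∀ i → IsPR α (hs i)) →
             IsPR α (λ xs → f (g xs ∷ tabulate λ i → hs i xs))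
  withTail {k} {n} {g = g} {hs} p q rs = compose {fs = fs} p λ { zero → q ; (suc i) → rs i }
    where
    fs : Fin (suc k) → Vec ℕ n → ℕ
    fs zero    = g
    fs (suc i) = hs i

stage : (ℕ → Vec ℕ n → ℕ) → Vec ℕ (suc n) → ℕ
stage f (s ∷ xs) = f s xs

PR-eval : {α : Oracle O} (c : Rec (λ _ → ⊥) n) → IsPR α (stage (eval c))
PR-eval zer         = ext (const 1) λ { (s ∷ []) → refl }
PR-eval succ        = ext (PR-suc (PR-suc (var (suc zero)))) λ { (s ∷ x ∷ []) → refl }
PR-eval (proj i)    = ext (PR-suc (var (suc i))) λ { (s ∷ xs) → refl }
PR-eval (comp c ds) = ext
  (PR-guardAll _ (λ i → PR-eval (ds i)) (withTail (PR-eval c) (var zero) (λ i → PR-pred (PR-eval (ds i)))))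
  λ { (s ∷ xs) → refl }
PR-eval (rec {n = n} c d)   = ext
  (PR-natrec (ext {f = λ ys → stage (eval c) (lookup ys zero ∷ tabulate λ i → lookup ys (suc (suc i)))}
                  (withTail (PR-eval c) (var zero) (λ i → var (suc (suc i)))) (λ _ → refl))
             (PR-guard (var (suc zero)) (compose {fs = fs} (PR-eval d) ps))
             (var (suc zero)))
  λ { (s ∷ i ∷ xs) → trans
    (natrec-cong (cong (eval c s) (tabulate∘lookup xs))
                 (λ j r → cong (λ ys → guard r (eval d s (j ∷ pred r ∷ ys))) (tabulate∘lookup xs)) i) refl }
  where
  fs : Fin (3 + n) → Vec ℕ (4 + n) → ℕ
  fs zero                ys = lookup ys (suc (suc zero))
  fs (suc zero)          ys = lookup ys zero
  fs (suc (suc zero))    ys = pred (lookup ys (suc zero))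
  fs (suc (suc (suc i))) ys = lookup ys (suc (suc (suc (suc i))))
  ps : ∀ i → IsPR _ (fs i)
  ps zero                = var (suc (suc zero))
  ps (suc zero)          = var zero
  ps (suc (suc zero))    = PR-pred (var (suc zero))
  ps (suc (suc (suc i))) = var (suc (suc (suc (suc i))))
PR-eval (mu {n = n} c)      = ext
  (PR-pred (PR-natrec (const 0) (PR-search (var zero) (var (suc zero)) (compose {fs = fs} (PR-eval c) ps)) (var zero)))
  λ { (s ∷ xs) → cong pred
    (natrec-cong refl (λ y r → cong (λ ys → search y r (eval c s (y ∷ ys))) (tabulate∘lookup xs)) s) }
  where
  fs : Fin (2 + n) → Vec ℕ (3 + n) → ℕ
  fs zero          ys = lookup ys (suc (suc zero))
  fs (suc zero)    ys = lookup ys zero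
  fs (suc (suc i)) ys = lookup ys (suc (suc (suc i)))
  ps : ∀ i → IsPR _ (fs i)
  ps zero          = var (suc (suc zero))
  ps (suc zero)    = var zero
  ps (suc (suc i)) = var (suc (suc (suc i)))

-- Convergence of the bounded evaluation

Eventually : (ℕ → Set) → Set
Eventually P = ∃ λ s₀ → ∀ s → s₀ ≤ s → P s

ev-map : ∀ {P Q : ℕ → Set} → (∀ s → P s → Q s) → Eventually P → Eventually Q
ev-map h (s₀ , p) = s₀ , λ s s≥ → h s (p s s≥)

ev-× : ∀ {P Q : ℕ → Set} → Eventually P → Eventually Q → Eventually (λ s → P s × Q s)
ev-× (s , p) (t , q) = s ⊔ t , λ u u≥ → p u (≤-trans (m≤m⊔n s t) u≥) , q u (≤-trans (m≤n⊔m s t) u≥)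

ev-Fin : ∀ m {P : Fin m → ℕ → Set} → (∀ i → Eventually (P i)) → Eventually (λ s → ∀ i → P i s)
ev-Fin zero    h = 0 , λ _ _ ()
ev-Fin (suc m) h = ev-map (λ { s (p , q) zero → p ; s (p , q) (suc i) → q i }) (ev-× (h zero) (ev-Fin m (h ∘ suc)))

ev-< : ∀ n {P : ℕ → ℕ → Set} → (∀ i → i < n → Eventually (P i)) → Eventually (λ s → ∀ i → i < n → P i s)
ev-< zero    h = 0 , λ _ _ _ ()
ev-< (suc n) {P} h = ev-map join (ev-× (h n ≤-refl) (ev-< n (λ i i<n → h i (m≤n⇒m≤1+n i<n))))
  where
  join : ∀ s → P n s × (∀ i → i < n → P i s) → ∀ i → i < suc n → P i s
  join s (p , q) i (s≤s i≤n) with i ≟ n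
  ... | yes refl = p
  ... | no  i≢n  = q i (≤∧≢⇒< i≤n i≢n)

-- No stage gives a wrong answer, and all late stages give the right one. The limit lemma uses the
-- first half to see that correct candidates survive and the second to see that incorrect ones do
-- not.
Approximates : (ℕ → ℕ) → ℕ → Set
Approximates t y = (∀ s → t s ≡ 0 ⊎ t s ≡ suc y) × Eventually (λ s → t s ≡ suc y)

guardAll-undefined : ∀ {m} (t : Fin m → ℕ) (ys : Vec ℕ m) → (∀ i → t i ≡ 0 ⊎ t i ≡ suc (lookup ys i)) →
                     (∀ v → guardAll t v ≡ 0) ⊎ (∀ i → t i ≡ suc (lookup ys i))
guardAll-undefined t []       h = inj₂ λ ()
guardAll-undefined t (y ∷ ys) h with h zero
... | inj₁ e = inj₁ λ v → cong (λ k → guard k (guardAll (t ∘ suc) v)) e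
... | inj₂ e with guardAll-undefined (t ∘ suc) ys (h ∘ suc)
...   | inj₁ e′ = inj₁ λ v → trans (cong (λ k → guard k (guardAll (t ∘ suc) v)) e) (e′ v)
...   | inj₂ e′ = inj₂ λ { zero → e ; (suc i) → e′ i }

guardAll-defined : ∀ {m} (t : Fin m → ℕ) (ys : Vec ℕ m) → (∀ i → t i ≡ suc (lookup ys i)) →
                   ∀ v → guardAll t v ≡ v
guardAll-defined t []       h v = refl
guardAll-defined t (y ∷ ys) h v = trans (cong (λ k → guard k (guardAll (t ∘ suc) v)) (h zero)) (guardAll-defined (t ∘ suc) ys (h ∘ suc) v)

eval-approximates : ∀ {c : Rec (λ _ → ⊥) n} {xs y} → none ⊢ c · xs ⇓ y → Approximates (λ s → eval c s xs) y
eval-approximates zer         = (λ _ → inj₂ refl) , 0 , λ _ _ → refl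
eval-approximates (succ x)    = (λ _ → inj₂ refl) , 0 , λ _ _ → refl
eval-approximates (proj i xs) = (λ _ → inj₂ refl) , 0 , λ _ _ → refl
eval-approximates {xs = xs} {z} (comp {c = c} {ds} ys h c⇓) = sound , ev-map (λ s (e , e′) → complete s e e′)
    (ev-× (ev-Fin _ (λ i → proj₂ (eval-approximates (h i)))) (proj₂ (eval-approximates c⇓)))
  where
  t : ℕ → _ → ℕ
  t s i = eval (ds i) s xs
  value : ∀ s → (∀ i → t s i ≡ suc (lookup ys i)) → eval (comp c ds) s xs ≡ eval c s ys
  value s e = trans (guardAll-defined (t s) ys e _)
    (cong (eval c s) (trans (tabulate-cong λ i → cong pred (e i)) (tabulate∘lookup ys)))
  complete : ∀ s → (∀ i → t s i ≡ suc (lookup ys i)) → eval c s ys ≡ suc z → eval (comp c ds) s xs ≡ suc z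
  complete s e e′ = trans (value s e) e′
  sound : ∀ s → eval (comp c ds) s xs ≡ 0 ⊎ eval (comp c ds) s xs ≡ suc z
  sound s with guardAll-undefined (t s) ys (λ i → proj₁ (eval-approximates (h i)) s)
  ... | inj₁ e = inj₁ (e _)
  ... | inj₂ e = subst (λ k → k ≡ 0 ⊎ k ≡ suc z) (sym (value s e)) (proj₁ (eval-approximates c⇓) s)
eval-approximates (rec₀ c⇓) = eval-approximates c⇓
eval-approximates {xs = suc i ∷ xs} {z} (rec₊ {c = c} {d} {y = y} c⇓ d⇓) = sound , ev-map (λ s (e , e′) → trans (value s e) e′)
    (ev-× (proj₂ (eval-approximates c⇓)) (proj₂ (eval-approximates d⇓)))
  where
  value : ∀ s → eval (rec c d) s (i ∷ xs) ≡ suc y → eval (rec c d) s (suc i ∷ xs) ≡ eval d s (i ∷ y ∷ xs)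
  value s e = cong (λ r → guard r (eval d s (i ∷ pred r ∷ xs))) e
  sound : ∀ s → eval (rec c d) s (suc i ∷ xs) ≡ 0 ⊎ eval (rec c d) s (suc i ∷ xs) ≡ suc z
  sound s with proj₁ (eval-approximates c⇓) s
  ... | inj₁ e = inj₁ (cong (λ r → guard r (eval d s (i ∷ pred r ∷ xs))) e)
  ... | inj₂ e = subst (λ k → k ≡ 0 ⊎ k ≡ suc z) (sym (value s e)) (proj₁ (eval-approximates d⇓) s)
eval-approximates {xs = xs} {y} (mu {c = c} c⇓ h) = sound ,
    ev-map (λ s (e , e′ , y<s) → complete s e e′ y<s)
      (ev-× (ev-< y (λ z z<y → ev-map (λ s e → proj₁ (h z z<y) , e) (proj₂ (eval-approximates (proj₂ (h z z<y))))))
            (ev-× (proj₂ (eval-approximates c⇓)) (suc y , λ s s≥ → s≥)))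
  where
  r : ℕ → ℕ → ℕ
  r s = searchState c s xs
  t : ℕ → ℕ → ℕ
  t s z = eval c s (z ∷ xs)
  -- Below `y` each value met is positive or still undefined, and an undefined one freezes the state
  -- at 1. So the search is never active beyond `y` and cannot report any zero other than `y`.
  invariant : ∀ s k → (k ≤ y × r s k ≡ 0) ⊎ r s k ≡ 1 ⊎ r s k ≡ 2 + y
  invariant s zero    = inj₁ (z≤n , refl)
  invariant s (suc k) with invariant s k
  ... | inj₂ (inj₁ e) = inj₂ (inj₁ (cong (λ q → search k q (t s k)) e))
  ... | inj₂ (inj₂ e) = inj₂ (inj₂ (cong (λ q → search k q (t s k)) e))
  ... | inj₁ (k≤y , e) with k ≟ y
  ...   | yes refl with proj₁ (eval-approximates c⇓) s
  ...     | inj₁ e′ = inj₂ (inj₁ (cong₂ (search k) e e′))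
  ...     | inj₂ e′ = inj₂ (inj₂ (cong₂ (search k) e e′))
  invariant s (suc k) | inj₁ (k≤y , e) | no k≢y with proj₁ (eval-approximates (proj₂ (h k (≤∧≢⇒< k≤y k≢y)))) s
  ...     | inj₁ e′ = inj₂ (inj₁ (cong₂ (search k) e e′))
  ...     | inj₂ e′ = inj₁ (≤∧≢⇒< k≤y k≢y , cong₂ (search k) e e′)
  sound : ∀ s → pred (r s s) ≡ 0 ⊎ pred (r s s) ≡ suc y
  sound s with invariant s s
  ... | inj₁ (_ , e)  = inj₁ (cong pred e)
  ... | inj₂ (inj₁ e) = inj₁ (cong pred e)
  ... | inj₂ (inj₂ e) = inj₂ (cong pred e)
  complete : ∀ s → (∀ z → z < y → ∃ λ v → t s z ≡ 2 + v) → t s y ≡ 1 → y < s → pred (r s s) ≡ suc y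
  complete s e e′ y<s = cong pred (trans (cong (r s) (sym (m∸n+n≡m y<s))) (after (s ∸ suc y)))
    where
    before : ∀ k → k ≤ y → r s k ≡ 0
    before zero    _   = refl
    before (suc k) k<y = cong₂ (search k) (before k (<⇒≤ k<y)) (proj₂ (e k k<y))
    after : ∀ j → r s (j + suc y) ≡ 2 + y
    after zero    = cong₂ (search y) (before y ≤-refl) e′
    after (suc j) = cong (λ q → search (j + suc y) q (t s (j + suc y))) (after j)

-- The limit lemma

opaque
  leastOf : ∀ {P : ℕ → Set} → (∀ n → Dec (P n)) → ∃ P → ∃ λ n → P n × (∀ m → m < n → ¬ P m)
  leastOf {P} P? (n , p) = go n p
    where
    below : ∀ n → (∃ λ m → P m × (∀ i → i < m → ¬ P i)) ⊎ (∀ m → m < n → ¬ P m)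
    below zero    = inj₂ λ _ ()
    below (suc n) with below n
    ... | inj₁ l = inj₁ l
    ... | inj₂ h with P? n
    ...   | yes p = inj₁ (n , p , h)
    ...   | no ¬p = inj₂ λ m m<1+n q → h m (≤∧≢⇒< (s≤s⁻¹ m<1+n) (λ { refl → ¬p q })) q
    go : ∀ n → P n → ∃ λ m → P m × (∀ i → i < m → ¬ P i)
    go n p with below (suc n)
    ... | inj₁ l = l
    ... | inj₂ h = ⊥-elim (h n ≤-refl p)

-- For a predicate that holds exactly below `k`, counting its elements recovers `k`. This replaces
-- minimisation in the limit lemma: counting the `i` such that all candidates up to `i` are refuted
-- gives the least unrefuted candidate.
sum-threshold : ∀ {P : ℕ → Set} (P? : ∀ n → Dec (P n)) k b → k ≤ b →
                (∀ i → i < k → P i) → (∀ i → k ≤ i → ¬ P i) →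
                sum< b (λ i → indicator (does (P? i))) ≡ k
sum-threshold {P} P? k b k≤b lo hi =
  trans (cong (λ c → sum< c χ) (sym (m∸n+n≡m k≤b))) (trans (above (b ∸ k)) (below k ≤-refl))
  where
  χ : ℕ → ℕ
  χ i = indicator (does (P? i))
  below : ∀ j → j ≤ k → sum< j χ ≡ j
  below zero    _   = refl
  below (suc j) j<k with P? j
  ... | yes _ = cong suc (below j (<⇒≤ j<k))
  ... | no ¬p = ⊥-elim (¬p (lo j j<k))
  above : ∀ j → sum< (j + k) χ ≡ sum< k χ
  above zero    = refl
  above (suc j) with P? (j + k)
  ... | yes p = ⊥-elim (hi (j + k) (m≤n+m k j) p)
  ... | no  _ = above j

LimitOf : (ℕ → ℕ) → (ℕ → ℕ → ℕ) → Set
LimitOf f G = ∀ x → Eventually (λ s → G x s ≡ f x)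

module _ (em : ExcludedMiddle 0ℓ) where

  opaque
    -- With the graph in the form ∃u ∀v, a candidate `w` codes a u together with a value. `G x s` is
    -- the value of the least candidate not refuted by stage `s`: the least correct candidate is
    -- never refuted, and the finitely many smaller ones all are in the end.
    limit-lemma : ∀ {f} → Σ⁰ 2 none (graph f) → ∃ λ G → IsPR none (binary G) × LimitOf f G
    limit-lemma {f} (h , (c , c⇓) , f⇔) = G , PR-G , lim
      where
      value : ℕ → ℕ → ℕ → ℕ → ℕ
      value v w x s = eval c s (π₁ w ∷ v ∷ x ∷ π₂ w ∷ [])

      -- Evaluations are shifted by 1: 0 means that there is no answer yet, and 2 that the matrix
      -- has the value 1, that is, holds.
      Refuted : ℕ → ℕ → ℕ → Set
      Refuted w x s = ∃ λ v → v < s × (¬ value v w x s ≡ 0 × ¬ value v w x s ≡ 2)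

      refutedᴿ : PRel none {3} λ { (w ∷ x ∷ s ∷ []) → Refuted w x s }
      refutedᴿ = retract (∃<ᴿ (var (suc (suc zero))) (¬ᴿ (val ≡ᴿ const 0) ×ᴿ ¬ᴿ (val ≡ᴿ const 2)))
        (λ { {_ ∷ _ ∷ _ ∷ []} r → r }) (λ { {_ ∷ _ ∷ _ ∷ []} r → r })
        where
        val : IsPR none {4} λ ys → stage (eval c) (lookup ys (suc (suc (suc zero))) ∷ π₁ (lookup ys (suc zero)) ∷
                lookup ys zero ∷ lookup ys (suc (suc zero)) ∷ π₂ (lookup ys (suc zero)) ∷ [])
        val = apply (PR-eval c) (var (suc (suc (suc zero))) ∷ PR-π₁ (var (suc zero)) ∷ var zero
                                 ∷ var (suc (suc zero)) ∷ PR-π₂ (var (suc zero)) ∷ [])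

      allRefutedᴿ : PRel none {3} λ ys → ∀ w → w < suc (lookup ys zero) → Refuted w (lookup ys (suc zero)) (lookup ys (suc (suc zero)))
      allRefutedᴿ = ∀<ᴿ (PR-suc (var zero)) (applyᴿ refutedᴿ (var zero ∷ var (suc (suc zero)) ∷ var (suc (suc (suc zero))) ∷ []))

      candidate : ℕ → ℕ → ℕ
      candidate x s = sum< s (λ i → indicator (does (decide allRefutedᴿ (i ∷ x ∷ s ∷ []))))

      G : ℕ → ℕ → ℕ
      G x s = π₂ (candidate x s)

      PR-G : IsPR none (binary G)
      PR-G = ext (PR-π₂ (PR-sum (char allRefutedᴿ) (var (suc zero)))) λ { (x ∷ s ∷ []) → refl }

      module _ (x : ℕ) where

        Correct : ℕ → Set
        Correct w = ∀ v → h (π₁ w ∷ v ∷ x ∷ π₂ w ∷ []) ≡ 1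

        correct⇒value : ∀ w → Correct w → π₂ w ≡ f x
        correct⇒value w p = sym (Equivalence.from (f⇔ (x ∷ π₂ w ∷ [])) (π₁ w , p))

        correct-exists : ∃ Correct
        correct-exists with Equivalence.to (f⇔ (x ∷ f x ∷ [])) refl
        ... | u , p = pair u (f x) , λ v → trans (cong₂ (λ a b → h (a ∷ v ∷ x ∷ b ∷ [])) (π₁-pair u (f x)) (π₂-pair u (f x))) (p v)

        correct⇒unrefuted : ∀ w s → Correct w → ¬ Refuted w x s
        correct⇒unrefuted w s p (v , _ , ≢0 , ≢2) with proj₁ (eval-approximates (c⇓ (π₁ w ∷ v ∷ x ∷ π₂ w ∷ []))) s
        ... | inj₁ e = ≢0 e
        ... | inj₂ e = ≢2 (trans e (cong suc (p v)))

        incorrect⇒refuted : ∀ w → ¬ Correct w → Eventually (Refuted w x)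
        incorrect⇒refuted w ¬p with em {∃ λ v → ¬ h (π₁ w ∷ v ∷ x ∷ π₂ w ∷ []) ≡ 1}
        ... | no  ∄ = ⊥-elim (¬p λ v → decidable-stable (_ ≟ 1) (λ ≢ → ∄ (v , ≢)))
        ... | yes (v , ≢1) = ev-map
          (λ s (e , v<s) → v , v<s , (λ e′ → 1+n≢0 (trans (sym e) e′)) , λ e′ → ≢1 (suc-injective (trans (sym e) e′)))
          (ev-× (proj₂ (eval-approximates (c⇓ (π₁ w ∷ v ∷ x ∷ π₂ w ∷ [])))) (suc v , λ s s≥ → s≥))

        lim : Eventually (λ s → G x s ≡ f x)
        lim with leastOf (λ w → em {Correct w}) correct-exists
        ... | w , p , <w⇒¬p = ev-map stable (ev-× (ev-< w (λ i i<w → incorrect⇒refuted i (<w⇒¬p i i<w))) (w , λ s s≥ → s≥))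
          where
          stable : ∀ s → (∀ i → i < w → Refuted i x s) × w ≤ s → G x s ≡ f x
          stable s (refuted , w≤s) = trans
            (cong π₂ (sum-threshold (λ i → decide allRefutedᴿ (i ∷ x ∷ s ∷ [])) w s w≤s
              (λ i i<w j j≤i → refuted j (≤-<-trans (s≤s⁻¹ j≤i) i<w))
              (λ i w≤i all → correct⇒unrefuted w s p (all w (s≤s w≤i)))))
            (correct⇒value w p)

-- Orbits

iter : (X → X) → ℕ → X → X
iter f n x = fold x f n

SameOrbit : (X → X) → X → X → Set
SameOrbit f x y = ∃ λ p → ∃ λ q → iter f p x ≡ iter f q y

-- An injective map has three kinds of orbits: cycles, ω-chains, which have a root, and ζ-chains,
-- which are deep. Cycles are deep too, so ζ-chains are recognised as deep and not periodic.
Periodic Deep Root : (X → X) → X → Set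
Periodic f x = ∃ λ k → iter f (suc k) x ≡ x
Deep     f x = ∀ p → ∃ λ u → iter f p u ≡ x
Root     f x = ∀ u → ¬ f u ≡ x

record Iso {X Y : Set} (f : X → X) (g : Y → Y) : Set where
  field
    to      : X → Y
    from    : Y → X
    to-from : ∀ y → to (from y) ≡ y
    from-to : ∀ x → from (to x) ≡ x
    homo    : ∀ x → to (f x) ≡ g (to x)

  to-injective : ∀ {x x′} → to x ≡ to x′ → x ≡ x′
  to-injective {x} {x′} e = trans (sym (from-to x)) (trans (cong from e) (from-to x′))

  homo-iter : ∀ n x → to (iter f n x) ≡ iter g n (to x)
  homo-iter zero    x = refl
  homo-iter (suc n) x = trans (homo _) (cong g (homo-iter n x))

Iso-sym : {f : X → X} {g : Y → Y} → Iso f g → Iso g f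
Iso-sym {f = f} {g} φ = record
  { to = from ; from = to ; to-from = from-to ; from-to = to-from
  ; homo = λ y → to-injective (trans (to-from (g y)) (trans (cong g (sym (to-from y))) (sym (homo (from y)))))
  }
  where open Iso φ

Iso-trans : {f : X → X} {g : Y → Y} {h : Z → Z} → Iso f g → Iso g h → Iso f h
Iso-trans φ ψ = record
  { to = Iso.to ψ ∘ Iso.to φ ; from = Iso.from φ ∘ Iso.from ψ
  ; to-from = λ z → trans (cong (Iso.to ψ) (Iso.to-from φ _)) (Iso.to-from ψ z)
  ; from-to = λ x → trans (cong (Iso.from φ) (Iso.from-to ψ _)) (Iso.from-to φ x)
  ; homo = λ x → trans (cong (Iso.to ψ) (Iso.homo φ x)) (Iso.homo ψ _)
  }

≅⇒Iso : ∀ {A B} → A ≅ B → Iso (op A) (op B)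
≅⇒Iso φ = record
  { to = to ; from = from ; to-from = Inverse.strictlyInverseˡ bijection
  ; from-to = Inverse.strictlyInverseʳ bijection ; homo = homo }
  where open _≅_ φ

Iso⇒≅ : ∀ {A B} → Iso (op A) (op B) → A ≅ B
Iso⇒≅ φ = record { bijection = mk↔ₛ′ to from to-from from-to ; homo = homo }
  where open Iso φ

iter-+ : ∀ (f : X → X) m n x → iter f (m + n) x ≡ iter f m (iter f n x)
iter-+ f zero    n x = refl
iter-+ f (suc m) n x = cong f (iter-+ f m n x)

iter-comm : ∀ (f : X → X) m n x → iter f m (iter f n x) ≡ iter f n (iter f m x)
iter-comm f m n x = trans (sym (iter-+ f m n x)) (trans (cong (λ k → iter f k x) (+-comm m n)) (iter-+ f n m x))

iter-suc : ∀ (f : X → X) n x → iter f n (f x) ≡ iter f (suc n) x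
iter-suc f n x = iter-comm f n 1 x

module _ {f : X → X} where

  ~-refl : ∀ {x} → SameOrbit f x x
  ~-refl = 0 , 0 , refl

  ~-sym : ∀ {x y} → SameOrbit f x y → SameOrbit f y x
  ~-sym (p , q , e) = q , p , sym e

  ~-trans : ∀ {x y z} → SameOrbit f x y → SameOrbit f y z → SameOrbit f x z
  ~-trans {x} {y} {z} (p , q , e) (r , s , e′) = r + p , q + s , (begin
    iter f (r + p) x        ≡⟨ iter-+ f r p x ⟩
    iter f r (iter f p x)   ≡⟨ cong (iter f r) e ⟩
    iter f r (iter f q y)   ≡⟨ iter-comm f r q y ⟩
    iter f q (iter f r y)   ≡⟨ cong (iter f q) e′ ⟩
    iter f q (iter f s z)   ≡⟨ sym (iter-+ f q s z) ⟩
    iter f (q + s) z        ∎)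
    where open ≡-Reasoning

  ~-iter : ∀ n {x y} → iter f n x ≡ y → SameOrbit f x y
  ~-iter n e = n , 0 , e

  ~-step : ∀ {x y} → f x ≡ y → SameOrbit f x y
  ~-step = ~-iter 1

  module _ (f-inj : Injective _≡_ _≡_ f) where

    iter-injective : ∀ n {x y} → iter f n x ≡ iter f n y → x ≡ y
    iter-injective zero    e = e
    iter-injective (suc n) e = iter-injective n (f-inj e)

    -- Injectivity cancels the smaller exponent, so of two elements of one orbit one is an iterate
    -- of the other.
    ~-compare : ∀ {x y} p q → iter f p x ≡ iter f q y →
                (x ≡ iter f (q ∸ p) y × p ≤ q) ⊎ (iter f (p ∸ q) x ≡ y × q ≤ p)
    ~-compare zero    q       e = inj₁ (e , z≤n)
    ~-compare (suc p) zero    e = inj₂ (e , z≤n)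
    ~-compare (suc p) (suc q) e with ~-compare p q (f-inj e)
    ... | inj₁ (e′ , p≤q) = inj₁ (e′ , s≤s p≤q)
    ... | inj₂ (e′ , q≤p) = inj₂ (e′ , s≤s q≤p)

    Deep-step : ∀ {x} → Deep f x → Deep f (f x)
    Deep-step d zero    = _ , refl
    Deep-step d (suc p) = proj₁ (d p) , cong f (proj₂ (d p))

    Deep-back : ∀ {x} → Deep f (f x) → Deep f x
    Deep-back d p = proj₁ (d (suc p)) , f-inj (proj₂ (d (suc p)))

    Periodic-step : ∀ {x} → Periodic f x → Periodic f (f x)
    Periodic-step {x} (k , e) = k , trans (iter-suc f (suc k) x) (cong f e)

    Periodic-back : ∀ {x} → Periodic f (f x) → Periodic f x
    Periodic-back {x} (k , e) = k , f-inj (trans (sym (iter-suc f (suc k) x)) e)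

    module _ (P : X → Set) (step : ∀ {x} → P x → P (f x)) (back : ∀ {x} → P (f x) → P x) where

      orbit-invariant : ∀ {x y} → SameOrbit f x y → P x → P y
      orbit-invariant {x} {y} (p , q , e) px = backs q (subst P e (steps p px))
        where
        steps : ∀ n {x} → P x → P (iter f n x)
        steps zero    px = px
        steps (suc n) px = step (steps n px)
        backs : ∀ n {x} → P (iter f n x) → P x
        backs zero    px = px
        backs (suc n) px = backs n (back px)

    Deep-~ : ∀ {x y} → SameOrbit f x y → Deep f x → Deep f y
    Deep-~ = orbit-invariant (Deep f) Deep-step Deep-back

    Periodic-~ : ∀ {x y} → SameOrbit f x y → Periodic f x → Periodic f y
    Periodic-~ = orbit-invariant (Periodic f) Periodic-step Periodic-back

    iter-exponent : ∀ {x} p q → ¬ Periodic f x → iter f p x ≡ iter f q x → p ≡ q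
    iter-exponent zero    zero    ¬per e = refl
    iter-exponent zero    (suc q) ¬per e = ⊥-elim (¬per (q , sym e))
    iter-exponent (suc p) zero    ¬per e = ⊥-elim (¬per (p , e))
    iter-exponent (suc p) (suc q) ¬per e = cong suc (iter-exponent p q ¬per (f-inj e))

    Root-unique : ∀ {x y} → Root f x → Root f y → SameOrbit f x y → x ≡ y
    Root-unique {x} {y} rx ry (p , q , e) with ~-compare p q e
    ... | inj₁ (e′ , _) = lem (q ∸ p) e′
      where
      lem : ∀ n → x ≡ iter f n y → x ≡ y
      lem zero    e = e
      lem (suc n) e = ⊥-elim (rx _ (sym e))
    ... | inj₂ (e′ , _) = lem (p ∸ q) e′
      where
      lem : ∀ n → iter f n x ≡ y → x ≡ y
      lem zero    e = e
      lem (suc n) e = ⊥-elim (ry _ e)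

  Root⇒¬Periodic : ∀ {x} → Root f x → ¬ Periodic f x
  Root⇒¬Periodic r (k , e) = r _ e

  Root⇒¬Deep : ∀ {x} → Root f x → ¬ Deep f x
  Root⇒¬Deep r d = r _ (proj₂ (d 1))

  Periodic⇒Deep : ∀ {x} → Periodic f x → Deep f x
  Periodic⇒Deep {x} (k , e) zero    = x , refl
  Periodic⇒Deep {x} (k , e) (suc p) with Periodic⇒Deep (k , e) p
  ... | u , e′ = iter f k u , (begin
    f (iter f p (iter f k u)) ≡⟨ iter-comm f (suc p) k u ⟩
    iter f k (iter f (suc p) u) ≡⟨ cong (iter f k ∘ f) e′ ⟩
    iter f k (f x)            ≡⟨ iter-suc f k x ⟩
    iter f (suc k) x          ≡⟨ e ⟩
    x                         ∎)
    where open ≡-Reasoning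

  -- If `x` is not deep, take the least p such that `x` has no p-fold preimage; a (p - 1)-fold
  -- preimage is then a root.
  Deep-or-Root : ExcludedMiddle 0ℓ → ∀ x → Deep f x ⊎ ∃ λ r → Root f r × SameOrbit f x r
  Deep-or-Root em x with em {∃ λ p → ¬ ∃ λ u → iter f p u ≡ x}
  ... | no  ∄ = inj₁ λ p → decidable-stable em (λ ¬∃ → ∄ (p , ¬∃))
  ... | yes ∃p with leastOf (λ _ → em) ∃p
  ...   | zero  , ¬∃ , _     = ⊥-elim (¬∃ (x , refl))
  ...   | suc p , ¬∃ , least with decidable-stable em (least p ≤-refl)
  ...     | u , e = inj₂ (u , (λ v fv≡u → ¬∃ (v , trans (sym (iter-suc f p v)) (trans (cong (iter f p) fv≡u) e)))
                            , ~-sym (~-iter p e))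

module _ {f : X → X} {g : Y → Y} (φ : Iso f g) where
  open Iso φ

  Iso-Deep : ∀ {x} → Deep f x → Deep g (to x)
  Iso-Deep d p = to (proj₁ (d p)) , trans (sym (homo-iter p _)) (cong to (proj₂ (d p)))

  Iso-Periodic : ∀ {x} → Periodic f x → Periodic g (to x)
  Iso-Periodic (k , e) = k , trans (sym (homo-iter (suc k) _)) (cong to e)

  Iso-~ : ∀ {x y} → SameOrbit f x y → SameOrbit g (to x) (to y)
  Iso-~ (p , q , e) = p , q , trans (sym (homo-iter p _)) (trans (cong to e) (homo-iter q _))

  Iso-injective : Injective _≡_ _≡_ g → Injective _≡_ _≡_ f
  Iso-injective g-inj e = to-injective (g-inj (trans (sym (homo _)) (trans (cong to e) (homo _))))

module _ {f : X → X} {g : Y → Y} (φ : Iso f g) where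
  open Iso φ

  Iso-Deep⁻ : ∀ {x} → Deep g (to x) → Deep f x
  Iso-Deep⁻ d = subst (Deep f) (from-to _) (Iso-Deep (Iso-sym φ) d)

  Iso-Periodic⁻ : ∀ {x} → Periodic g (to x) → Periodic f x
  Iso-Periodic⁻ d = subst (Periodic f) (from-to _) (Iso-Periodic (Iso-sym φ) d)

  Iso-~⁻ : ∀ {x y} → SameOrbit g (to x) (to y) → SameOrbit f x y
  Iso-~⁻ r = subst₂ (SameOrbit f) (from-to _) (from-to _) (Iso-~ (Iso-sym φ) r)

-- Isomorphisms from matchings of orbit representatives

-- One direction of a matching of orbit representatives. `exponents` makes the induced map well
-- defined on a cycle; `preimages` lets it extend to the elements that precede the representative.
record Matches {X Y : Set} (f : X → X) (g : Y → Y) (M : X → Y → Set) : Set where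
  field
    total     : ∀ x → ∃ λ a → ∃ λ b → M a b × SameOrbit f x a
    unique    : ∀ {a b a′ b′} → M a b → M a′ b′ → SameOrbit f a a′ → a ≡ a′ × b ≡ b′
    exponents : ∀ {a b} → M a b → ∀ p q → iter f p a ≡ iter f q a → iter g p b ≡ iter g q b
    preimages : ∀ {a b} → M a b → ∀ p → (∃ λ u → iter f p u ≡ a) → ∃ λ v → iter g p v ≡ b

-- The exponents are the same on both sides: `y` lies relative to `b` as `x` lies relative to `a`.
-- Stated with existential quantifiers only, the relation is Σ₁ whenever `M` is.
Corresponds : (X → X) → (Y → Y) → (X → Y → Set) → X → Y → Set
Corresponds f g M x y =
  ∃ λ a → ∃ λ b → ∃ λ p → ∃ λ q → M a b × iter f p x ≡ iter f q a × iter g p y ≡ iter g q b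

Corresponds-flip : {f : X → X} {g : Y → Y} {M : X → Y → Set} → ∀ {x y} →
                   Corresponds f g M x y → Corresponds g f (flip M) y x
Corresponds-flip (a , b , p , q , m , e , e′) = b , a , p , q , m , e′ , e

module _ {f : X → X} {g : Y → Y} {M : X → Y → Set}
         (f-inj : Injective _≡_ _≡_ f) (g-inj : Injective _≡_ _≡_ g) (match : Matches f g M) where
  open Matches match

  opaque
    Corresponds-total : ∀ x → ∃ λ y → Corresponds f g M x y
    Corresponds-total x with total x
    ... | a , b , m , p , q , e with ~-compare f-inj p q e
    ...   | inj₁ (e′ , _) = _ , a , b , 0 , q ∸ p , m , e′ , refl
    -- Here `x` is a `(p ∸ q)`-fold preimage of `a`, so `b` must have an equally remote one.
    ...   | inj₂ (e′ , _) with preimages m (p ∸ q) (x , e′)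
    ...     | v , e″ = v , a , b , p ∸ q , 0 , m , e′ , e″

  Corresponds-functional : ∀ {x y y′} → Corresponds f g M x y → Corresponds f g M x y′ → y ≡ y′
  Corresponds-functional {x} {y} {y′} (a , b , p , q , m , e , d) (a′ , b′ , p′ , q′ , m′ , e′ , d′)
    with unique m m′ (~-trans (~-sym (p , q , e)) (p′ , q′ , e′))
  ... | refl , refl = iter-injective g-inj (p′ + p) (begin
    iter g (p′ + p) y        ≡⟨ iter-+ g p′ p y ⟩
    iter g p′ (iter g p y)   ≡⟨ cong (iter g p′) d ⟩
    iter g p′ (iter g q b)   ≡⟨ sym (iter-+ g p′ q b) ⟩
    iter g (p′ + q) b        ≡⟨ exponents m (p′ + q) (p + q′) exponents-a ⟩
    iter g (p + q′) b        ≡⟨ iter-+ g p q′ b ⟩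
    iter g p (iter g q′ b)   ≡⟨ cong (iter g p) (sym d′) ⟩
    iter g p (iter g p′ y′)  ≡⟨ iter-comm g p p′ y′ ⟩
    iter g p′ (iter g p y′)  ≡⟨ sym (iter-+ g p′ p y′) ⟩
    iter g (p′ + p) y′       ∎)
    where
    open ≡-Reasoning
    exponents-a : iter f (p′ + q) a ≡ iter f (p + q′) a
    exponents-a = begin
      iter f (p′ + q) a       ≡⟨ iter-+ f p′ q a ⟩
      iter f p′ (iter f q a)  ≡⟨ cong (iter f p′) (sym e) ⟩
      iter f p′ (iter f p x)  ≡⟨ iter-comm f p′ p x ⟩
      iter f p (iter f p′ x)  ≡⟨ cong (iter f p) e′ ⟩
      iter f p (iter f q′ a)  ≡⟨ sym (iter-+ f p q′ a) ⟩
      iter f (p + q′) a       ∎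

  Corresponds-step : ∀ {x y} → Corresponds f g M x y → Corresponds f g M (f x) (g y)
  Corresponds-step {x} {y} (a , b , p , q , m , e , d) = a , b , p , suc q , m ,
    trans (iter-suc f p x) (cong f e) , trans (iter-suc g p y) (cong g d)

module _ {f : X → X} {g : Y → Y} {M : X → Y → Set} (f-inj : Injective _≡_ _≡_ f) (g-inj : Injective _≡_ _≡_ g)
         (match : Matches f g M) (match′ : Matches g f (flip M)) where

  opaque
    -- The inclusion in `Corresponds` is returned as well, since it is what bounds the complexity of
    -- the graph.
    matching-iso : Σ (Iso f g) λ φ → ∀ x → Corresponds f g M x (Iso.to φ x)
    matching-iso = record
      { to      = to
      ; from    = from
      ; to-from = λ y → Corresponds-functional f-inj g-inj match (to-R (from y)) (Corresponds-flip (from-R y))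
      ; from-to = λ x → Corresponds-functional g-inj f-inj match′ (from-R (to x)) (Corresponds-flip (to-R x))
      ; homo    = λ x → Corresponds-functional f-inj g-inj match (to-R (f x)) (Corresponds-step f-inj g-inj match (to-R x))
      } , to-R
      where
      to : X → Y
      to x = proj₁ (Corresponds-total f-inj g-inj match x)
      to-R : ∀ x → Corresponds f g M x (to x)
      to-R x = proj₂ (Corresponds-total f-inj g-inj match x)
      from : Y → X
      from y = proj₁ (Corresponds-total g-inj f-inj match′ y)
      from-R : ∀ y → Corresponds g f (flip M) y (from y)
      from-R y = proj₂ (Corresponds-total g-inj f-inj match′ y)

-- Counting

≤-sum : ∀ (f : ℕ → ℕ) {i b} → i < b → f i ≤ sum< b f
≤-sum f {i} {suc b} (s≤s i≤b) with i ≟ b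
... | yes refl = m≤m+n _ _
... | no  i≢b  = ≤-trans (≤-sum f (≤∧≢⇒< i≤b i≢b)) (m≤n+m _ (f b))

count : (∀ n → Dec (P n)) → ℕ → ℕ
count P? n = sum< n (λ i → indicator (does (P? i)))

count-suc : (P? : ∀ n → Dec (P n)) → ∀ {a} → P a → count P? (suc a) ≡ suc (count P? a)
count-suc P? {a} p with P? a
... | yes _ = refl
... | no ¬p = ⊥-elim (¬p p)

count-mono : (P? : ∀ n → Dec (P n)) → ∀ {m n} → m ≤ n → count P? m ≤ count P? n
count-mono P? {m} {n} m≤n = subst (λ k → count P? m ≤ count P? k) (m∸n+n≡m m≤n) (lem (n ∸ m))
  where
  lem : ∀ k → count P? m ≤ count P? (k + m)
  lem zero    = ≤-refl
  lem (suc k) = ≤-trans (lem k) (m≤n+m _ _)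

count-< : (P? : ∀ n → Dec (P n)) → ∀ {a n} → P a → a < n → count P? a < count P? n
count-< P? p a<n = ≤-trans (≤-reflexive (sym (count-suc P? p))) (count-mono P? a<n)

count-injective : (P? : ∀ n → Dec (P n)) → ∀ {a b} → P a → P b → count P? a ≡ count P? b → a ≡ b
count-injective P? {a} {b} pa pb e with <-cmp a b
... | tri≈ _ a≡b _ = a≡b
... | tri< a<b _ _ = ⊥-elim (<-irrefl e (count-< P? pa a<b))
... | tri> _ _ b<a = ⊥-elim (<-irrefl (sym e) (count-< P? pb b<a))

opaque
  count-nth : (P? : ∀ n → Dec (P n)) → ∀ {i} n → i < count P? n → ∃ λ a → P a × count P? a ≡ i
  count-nth P? {i} (suc n) i< with P? n
  ... | no  _ = count-nth P? n i<
  ... | yes p with i ≟ count P? n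
  ...   | yes refl = n , p , refl
  ...   | no  i≢   = count-nth P? n (≤∧≢⇒< (s≤s⁻¹ i<) i≢)

opaque
  count-infinite : (P? : ∀ n → Dec (P n)) → (∀ n → ∃ λ a → n ≤ a × P a) → ∀ i → ∃ λ a → P a × count P? a ≡ i
  count-infinite P? inf i = count-nth P? (proj₁ (exceeds i)) (proj₂ (exceeds i))
    where
    exceeds : ∀ i → ∃ λ n → i < count P? n
    exceeds zero    with inf 0
    ... | a , _ , p = suc a , ≤-trans (s≤s z≤n) (≤-reflexive (sym (count-suc P? p)))
    exceeds (suc i) with exceeds i
    ... | n , i<n with inf n
    ...   | a , n≤a , p = suc a , ≤-trans (s≤s (≤-trans i<n (count-mono P? n≤a))) (≤-reflexive (sym (count-suc P? p)))

count-remove : (Q? : ∀ n → Dec (Q n)) → ∀ {c n} → Q c → c < n →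
               count Q? n ≡ suc (count (λ i → Q? i ×-dec ¬? (i ≟ c)) n)
count-remove {Q = Q} Q? {c} {n} q c<n = trans (cong (count Q?) (sym (m∸n+n≡m c<n)))
  (trans (above (n ∸ suc c)) (cong (suc ∘ count R?) (m∸n+n≡m c<n)))
  where
  R? : ∀ i → Dec (Q i × ¬ i ≡ c)
  R? i = Q? i ×-dec ¬? (i ≟ c)
  agree : ∀ i → ¬ i ≡ c → does (Q? i) ≡ does (R? i)
  agree i i≢c = does-⇔ (mk⇔ (λ q → q , i≢c) proj₁) (Q? i) (R? i)
  below : ∀ n → n ≤ c → count Q? n ≡ count R? n
  below zero    _   = refl
  below (suc n) n<c = cong₂ (λ b k → indicator b + k) (agree n (<⇒≢ n<c)) (below n (<⇒≤ n<c))
  above : ∀ k → count Q? (k + suc c) ≡ suc (count R? (k + suc c))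
  above zero    = trans (count-suc Q? q) (cong suc (trans (below c ≤-refl)
    (sym (cong (λ b → indicator b + count R? c) (dec-false (R? c) λ (_ , c≢c) → c≢c refl)))))
  above (suc k) = trans
    (cong₂ (λ b k → indicator b + k) (agree (k + suc c) (λ e → <-irrefl (sym e) (m≤n+m (suc c) k))) (above k))
    (+-suc _ _)

-- Whenever `n` itself is counted, its image is removed from `Q`, and injectivity keeps the smaller
-- elements mapped into the rest.
count-embed : ∀ n N (P? : ∀ n → Dec (P n)) (Q? : ∀ n → Dec (Q n)) (h : ℕ → ℕ) →
              (∀ {a} → P a → a < n → Q (h a) × h a < N) →
              (∀ {a b} → P a → P b → h a ≡ h b → a ≡ b) →
              count P? n ≤ count Q? N
count-embed zero    N P? Q? h into inj = z≤n
count-embed (suc n) N P? Q? h into inj with P? n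
... | no  _ = count-embed n N P? Q? h (λ p a<n → into p (m≤n⇒m≤1+n a<n)) inj
... | yes p = ≤-trans
  (s≤s (count-embed n N P? (λ i → Q? i ×-dec ¬? (i ≟ h n)) h
    (λ q a<n → (proj₁ (into q (m≤n⇒m≤1+n a<n)) , λ e → <-irrefl (inj q p e) a<n) , proj₂ (into q (m≤n⇒m≤1+n a<n))) inj))
  (≤-reflexive (sym (count-remove Q? (proj₁ (into p ≤-refl)) (proj₂ (into p ≤-refl)))))

opaque
  -- The injection need not respect the order. It only shows that `Q` has more elements than `P` has
  -- below `a`, hence one with the same number of predecessors. A sum of successors serves as a
  -- strict bound `N` for the images.
  count-transfer : (P? : ∀ n → Dec (P n)) (Q? : ∀ n → Dec (Q n)) (h : ∀ a → P a → ∃ Q) →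
                   (∀ {a b} (p : P a) (q : P b) → proj₁ (h a p) ≡ proj₁ (h b q) → a ≡ b) →
                   ∀ {a} → P a → ∃ λ b → Q b × count Q? b ≡ count P? a
  count-transfer {P = P} {Q} P? Q? h inj {a} p = count-nth Q? N (<-≤-trans (count-< P? p ≤-refl)
    (count-embed (suc a) N P? Q? h′ (λ q c≤a → into q , ≤-sum (suc ∘ h′) c≤a) h′-inj))
    where
    image : ∀ a → Dec (P a) → ℕ
    image a (yes p) = proj₁ (h a p)
    image a (no ¬p) = 0
    h′ : ℕ → ℕ
    h′ a = image a (P? a)
    N : ℕ
    N = sum< (suc a) (suc ∘ h′)
    into : ∀ {c} → P c → Q (h′ c)
    into {c} q with P? c
    ... | yes p = proj₂ (h c p)
    ... | no ¬p = ⊥-elim (¬p q)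
    h′-inj : ∀ {c d} → P c → P d → h′ c ≡ h′ d → c ≡ d
    h′-inj {c} {d} p q e with P? c | P? d
    ... | yes p′ | yes q′ = inj p′ q′ e
    ... | no ¬p  | _      = ⊥-elim (¬p p)
    ... | yes _  | no ¬q  = ⊥-elim (¬q q)

-- Cycles

Period : (X → X) → X → ℕ → Set
Period f a k = 0 < k × iter f k a ≡ a × (∀ j → j < k → 0 < j → ¬ iter f j a ≡ a)

-- The canonical element of a cycle. Once the length `k` is given all quantifiers are bounded, so
-- the relation is primitive recursive in `SameIterate`.
CycleLeast : (ℕ → ℕ) → ℕ → ℕ → Set
CycleLeast f k a = Period f a k × (∀ b → b < a → ¬ ∃ λ j → j < k × iter f j a ≡ b)

Period⇒Periodic : {f : X → X} → ∀ {a k} → Period f a k → Periodic f a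
Period⇒Periodic {k = suc k} (_ , e , _) = k , e

Period-unique : {f : X → X} → ∀ {a k l} → Period f a k → Period f a l → k ≡ l
Period-unique {k = k} {l} (0<k , e , h) (0<l , e′ , h′) with <-cmp k l
... | tri≈ _ k≡l _ = k≡l
... | tri< k<l _ _ = ⊥-elim (h′ k k<l 0<k e)
... | tri> _ _ l<k = ⊥-elim (h l l<k 0<l e′)

Iso-Period : {f : X → X} {g : Y → Y} (φ : Iso f g) → ∀ {a k} → Period f a k → Period g (Iso.to φ a) k
Iso-Period φ {a} {k} (0<k , e , h) = 0<k , trans (sym (homo-iter k a)) (cong to e) ,
  λ j j<k 0<j e′ → h j j<k 0<j (to-injective (trans (homo-iter j a) e′))
  where open Iso φ

module _ {f : X → X} (f-inj : Injective _≡_ _≡_ f) where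

  Period-~ : ∀ {x y k} → SameOrbit f x y → Period f x k → Period f y k
  Period-~ {k = k} = orbit-invariant f-inj (λ x → Period f x k)
    (λ {x} (0<k , e , h) → 0<k , trans (iter-suc f k x) (cong f e) ,
      λ j j<k 0<j e′ → h j j<k 0<j (f-inj (trans (sym (iter-suc f j x)) e′)))
    (λ {x} (0<k , e , h) → 0<k , f-inj (trans (sym (iter-suc f k x)) e) ,
      λ j j<k 0<j e′ → h j j<k 0<j (trans (iter-suc f j x) (cong f e′)))

  Period-orbit : ∀ {x y k} → Period f x k → SameOrbit f x y → ∃ λ j → j < k × iter f j x ≡ y
  Period-orbit {x} {k = suc k} (0<k , e , h) x~y =
    orbit-invariant f-inj (λ y → ∃ λ j → j < suc k × iter f j x ≡ y) forward backward x~y (0 , 0<k , refl)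
    where
    forward : ∀ {y} → (∃ λ j → j < suc k × iter f j x ≡ y) → ∃ λ j → j < suc k × iter f j x ≡ f y
    forward (j , j<k , e′) with j ≟ k
    ... | yes refl = 0 , 0<k , trans (sym e) (cong f e′)
    ... | no  j≢k  = suc j , s≤s (≤∧≢⇒< (s≤s⁻¹ j<k) j≢k) , cong f e′
    backward : ∀ {y} → (∃ λ j → j < suc k × iter f j x ≡ f y) → ∃ λ j → j < suc k × iter f j x ≡ y
    backward (zero  , _   , e′) = k , ≤-refl , f-inj (trans e e′)
    backward (suc j , j<k , e′) = j , <⇒≤ j<k , f-inj e′

  Period-exponent : ∀ {x k} → Period f x k → ∀ n → iter f n x ≡ x → ∃ λ q → n ≡ q * k
  Period-exponent {x} {suc k} (_ , e , h) n en with n % suc k in eq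
  ... | zero  = n / suc k , trans (m≡m%n+[m/n]*n n (suc k)) (cong (_+ n / suc k * suc k) eq)
  ... | suc r = ⊥-elim (h (n % suc k) (m%n<n n (suc k)) (subst (0 <_) (sym eq) (s≤s z≤n)) (begin
    iter f (n % suc k) x                                ≡⟨ cong (iter f (n % suc k)) (sym (multiple (n / suc k))) ⟩
    iter f (n % suc k) (iter f (n / suc k * suc k) x)   ≡⟨ sym (iter-+ f (n % suc k) _ x) ⟩
    iter f (n % suc k + n / suc k * suc k) x            ≡⟨ cong (λ m → iter f m x) (sym (m≡m%n+[m/n]*n n (suc k))) ⟩
    iter f n x                                          ≡⟨ en ⟩
    x                                                   ∎))
    where
    open ≡-Reasoning
    multiple : ∀ q → iter f (q * suc k) x ≡ x
    multiple zero    = refl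
    multiple (suc q) = trans (iter-+ f (suc k) (q * suc k) x) (trans (cong (iter f (suc k)) (multiple q)) e)

iter-multiple : {f : X → X} → ∀ {x k} → Period f x k → ∀ q → iter f (q * k) x ≡ x
iter-multiple p zero    = refl
iter-multiple {f = f} {x} {k} p@(_ , e , _) (suc q) =
  trans (iter-+ f k (q * k) x) (trans (cong (iter f k) (iter-multiple p q)) e)

-- The two exponents differ by a multiple of the common period.
Period-exponents : {f : X → X} {g : Y → Y} → Injective _≡_ _≡_ f → ∀ {a b k} → Period f a k → Period g b k →
                   ∀ p q → iter f p a ≡ iter f q a → iter g p b ≡ iter g q b
Period-exponents {f = f} {g} f-inj {a} {b} pa pb p q e with ~-compare f-inj p q e
... | inj₁ (e′ , p≤q) with Period-exponent f-inj pa (q ∸ p) (sym e′)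
...   | r , e″ = trans (cong (iter g p) (sym (trans (cong (λ n → iter g n b) e″) (iter-multiple pb r))))
                       (trans (sym (iter-+ g p (q ∸ p) b)) (cong (λ n → iter g n b) (m+[n∸m]≡n p≤q)))
Period-exponents {f = f} {g} f-inj {a} {b} pa pb p q e | inj₂ (e′ , q≤p) with Period-exponent f-inj pa (p ∸ q) e′
...   | r , e″ = sym (trans (cong (iter g q) (sym (trans (cong (λ n → iter g n b) e″) (iter-multiple pb r))))
                       (trans (sym (iter-+ g q (p ∸ q) b)) (cong (λ n → iter g n b) (m+[n∸m]≡n q≤p))))

CycleLeast-unique : ∀ {f} → Injective _≡_ _≡_ f → ∀ {k l a b} → CycleLeast f k a → CycleLeast f l b →
                    SameOrbit f a b → a ≡ b × k ≡ l
CycleLeast-unique {f} f-inj {k} {l} {a} {b} (pa , ha) (pb , hb) a~b = a≡b , Period-unique pa (Period-~ f-inj (~-sym a~b) pb)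
  where
  a≡b : a ≡ b
  a≡b with <-cmp a b
  ... | tri≈ _ e _ = e
  ... | tri< a<b _ _ = ⊥-elim (hb a a<b (Period-orbit f-inj pb (~-sym a~b)))
  ... | tri> _ _ b<a = ⊥-elim (ha b b<a (Period-orbit f-inj pa a~b))

module _ (em : ExcludedMiddle 0ℓ) where

  Periodic⇒Period : {f : X → X} → ∀ {x} → Periodic f x → ∃ λ k → Period f x k
  Periodic⇒Period {f = f} {x} (k , e) with leastOf {λ k → 0 < k × iter f k x ≡ x} (λ _ → em) (suc k , s≤s z≤n , e)
  ... | l , (0<l , e′) , h = l , 0<l , e′ , λ j j<l 0<j e″ → h j j<l (0<j , e″)

  CycleLeast-exists : ∀ {f} → Injective _≡_ _≡_ f → ∀ {x k} → Period f x k → ∃ λ a → CycleLeast f k a × SameOrbit f x a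
  CycleLeast-exists {f} f-inj {x} {k} p with leastOf {SameOrbit f x} (λ _ → em) (x , ~-refl)
  ... | a , x~a , h = a , (Period-~ f-inj x~a p , λ b b<a (j , _ , e) → h b b<a (~-trans x~a (~-iter j e))) , x~a

-- Arguments as in the atomic diagram.
SameIterate : (ℕ → ℕ) → Vec ℕ 4 → Set
SameIterate f xs = iter f (lookup xs zero) (lookup xs (suc zero)) ≡
                   iter f (lookup xs (suc (suc zero))) (lookup xs (suc (suc (suc zero))))

PR-iter : {α : Oracle O} {f : ℕ → ℕ} → IsPR α (unary f) → {g h : Vec ℕ n → ℕ} → IsPR α g → IsPR α h →
          IsPR α (λ xs → iter f (g xs) (h xs))
PR-iter {f = f} p {g} {h} q r = ext (PR-natrec r (apply p (v₁ ∷ [])) q) (λ xs → lem (g xs) (h xs))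
  where
  lem : ∀ n x → natrec x (λ _ → f) n ≡ iter f n x
  lem zero    x = refl
  lem (suc n) x = cong f (lem n x)

sameIterateᴿ : {α : Oracle O} {f : ℕ → ℕ} → IsPR α (unary f) → PRel α (SameIterate f)
sameIterateᴿ p = PR-iter p v₀ v₁ ≡ᴿ PR-iter p v₂ v₃

diagramᴿ : ∀ B → PRel (single (atomicDiagram B)) (SameIterate (op B))
diagramᴿ B = prel (λ xs → _ ≟ _) (ext (isPR (basic refl) λ _ → refl) λ { (_ ∷ _ ∷ _ ∷ _ ∷ []) → refl })

module _ {α : Oracle O} {f : ℕ → ℕ} (S : PRel α (SameIterate f)) where

  opaque
    periodᴿ : PRel α {2} (λ xs → Period f (lookup xs zero) (lookup xs (suc zero)))
    periodᴿ = (const 0 <ᴿ v₁) ×ᴿ applyᴿ S (v₁ ∷ v₀ ∷ const 0 ∷ v₀ ∷ [])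
           ×ᴿ ∀<ᴿ v₁ ((const 0 <ᴿ v₀) →ᴿ ¬ᴿ (applyᴿ S (v₀ ∷ v₁ ∷ const 0 ∷ v₁ ∷ [])))

    cycleLeastᴿ : PRel α {2} (λ xs → CycleLeast f (lookup xs zero) (lookup xs (suc zero)))
    cycleLeastᴿ = applyᴿ periodᴿ (v₁ ∷ v₀ ∷ [])
               ×ᴿ ∀<ᴿ v₁ (¬ᴿ (∃<ᴿ v₁ (applyᴿ S (v₀ ∷ v₃ ∷ const 0 ∷ v₁ ∷ []))))

  cycleLeast? : ∀ k a → Dec (CycleLeast f k a)
  cycleLeast? k a = decide cycleLeastᴿ (k ∷ a ∷ [])

  opaque
    -- Counts the cycles of length `k` whose least element is below `a`. Matching cycles of equal
    -- length and rank calls for no knowledge of an isomorphism.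
    rank : ℕ → ℕ → ℕ
    rank k a = count (cycleLeast? k) a

  opaque
    unfolding rank

    rank-injective : ∀ {k a b} → CycleLeast f k a → CycleLeast f k b → rank k a ≡ rank k b → a ≡ b
    rank-injective = count-injective (cycleLeast? _)

    PR-rank : ∀ {g h : Vec ℕ n → ℕ} → IsPR α g → IsPR α h → IsPR α (λ xs → rank (g xs) (h xs))
    PR-rank p q = apply {g = binary rank} (ext (PR-sum (char (applyᴿ cycleLeastᴿ (v₁ ∷ v₀ ∷ []))) v₁)
      λ { (_ ∷ _ ∷ []) → refl }) (p ∷ q ∷ [])

opaque
  unfolding rank

  rank-transfer : ∀ {f g : ℕ → ℕ} {α : Oracle O} (S : PRel α (SameIterate f)) (T : PRel α (SameIterate g)) {k} →
                  (h : ∀ a → CycleLeast f k a → ∃ (CycleLeast g k)) →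
                  (∀ {a b} p q → proj₁ (h a p) ≡ proj₁ (h b q) → a ≡ b) →
                  ∀ {a} → CycleLeast f k a → ∃ λ b → CycleLeast g k b × rank T k b ≡ rank S k a
  rank-transfer S T {k} = count-transfer (cycleLeast? S k) (cycleLeast? T k)

-- Infinite orbits

data OrbitType : Set where
  ω ζ : OrbitType

-- A ζ-chain has no distinguished element, so its least number is taken; unlike a root, it is not
-- preserved by isomorphisms.
Representative : OrbitType → (ℕ → ℕ) → ℕ → Set
Representative ω f a = Root f a
Representative ζ f a = Deep f a × ¬ Periodic f a × (∀ b → b < a → ¬ SameOrbit f a b)

module _ {f : ℕ → ℕ} where

  Representative⇒¬Periodic : ∀ t {a} → Representative t f a → ¬ Periodic f a
  Representative⇒¬Periodic ω r           = Root⇒¬Periodic r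
  Representative⇒¬Periodic ζ (_ , h , _) = h

  module _ (f-inj : Injective _≡_ _≡_ f) where

    Representative-unique : ∀ {t u a b} → Representative t f a → Representative u f b → SameOrbit f a b →
                            a ≡ b × t ≡ u
    Representative-unique {ω} {ω} r s a~b = Root-unique f-inj r s a~b , refl
    Representative-unique {ω} {ζ} r (d , _) a~b = ⊥-elim (Root⇒¬Deep r (Deep-~ f-inj (~-sym a~b) d))
    Representative-unique {ζ} {ω} (d , _) s a~b = ⊥-elim (Root⇒¬Deep s (Deep-~ f-inj a~b d))
    Representative-unique {ζ} {ζ} {a} {b} (_ , _ , h) (_ , _ , h′) a~b with <-cmp a b
    ... | tri≈ _ e _ = e , refl
    ... | tri< a<b _ _ = ⊥-elim (h′ a a<b (~-sym a~b))
    ... | tri> _ _ b<a = ⊥-elim (h b b<a a~b)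

    Representative-exists : ExcludedMiddle 0ℓ → ∀ {x} → ¬ Periodic f x →
                            ∃ λ t → ∃ λ a → Representative t f a × SameOrbit f x a
    Representative-exists em {x} ¬per with Deep-or-Root em x
    ... | inj₂ (r , root , x~r) = ω , r , root , x~r
    ... | inj₁ d with leastOf {SameOrbit f x} (λ _ → em) (x , ~-refl)
    ...   | a , x~a , h = ζ , a , (Deep-~ f-inj x~a d , (λ p → ¬per (Periodic-~ f-inj (~-sym x~a) p))
                                  , λ b b<a a~b → h b b<a (~-trans x~a a~b)) , x~a

-- Σ₁ relations

record Σ₁ {O : ℕ → Set} (α : Oracle O) {n : ℕ} (P : Vec ℕ n → Set) : Set₁ where
  field
    matrix  : Vec ℕ (suc n) → Set
    rel     : PRel α matrix
    witness : ∀ {xs} → P xs → ∃ λ w → matrix (w ∷ xs)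
    holds   : ∀ {xs w} → matrix (w ∷ xs) → P xs

open Σ₁

module _ {α : Oracle O} where

  Σ₁-base : {P : Vec ℕ n → Set} → PRel α P → Σ₁ α P
  Σ₁-base {P = P} R = record
    { matrix  = λ ys → P (tabulate λ i → lookup ys (suc i))
    ; rel     = composeᴿ R (λ i → var (suc i))
    ; witness = λ {xs} p → 0 , subst P (sym (tabulate∘lookup xs)) p
    ; holds   = λ {xs} p → subst P (tabulate∘lookup xs) p
    }

  -- The new quantifier is merged with the old one by pairing.
  Σ₁-∃ : {P : Vec ℕ (suc n) → Set} → Σ₁ α P → Σ₁ α (λ xs → ∃ λ y → P (y ∷ xs))
  Σ₁-∃ {n} S = record
    { matrix  = λ ys → matrix S (tabulate λ i → fs i ys)
    ; rel     = composeᴿ {fs = fs} (rel S) λ { zero → PR-π₁ v₀ ; (suc zero) → PR-π₂ v₀ ; (suc (suc i)) → var (suc i) }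
    ; witness = λ {xs} (y , p) → pair (proj₁ (witness S p)) y ,
        subst (matrix S) (sym (cong₂ _∷_ (π₁-pair _ y) (cong₂ _∷_ (π₂-pair (proj₁ (witness S p)) y) (tabulate∘lookup xs))))
          (proj₂ (witness S p))
    ; holds   = λ {xs} {w} m → π₂ w ,
        holds S {w = π₁ w} (subst (matrix S) (cong (λ zs → π₁ w ∷ π₂ w ∷ zs) (tabulate∘lookup xs)) m)
    }
    where
    fs : Fin (2 + n) → Vec ℕ (suc n) → ℕ
    fs zero          ys = π₁ (lookup ys zero)
    fs (suc zero)    ys = π₂ (lookup ys zero)
    fs (suc (suc i)) ys = lookup ys (suc i)

  Σ₁-retract : {P Q : Vec ℕ n → Set} → Σ₁ α P → (∀ {xs} → P xs → Q xs) → (∀ {xs} → Q xs → P xs) → Σ₁ α Q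
  Σ₁-retract S to from = record
    { matrix = matrix S ; rel = rel S ; witness = λ q → witness S (from q) ; holds = λ m → to (holds S m) }

  indicator≡1 : {P : Set} (P? : Dec P) → indicator (does P?) ≡ 1 ⇔ P
  indicator≡1 (yes p) = mk⇔ (λ _ → p) (λ _ → refl)
  indicator≡1 (no ¬p) = mk⇔ (λ ()) (λ p → ⊥-elim (¬p p))

  -- Negating the matrix of a Σ₁ definition of the complement gives a Π₁ definition.
  Δ₁ : {P Q : Vec ℕ n → Set} → Σ₁ α P → Σ₁ α Q → (∀ xs → P xs ⇔ (¬ Q xs)) → Δ⁰ 1 α P
  Δ₁ S T P⇔¬Q =
      (_ , PR⇒computable (char (rel S)) , λ xs → mk⇔
        (λ p → _ , Equivalence.from (indicator≡1 (decide (rel S) _)) (proj₂ (witness S p)))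
        (λ (w , e) → holds S (Equivalence.to (indicator≡1 (decide (rel S) _)) e)))
    , (_ , PR⇒computable (char (¬ᴿ (rel T))) , λ xs → mk⇔
        (λ p w → Equivalence.from (indicator≡1 (decide (¬ᴿ (rel T)) _)) (λ m → Equivalence.to (P⇔¬Q xs) p (holds T m)))
        (λ h → Equivalence.from (P⇔¬Q xs) (λ q →
          Equivalence.to (indicator≡1 (decide (¬ᴿ (rel T)) _)) (h (proj₁ (witness T q))) (proj₂ (witness T q)))))

-- Structures with finitely many infinite orbits

-- A finite part of an arbitrary function is primitive recursive, because its values are written
-- into the scheme. In this way finitely many values of a noncomputable isomorphism become
-- available.
table : ℕ → (ℕ → ℕ) → ℕ → ℕ
table zero    g a       = 0
table (suc N) g zero    = g 0
table (suc N) g (suc a) = table N (g ∘ suc) a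

table-< : ∀ {N a} (g : ℕ → ℕ) → a < N → table N g a ≡ g a
table-< {suc N} {zero}  g _         = refl
table-< {suc N} {suc a} g (s≤s a<N) = table-< (g ∘ suc) a<N

table-≥ : ∀ {N a} (g : ℕ → ℕ) → N ≤ a → table N g a ≡ 0
table-≥ {zero}          g _         = refl
table-≥ {suc N} {suc a} g (s≤s N≤a) = table-≥ (g ∘ suc) N≤a

PR-table : ∀ {α : Oracle O} N (g : ℕ → ℕ) {h : Vec ℕ n → ℕ} → IsPR α h → IsPR α (λ xs → table N g (h xs))
PR-table zero    g p = const 0
PR-table (suc N) g {h} p = ext (PR-if (p ≡ᴿ const 0) (const (g 0)) (PR-table N (g ∘ suc) (PR-pred p))) (λ xs → lem (h xs))
  where
  lem : ∀ a → (if does (a ≟ 0) then g 0 else table N (g ∘ suc) (pred a)) ≡ table (suc N) g a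
  lem zero    = refl
  lem (suc a) = refl

module _ (em : ExcludedMiddle 0ℓ) where

  module FiniteMatching {f g : ℕ → ℕ} {α : Oracle O} (S : PRel α (SameIterate f)) (T : PRel α (SameIterate g))
           (f-inj : Injective _≡_ _≡_ f) (φ : Iso f g)
           (N : ℕ) (bound : ∀ t {a} → Representative t f a → a < N) where

    g-inj : Injective _≡_ _≡_ g
    g-inj = Iso-injective (Iso-sym φ) f-inj

    open Iso φ

    InfiniteRep : ℕ → Set
    InfiniteRep a = ∃ λ t → Representative t f a

    lineImage : (a : ℕ) → Dec (InfiniteRep a) → ℕ
    lineImage a (yes _) = suc (to a)
    lineImage a (no  _) = 0

    -- suc b if the representative a of an infinite orbit is matched with b, else 0.
    lines : ℕ → ℕ
    lines = table N (λ a → lineImage a em)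

    lines-image : ∀ {a} → InfiniteRep a → lines a ≡ suc (to a)
    lines-image {a} r = trans (table-< _ (bound _ (proj₂ r))) (lem em)
      where
      lem : ∀ d → lineImage a d ≡ suc (to a)
      lem (yes _) = refl
      lem (no ¬r) = ⊥-elim (¬r r)

    lines-rep : ∀ {a b} → lines a ≡ suc b → InfiniteRep a × b ≡ to a
    lines-rep {a} {b} e with a <? N
    ... | no  a≮N = ⊥-elim (1+n≢0 (trans (sym e) (table-≥ {N} _ (≮⇒≥ a≮N))))
    ... | yes a<N = lem em (trans (sym (table-< _ a<N)) e)
      where
      lem : ∀ d → lineImage a d ≡ suc b → InfiniteRep a × b ≡ to a
      lem (yes r) e = r , sym (suc-injective e)

    CycleMatch : ℕ → ℕ → ℕ → Set
    CycleMatch k a b = CycleLeast f k a × CycleLeast g k b × rank S k a ≡ rank T k b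

    -- On infinite orbits `b` is the image of `a` under the given isomorphism and need not be least
    -- in its own orbit. The length `k` is quantified in front of both cases, which leaves a
    -- primitive recursive matrix.
    M : ℕ → ℕ → Set
    M a b = ∃ λ k → lines a ≡ suc b ⊎ CycleMatch k a b

    M-rep : ∀ {a b} → M a b → (InfiniteRep a × b ≡ to a) ⊎ (∃ λ k → CycleMatch k a b)
    M-rep (k , inj₁ e) = inj₁ (lines-rep e)
    M-rep (k , inj₂ c) = inj₂ (k , c)

  opaque
    -- The isomorphism sends cycles of length k to cycles of length k injectively, so every rank
    -- attained in `f` is attained in `g`.
    cycle-partner : ∀ {f g : ℕ → ℕ} {α : Oracle O} (S : PRel α (SameIterate f)) (T : PRel α (SameIterate g)) →
                    Injective _≡_ _≡_ f → Iso f g → ∀ {x} → Periodic f x →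
                    ∃ λ k → ∃ λ a → ∃ λ b → (CycleLeast f k a × CycleLeast g k b × rank S k a ≡ rank T k b) × SameOrbit f x a
    cycle-partner {f = f} {g} S T f-inj φ per with Periodic⇒Period em per
    ... | k , p with CycleLeast-exists em f-inj p
    ...   | a , ca , x~a = k , a , proj₁ partner , (ca , proj₁ (proj₂ partner) , sym (proj₂ (proj₂ partner))) , x~a
      where
      g-inj : Injective _≡_ _≡_ g
      g-inj = Iso-injective (Iso-sym φ) f-inj
      image : ∀ a → CycleLeast f k a → ∃ λ b → CycleLeast g k b × SameOrbit g (Iso.to φ a) b
      image a (pa , _) = CycleLeast-exists em g-inj (Iso-Period φ pa)
      inj : ∀ {a b} (ca : CycleLeast f k a) (cb : CycleLeast f k b) → proj₁ (image a ca) ≡ proj₁ (image b cb) → a ≡ b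
      inj ca cb e = proj₁ (CycleLeast-unique f-inj ca cb (Iso-~⁻ φ
        (~-trans (proj₂ (proj₂ (image _ ca))) (subst (λ c → SameOrbit g c _) (sym e) (~-sym (proj₂ (proj₂ (image _ cb))))))))
      partner : ∃ λ b → CycleLeast g k b × rank T k b ≡ rank S k a
      partner = rank-transfer S T (λ a ca → proj₁ (image a ca) , proj₁ (proj₂ (image a ca))) inj ca

  CycleMatch-unique : ∀ {f g : ℕ → ℕ} {α : Oracle O} (S : PRel α (SameIterate f)) (T : PRel α (SameIterate g)) →
                      Injective _≡_ _≡_ f → ∀ {k l a b a′ b′} →
                      CycleLeast f k a × CycleLeast g k b × rank S k a ≡ rank T k b →
                      CycleLeast f l a′ × CycleLeast g l b′ × rank S l a′ ≡ rank T l b′ →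
                      SameOrbit f a a′ → a ≡ a′ × b ≡ b′
  CycleMatch-unique S T f-inj (ca , cb , e) (ca′ , cb′ , e′) a~a′ with CycleLeast-unique f-inj ca ca′ a~a′
  ... | refl , refl = refl , rank-injective T cb cb′ (trans (sym e) e′)

  module _ {f g : ℕ → ℕ} {α : Oracle O} (S : PRel α (SameIterate f)) (T : PRel α (SameIterate g))
           (f-inj : Injective _≡_ _≡_ f) (φ : Iso f g)
           (N : ℕ) (bound : ∀ t {a} → Representative t f a → a < N) where
    open FiniteMatching S T f-inj φ N bound
    open Iso φ

    finite-matches : Matches f g M
    finite-matches = record { total = total ; unique = λ m m′ → unique (M-rep m) (M-rep m′)
                            ; exponents = λ m → exponents (M-rep m) ; preimages = λ m → preimages (M-rep m) }
      where
      total : ∀ x → ∃ λ a → ∃ λ b → M a b × SameOrbit f x a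
      total x with em {Periodic f x}
      ... | yes per with cycle-partner S T f-inj φ per
      ...   | k , a , b , c , x~a = a , b , (k , inj₂ c) , x~a
      total x | no ¬per with Representative-exists f-inj em ¬per
      ...   | t , a , r , x~a = a , to a , (0 , inj₁ (lines-image (t , r))) , x~a
      Rep : ℕ → ℕ → Set
      Rep a b = (InfiniteRep a × b ≡ to a) ⊎ (∃ λ k → CycleMatch k a b)
      unique : ∀ {a b a′ b′} → Rep a b → Rep a′ b′ → SameOrbit f a a′ → a ≡ a′ × b ≡ b′
      unique (inj₁ ((_ , r) , refl)) (inj₁ ((_ , r′) , refl)) a~a′ with Representative-unique f-inj r r′ a~a′
      ... | refl , _ = refl , refl
      unique (inj₁ ((t , r) , _)) (inj₂ (_ , (p , _) , _)) a~a′ =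
        ⊥-elim (Representative⇒¬Periodic t r (Periodic-~ f-inj (~-sym a~a′) (Period⇒Periodic p)))
      unique (inj₂ (_ , (p , _) , _)) (inj₁ ((t , r) , _)) a~a′ =
        ⊥-elim (Representative⇒¬Periodic t r (Periodic-~ f-inj a~a′ (Period⇒Periodic p)))
      unique (inj₂ (_ , c)) (inj₂ (_ , c′)) a~a′ = CycleMatch-unique S T f-inj c c′ a~a′
      exponents : ∀ {a b} → Rep a b → ∀ p q → iter f p a ≡ iter f q a → iter g p b ≡ iter g q b
      exponents (inj₁ (_ , refl)) p q e = trans (sym (homo-iter p _)) (trans (cong to e) (homo-iter q _))
      exponents (inj₂ (_ , (p , _) , (p′ , _) , _)) = Period-exponents f-inj p p′
      preimages : ∀ {a b} → Rep a b → ∀ p → (∃ λ u → iter f p u ≡ a) → ∃ λ v → iter g p v ≡ b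
      preimages (inj₁ (_ , refl)) p (u , e) = to u , trans (sym (homo-iter p u)) (cong to e)
      preimages (inj₂ (_ , _ , (p′ , _) , _)) p _ = Periodic⇒Deep (Period⇒Periodic p′) p

    finite-matches⁻ : Matches g f (flip M)
    finite-matches⁻ = record { total = total ; unique = λ m m′ → unique (M-rep m) (M-rep m′)
                             ; exponents = λ m → exponents (M-rep m) ; preimages = λ m → preimages (M-rep m) }
      where
      total : ∀ y → ∃ λ b → ∃ λ a → M a b × SameOrbit g y b
      total y with em {Periodic g y}
      ... | yes per with cycle-partner T S g-inj (Iso-sym φ) per
      ...   | k , b , a , (cb , ca , e) , y~b = b , a , (k , inj₂ (ca , cb , sym e)) , y~b
      total y | no ¬per with Representative-exists f-inj em {from y} (λ p → ¬per (Iso-Periodic⁻ (Iso-sym φ) p))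
      ...   | t , a , r , x~a = to a , a , (0 , inj₁ (lines-image (t , r))) ,
                                subst (λ z → SameOrbit g z (to a)) (to-from y) (Iso-~ φ x~a)
      Rep : ℕ → ℕ → Set
      Rep a b = (InfiniteRep a × b ≡ to a) ⊎ (∃ λ k → CycleMatch k a b)
      unique : ∀ {b a b′ a′} → Rep a b → Rep a′ b′ → SameOrbit g b b′ → b ≡ b′ × a ≡ a′
      unique (inj₁ ((_ , r) , refl)) (inj₁ ((_ , r′) , refl)) b~b′ with Representative-unique f-inj r r′ (Iso-~⁻ φ b~b′)
      ... | refl , _ = refl , refl
      unique (inj₁ ((t , r) , refl)) (inj₂ (_ , _ , (p , _) , _)) b~b′ =
        ⊥-elim (Representative⇒¬Periodic t r (Iso-Periodic⁻ φ (Periodic-~ g-inj (~-sym b~b′) (Period⇒Periodic p))))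
      unique (inj₂ (_ , _ , (p , _) , _)) (inj₁ ((t , r) , refl)) b~b′ =
        ⊥-elim (Representative⇒¬Periodic t r (Iso-Periodic⁻ φ (Periodic-~ g-inj b~b′ (Period⇒Periodic p))))
      unique (inj₂ (_ , ca , cb , e)) (inj₂ (_ , ca′ , cb′ , e′)) b~b′ =
        CycleMatch-unique T S g-inj (cb , ca , sym e) (cb′ , ca′ , sym e′) b~b′
      exponents : ∀ {b a} → Rep a b → ∀ p q → iter g p b ≡ iter g q b → iter f p a ≡ iter f q a
      exponents (inj₁ (_ , refl)) p q e = to-injective (trans (homo-iter p _) (trans e (sym (homo-iter q _))))
      exponents (inj₂ (_ , (p , _) , (p′ , _) , _)) = Period-exponents g-inj p′ p
      preimages : ∀ {b a} → Rep a b → ∀ p → (∃ λ u → iter g p u ≡ b) → ∃ λ v → iter f p v ≡ a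
      preimages (inj₁ (_ , refl)) p (u , e) = from u ,
        to-injective (trans (homo-iter p (from u)) (trans (cong (iter g p) (to-from u)) e))
      preimages (inj₂ (_ , (p , _) , _)) q _ = Periodic⇒Deep (Period⇒Periodic p) q

    Matrix : Vec ℕ 7 → Set
    Matrix (k ∷ q ∷ p ∷ b ∷ a ∷ x ∷ y ∷ []) =
      (lines a ≡ suc b ⊎ CycleMatch k a b) × iter f p x ≡ iter f q a × iter g p y ≡ iter g q b

    opaque
      matrixᴿ : PRel α Matrix
      matrixᴿ = retract (((PR-table N _ v₄ ≡ᴿ PR-suc v₃)
                ⊎ᴿ (applyᴿ (cycleLeastᴿ S) (v₀ ∷ v₄ ∷ []) ×ᴿ applyᴿ (cycleLeastᴿ T) (v₀ ∷ v₃ ∷ [])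
                    ×ᴿ (PR-rank S v₀ v₄ ≡ᴿ PR-rank T v₀ v₃)))
             ×ᴿ applyᴿ S (v₂ ∷ v₅ ∷ v₁ ∷ v₄ ∷ []) ×ᴿ applyᴿ T (v₂ ∷ v₆ ∷ v₁ ∷ v₃ ∷ []))
        (λ { {_ ∷ _ ∷ _ ∷ _ ∷ _ ∷ _ ∷ _ ∷ []} m → m }) (λ { {_ ∷ _ ∷ _ ∷ _ ∷ _ ∷ _ ∷ _ ∷ []} m → m })

    opaque
      corresponds-Σ₁ : Σ₁ α {2} (λ { (x ∷ y ∷ []) → Corresponds f g M x y })
      corresponds-Σ₁ = Σ₁-retract (Σ₁-∃ (Σ₁-∃ (Σ₁-∃ (Σ₁-∃ (Σ₁-∃ (Σ₁-base matrixᴿ))))))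
        (λ { {_ ∷ _ ∷ []} (a , b , p , q , k , m , e , e′) → a , b , p , q , (k , m) , e , e′ })
        (λ { {_ ∷ _ ∷ []} (a , b , p , q , (k , m) , e , e′) → a , b , p , q , k , m , e , e′ })

    opaque
      -- The correspondent of `x` exists and is unique, so this is the complement of the graph.
      notCorresponds-Σ₁ : Σ₁ α {2} (λ { (x ∷ y ∷ []) → ∃ λ y′ → Corresponds f g M x y′ × ¬ y′ ≡ y })
      notCorresponds-Σ₁ = Σ₁-retract (Σ₁-∃ (Σ₁-∃ (Σ₁-∃ (Σ₁-∃ (Σ₁-∃ (Σ₁-∃ (Σ₁-base
          (applyᴿ matrixᴿ (v₀ ∷ v₁ ∷ v₂ ∷ v₃ ∷ v₄ ∷ v₆ ∷ v₅ ∷ []) ×ᴿ ¬ᴿ (v₅ ≡ᴿ v₇)))))))))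
        (λ { {_ ∷ _ ∷ []} (y′ , a , b , p , q , k , (m , e , e′) , ≢) → y′ , (a , b , p , q , (k , m) , e , e′) , ≢ })
        (λ { {_ ∷ _ ∷ []} (y′ , (a , b , p , q , (k , m) , e , e′) , ≢) → y′ , a , b , p , q , k , (m , e , e′) , ≢ })

    opaque
      computable-iso : Σ (Iso f g) λ ψ → Δ⁰-function 1 α (Iso.to ψ)
      computable-iso = proj₁ iso , Δ₁
        (Σ₁-retract corresponds-Σ₁ (λ { {_ ∷ _ ∷ []} → functional (proj₂ iso _) })
                                   (λ { {_ ∷ _ ∷ []} refl → proj₂ iso _ }))
        notCorresponds-Σ₁
        (λ { (x ∷ y ∷ []) → mk⇔
          (λ { refl (y′ , r , ≢) → ≢ (functional r (proj₂ iso x)) })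
          (λ h → decidable-stable (_ ≟ _) (λ ≢ → h (_ , proj₂ iso x , ≢))) })
        where
        iso : Σ (Iso f g) λ φ → ∀ x → Corresponds f g M x (Iso.to φ x)
        iso = matching-iso f-inj g-inj finite-matches finite-matches⁻
        functional : ∀ {x y y′} → Corresponds f g M x y → Corresponds f g M x y′ → y ≡ y′
        functional = Corresponds-functional f-inj g-inj finite-matches

  opaque
    -- The only information not computed from the diagram of B is the finite table of images of the
    -- representatives below `N`.
    finite⇒Δ₁-categorical : ∀ A → Punctual A → IsInjectionStructure A →
                            ∀ N → (∀ t {a} → Representative t (op A) a → a < N) → RelativelyΔ⁰Categorical 1 A
    finite⇒Δ₁-categorical A (p , p≗) f-inj N bound B B≅A = Iso⇒≅ (proj₁ result) , proj₂ result
      where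
      result : Σ (Iso (op A) (op B)) λ ψ → Δ⁰-function 1 (single (atomicDiagram B)) (Iso.to ψ)
      result = computable-iso (sameIterateᴿ (fromNone (isPR p p≗))) (diagramᴿ B) f-inj (Iso-sym (≅⇒Iso B≅A)) N bound

-- The part of being a representative that isomorphisms preserve.
HasType : OrbitType → (X → X) → X → Set
HasType ω f a = Root f a
HasType ζ f a = Deep f a × ¬ Periodic f a

Representative⇒HasType : ∀ t {f a} → Representative t f a → HasType t f a
Representative⇒HasType ω r           = r
Representative⇒HasType ζ (d , h , _) = d , h

HasType⇒¬Periodic : ∀ t {f : X → X} {a} → HasType t f a → ¬ Periodic f a
HasType⇒¬Periodic ω r       = Root⇒¬Periodic r
HasType⇒¬Periodic ζ (_ , h) = h

HasType-preimages : ∀ t {f : X → X} {g : Y → Y} {a b} → HasType t f a → HasType t g b →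
                    ∀ p → (∃ λ u → iter f p u ≡ a) → ∃ λ v → iter g p v ≡ b
HasType-preimages ω r s       zero    _       = _ , refl
HasType-preimages ω r s       (suc p) (u , e) = ⊥-elim (r _ e)
HasType-preimages ζ r (d , _) p       _       = d p

HasType-exponents : ∀ t {f : X → X} {g : Y → Y} → Injective _≡_ _≡_ f → ∀ {a b} → HasType t f a →
                    ∀ p q → iter f p a ≡ iter f q a → iter g p b ≡ iter g q b
HasType-exponents t {g = g} f-inj r p q e = cong (λ n → iter g n _) (iter-exponent f-inj p q (HasType⇒¬Periodic t r) e)

-- A copy in which refuted chains are absorbed by a junk orbit

-- fwd ω c is an ω-chain; bwd c and fwd ζ c are the two halves of a ℤ-chain; cyc a k
-- stands for the element a of the given structure if k is its exact period;
-- backJunk precedes junk when the junk orbit has to be a ℤ-chain.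
data Element : Set where
  junk backJunk : ℕ → Element
  fwd           : OrbitType → ℕ → ℕ → Element
  bwd cyc       : ℕ → ℕ → Element

code : Element → ℕ
code (junk z)     = pair 0 z
code (backJunk z) = pair 1 z
code (fwd ω c n)  = pair 2 (pair c n)
code (fwd ζ c n)  = pair 3 (pair c n)
code (bwd c n)    = pair 4 (pair c n)
code (cyc a k)    = pair (5 + a) k

fromPair : ℕ → ℕ → Element
fromPair 0 z = junk z
fromPair 1 z = backJunk z
fromPair 2 z = fwd ω (π₁ z) (π₂ z)
fromPair 3 z = fwd ζ (π₁ z) (π₂ z)
fromPair 4 z = bwd (π₁ z) (π₂ z)
fromPair (suc (suc (suc (suc (suc a))))) k = cyc a k

decode : ℕ → Element
decode z = fromPair (π₁ z) (π₂ z)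

code-fromPair : ∀ u v → code (fromPair u v) ≡ pair u v
code-fromPair 0 z = refl
code-fromPair 1 z = refl
code-fromPair 2 z = cong (pair 2) (pair-π z)
code-fromPair 3 z = cong (pair 3) (pair-π z)
code-fromPair 4 z = cong (pair 4) (pair-π z)
code-fromPair (suc (suc (suc (suc (suc a))))) k = refl

opaque
  code-decode : ∀ z → code (decode z) ≡ z
  code-decode z = trans (code-fromPair (π₁ z) (π₂ z)) (pair-π z)

  decode-pair : ∀ u v → decode (pair u v) ≡ fromPair u v
  decode-pair u v = cong₂ fromPair (π₁-pair u v) (π₂-pair u v)

  decode-code : ∀ x → decode (code x) ≡ x
  decode-code (junk z)     = decode-pair 0 z
  decode-code (backJunk z) = decode-pair 1 z
  decode-code (fwd ω c n)  = trans (decode-pair 2 (pair c n)) (cong₂ (fwd ω) (π₁-pair c n) (π₂-pair c n))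
  decode-code (fwd ζ c n)  = trans (decode-pair 3 (pair c n)) (cong₂ (fwd ζ) (π₁-pair c n) (π₂-pair c n))
  decode-code (bwd c n)    = trans (decode-pair 4 (pair c n)) (cong₂ bwd (π₁-pair c n) (π₂-pair c n))
  decode-code (cyc a k)    = decode-pair (5 + a) k

chainOf : Element → ℕ
chainOf (fwd _ c _) = c
chainOf (bwd c _)   = c
chainOf _           = 0

-- `Refuted t c n`: the chain c of type t is known at stage n to be junk.
record Chains : Set₁ where
  field
    Refuted  : OrbitType → ℕ → ℕ → Set
    refutedᴿ : ∀ t → PRel none {2} (λ xs → Refuted t (lookup xs zero) (lookup xs (suc zero)))
    persist  : ∀ t {c n} → Refuted t c n → Refuted t c (suc n)

  refuted? : ∀ t c n → Dec (Refuted t c n)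
  refuted? t c n = decide (refutedᴿ t) (c ∷ n ∷ [])

  True : OrbitType → ℕ → Set
  True t c = ∀ n → ¬ Refuted t c n

  persist-≤ : ∀ t {c m n} → m ≤ n → Refuted t c m → Refuted t c n
  persist-≤ t {c} {m} {n} m≤n r = subst (Refuted t c) (m∸n+n≡m m≤n) (lem (n ∸ m))
    where
    lem : ∀ k → Refuted t c (k + m)
    lem zero    = r
    lem (suc k) = persist t (lem k)

module Copy {f : ℕ → ℕ} (S : PRel none (SameIterate f)) (T : OrbitType) (chains : Chains) where
  open Chains chains public

  period? : ∀ a k → Dec (Period f a k)
  period? a k = decide (periodᴿ S) (a ∷ k ∷ [])

  -- The first element of the segment that ends in `fwd t c n`. At the first refuted stage the
  -- segment is the whole chain built so far; later elements are inserted singly for ω, and as pairs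
  -- `bwd c n`, `fwd ζ c n` for ζ.
  enter : OrbitType → ℕ → ℕ → Element
  enter ω c zero    = fwd ω c zero
  enter ω c (suc n) = if does (refuted? ω c n) then fwd ω c (suc n) else fwd ω c zero
  enter ζ c n       = bwd c n

  slotBack : OrbitType → ℕ → ℕ → Element
  slotBack ω z p = backJunk p
  slotBack ζ z p = junk (suc z)

  -- junk z leads to junk (1 + z), through the segment of refuted elements that
  -- ends in the element with code z if there is one.
  slot : ℕ → Element → Element
  slot z (junk _)     = junk (suc z)
  slot z (backJunk p) = slotBack T z p
  slot z (fwd t c n)  = if does (refuted? t c n) then enter t c n else junk (suc z)
  slot z (bwd _ _)    = junk (suc z)
  slot z (cyc a k)    = if does (period? a k) then junk (suc z) else cyc a k

  -- For ω these elements are surplus numbers and pass through their slots in the junk orbit; for ζ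
  -- they lead down to `junk 0`.
  nextBack : OrbitType → ℕ → Element
  nextBack ω p       = junk (suc (code (backJunk p)))
  nextBack ζ zero    = junk 0
  nextBack ζ (suc p) = backJunk p

  next : Element → Element
  next (junk z)        = slot z (decode z)
  next (backJunk p)    = nextBack T p
  next (fwd t c n)     = if does (refuted? t c n) then junk (suc (code (fwd t c n))) else fwd t c (suc n)
  next (bwd c zero)    = fwd ζ c zero
  -- If the chain is refuted at `n` already, `bwd c n` belongs to the segment that ends in
  -- `fwd ζ c n`, so this segment turns to the forward half at once.
  next (bwd c (suc n)) = if does (refuted? ζ c n) then fwd ζ c (suc n) else bwd c n
  next (cyc a k)       = if does (period? a k) then cyc (f a) k else junk (suc (code (cyc a k)))

  next-exit : ∀ t {c n} → Refuted t c n → next (fwd t c n) ≡ junk (suc (code (fwd t c n)))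
  next-exit t {c} {n} r with refuted? t c n
  ... | yes _ = refl
  ... | no ¬r = ⊥-elim (¬r r)

  next-fwd : ∀ t {c n} → ¬ Refuted t c n → next (fwd t c n) ≡ fwd t c (suc n)
  next-fwd t {c} {n} ¬r with refuted? t c n
  ... | yes r = ⊥-elim (¬r r)
  ... | no  _ = refl

  next-bwd : ∀ {c n} → ¬ Refuted ζ c n → next (bwd c (suc n)) ≡ bwd c n
  next-bwd {c} {n} ¬r with refuted? ζ c n
  ... | yes r = ⊥-elim (¬r r)
  ... | no  _ = refl

  next-turn : ∀ {c n} → Refuted ζ c n → next (bwd c (suc n)) ≡ fwd ζ c (suc n)
  next-turn {c} {n} r with refuted? ζ c n
  ... | yes _ = refl
  ... | no ¬r = ⊥-elim (¬r r)

  next-cyc : ∀ {a k} → Period f a k → next (cyc a k) ≡ cyc (f a) k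
  next-cyc {a} {k} p with period? a k
  ... | yes _ = refl
  ... | no ¬p = ⊥-elim (¬p p)

  fwd-run : ∀ t {c} n → (∀ j → j < n → ¬ Refuted t c j) → iter next n (fwd t c 0) ≡ fwd t c n
  fwd-run t zero    h = refl
  fwd-run t (suc n) h = trans (cong next (fwd-run t n (λ j j<n → h j (m≤n⇒m≤1+n j<n)))) (next-fwd t (h n ≤-refl))

  bwd-run : ∀ {c} n → (∀ j → j < n → ¬ Refuted ζ c j) → iter next (suc n) (bwd c n) ≡ fwd ζ c 0
  bwd-run     zero    h = refl
  bwd-run {c} (suc n) h = trans (sym (iter-suc next (suc n) (bwd c (suc n))))
    (trans (cong (iter next (suc n)) (next-bwd (h n ≤-refl))) (bwd-run n (λ j j<n → h j (m≤n⇒m≤1+n j<n))))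

  module _ (em : ExcludedMiddle 0ℓ) (f-inj : Injective _≡_ _≡_ f) where

    FirstRefuted : ℕ → ℕ → Set
    FirstRefuted c n = Refuted ω c n × (∀ m → m < n → ¬ Refuted ω c m)

    FirstRefuted-unique : ∀ {c m n} → FirstRefuted c m → FirstRefuted c n → m ≡ n
    FirstRefuted-unique {m = m} {n} (r , h) (r′ , h′) with <-cmp m n
    ... | tri≈ _ e _ = e
    ... | tri< l _ _ = ⊥-elim (h′ m l r)
    ... | tri> _ _ l = ⊥-elim (h n l r′)

    prevBack : OrbitType → ℕ → Element
    prevBack ω p = junk (code (backJunk p))
    prevBack ζ p = backJunk (suc p)

    prevSlotBack : OrbitType → ℕ → ℕ → Element
    prevSlotBack ω z p = backJunk p
    prevSlotBack ζ z p = junk z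

    prevSlot : ℕ → Element → Element
    prevSlot z (junk _)     = junk z
    prevSlot z (backJunk p) = prevSlotBack T z p
    prevSlot z (fwd t c n)  = if does (refuted? t c n) then fwd t c n else junk z
    prevSlot z (bwd _ _)    = junk z
    prevSlot z (cyc a k)    = if does (period? a k) then junk z else cyc a k

    prevRoot : ∀ c → Dec (∃ (FirstRefuted c)) → Element
    prevRoot c (yes (n , _)) = junk (code (fwd ω c n))
    prevRoot c (no _)        = fwd ω c zero

    -- A left inverse of `next`, which yields injectivity. Excluded middle enters because the
    -- predecessor of `fwd ω c zero` depends on whether the chain is ever refuted. At a root the
    -- value is a default that `next` does not send back to the root; this is how roots are
    -- recognised later.
    prev : Element → Element
    prev (junk zero)       = backJunk zero
    prev (junk (suc z))    = prevSlot z (decode z)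
    prev (backJunk p)      = prevBack T p
    prev (fwd ω c zero)    = prevRoot c em
    prev (fwd ω c (suc n)) = if does (refuted? ω c n) then junk (code (fwd ω c (suc n))) else fwd ω c n
    prev (fwd ζ c zero)    = bwd c zero
    prev (fwd ζ c (suc n)) = if does (refuted? ζ c n) then bwd c (suc n) else fwd ζ c n
    prev (bwd c n)         = if does (refuted? ζ c n) then junk (code (fwd ζ c n)) else bwd c (suc n)
    prev (cyc a k)         = if does (period? a k) then cyc (iter f (pred k) a) k else junk (code (cyc a k))

    prevRoot-first : ∀ {c n} → FirstRefuted c n → ∀ d → prevRoot c d ≡ junk (code (fwd ω c n))
    prevRoot-first {c} fr (yes (m , fr′)) = cong (junk ∘ code ∘ fwd ω c) (FirstRefuted-unique fr′ fr)
    prevRoot-first fr (no ∄)          = ⊥-elim (∄ (_ , fr))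

    prevRoot-true : ∀ {c} → True ω c → ∀ d → prevRoot c d ≡ fwd ω c zero
    prevRoot-true tr (yes (n , r , _)) = ⊥-elim (tr n r)
    prevRoot-true tr (no _)            = refl

    prev-slot : ∀ z x → decode z ≡ x → prev (slot z x) ≡ junk z
    prev-slot z x eq = go x eq (trans (sym (cong code eq)) (code-decode z)) T refl
      where
      prev-junk : ∀ {y} → decode z ≡ y → prevSlot z y ≡ junk z → prev (junk (suc z)) ≡ junk z
      prev-junk e e′ = trans (cong (prevSlot z) e) e′
      go : ∀ y → decode z ≡ y → code y ≡ z → ∀ t → T ≡ t → prev (slot z y) ≡ junk z
      go (junk _)     e c _ _ = prev-junk e refl
      go (bwd _ _)    e c _ _ = prev-junk e refl
      go (backJunk p) e c ω refl = cong junk c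
      go (backJunk p) e c ζ refl = prev-junk e refl
      go (fwd t c n) e ce _ _ with refuted? t c n in eqr
      ... | no ¬r = prev-junk e (cong (λ d → if does d then fwd t c n else junk z) eqr)
      go (fwd ω c zero)    e ce _ _ | yes r = trans (prevRoot-first (r , λ _ ()) em) (cong junk ce)
      go (fwd ω c (suc n)) e ce _ _ | yes r with refuted? ω c n in eqn
      ... | yes r′ = trans (cong (λ d → if does d then junk (code (fwd ω c (suc n))) else fwd ω c n) eqn) (cong junk ce)
      -- Refuted at `suc n` but not at `n`: this is the first refuted stage, so the segment begins
      -- with the start of the chain.
      ... | no ¬r′ = trans (prevRoot-first (r , λ m m≤n r′ → ¬r′ (persist-≤ ω (s≤s⁻¹ m≤n) r′)) em) (cong junk ce)
      go (fwd ζ c n)       e ce _ _ | yes r =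
        trans (cong (λ d → if does d then junk (code (fwd ζ c n)) else bwd c (suc n)) eqr) (cong junk ce)
      go (cyc a k)    e c _ _ with period? a k in eqp
      ... | yes _ = prev-junk e (cong (λ d → if does d then junk z else cyc a k) eqp)
      ... | no  _ = trans (cong (λ d → if does d then cyc (iter f (pred k) a) k else junk (code (cyc a k))) eqp) (cong junk c)

    prev-next : ∀ x → prev (next x) ≡ x
    prev-next (junk z) = prev-slot z (decode z) refl
    prev-next (backJunk p) = go T refl p
      where
      go : ∀ t → T ≡ t → ∀ p → prev (nextBack t p) ≡ backJunk p
      go ω e p rewrite decode-code (backJunk p) | e = refl
      go ζ e zero    = refl
      go ζ e (suc p) = cong (λ t → prevBack t p) e
    prev-next (fwd t c n) with refuted? t c n in eqr
    ... | yes r = trans (cong (prevSlot _) (decode-code (fwd t c n)))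
                        (cong (λ d → if does d then fwd t c n else junk (code (fwd t c n))) eqr)
    prev-next (fwd ω c n) | no ¬r = cong (λ d → if does d then junk (code (fwd ω c (suc n))) else fwd ω c n) eqr
    prev-next (fwd ζ c n) | no ¬r = cong (λ d → if does d then bwd c (suc n) else fwd ζ c n) eqr
    prev-next (bwd c zero)    = refl
    prev-next (bwd c (suc n)) with refuted? ζ c n in eqr
    ... | yes r = cong (λ d → if does d then bwd c (suc n) else fwd ζ c n) eqr
    ... | no ¬r = cong (λ d → if does d then junk (code (fwd ζ c n)) else bwd c (suc n)) eqr
    prev-next (cyc a k) with period? a k in eqp
    ... | no ¬p = trans (cong (prevSlot _) (decode-code (cyc a k)))
                        (cong (λ d → if does d then junk (code (cyc a k)) else cyc a k) eqp)
    ... | yes p with period? (f a) k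
    ...   | no ¬p = ⊥-elim (¬p (Period-~ f-inj (~-step refl) p))
    ...   | yes _ = lem p
      where
      lem : ∀ {k} → Period f a k → cyc (iter f (pred k) (f a)) k ≡ cyc a k
      lem {suc k} (_ , e , _) = cong (λ b → cyc b (suc k)) (trans (iter-suc f k a) e)

    next-injective : Injective _≡_ _≡_ next
    next-injective {x} {y} e = trans (sym (prev-next x)) (trans (cong prev e) (prev-next y))

-- The orbits of the copy

module CopyOrbits (em : ExcludedMiddle 0ℓ) {f : ℕ → ℕ} (f-inj : Injective _≡_ _≡_ f)
                  (S : PRel none (SameIterate f)) (T : OrbitType) (chains : Chains) where
  open Copy S T chains

  infix 4 _~_

  _~_ : Element → Element → Set
  _~_ = SameOrbit next

  next-inj : Injective _≡_ _≡_ next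
  next-inj = next-injective em f-inj

  unrefuted-below : ∀ t {c n} → ¬ Refuted t c n → ∀ j → j < suc n → ¬ Refuted t c j
  unrefuted-below t ¬r j j≤n r = ¬r (persist-≤ t (s≤s⁻¹ j≤n) r)

  -- The segment inserted after `junk z`, if there is one, runs from `enter` to the element with
  -- code `z`, which exits to `junk (suc z)`.
  junk-~-suc : ∀ z → junk z ~ junk (suc z)
  junk-~-suc z = go (decode z) refl (code-decode z)
    where
    exit : ∀ t {c n} → Refuted t c n → code (fwd t c n) ≡ z → fwd t c n ~ junk (suc z)
    exit t r e = ~-step (trans (next-exit t r) (cong (junk ∘ suc) e))
    backwards : ∀ {c} n → Refuted ζ c n → bwd c n ~ fwd ζ c n
    backwards zero    r = ~-step refl
    backwards {c} (suc n) r with em {Refuted ζ c n}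
    ... | yes r′ = ~-step (next-turn r′)
    -- At the first refuted stage the segment descends the whole backward half to `fwd ζ c 0` and
    -- then climbs the forward half.
    ... | no ¬r  = ~-trans (~-iter (2 + n) (bwd-turn ¬r)) (~-iter (suc n) (fwd-run ζ (suc n) (unrefuted-below ζ ¬r)))
      where
      bwd-turn : ¬ Refuted ζ c n → iter next (2 + n) (bwd c (suc n)) ≡ fwd ζ c 0
      bwd-turn ¬r = bwd-run (suc n) (unrefuted-below ζ ¬r)
    entered : ∀ t {c} n → Refuted t c n → enter t c n ~ fwd t c n
    entered ω zero    r = ~-refl
    entered ω {c} (suc n) r with refuted? ω c n
    ... | yes r′ = ~-refl
    ... | no ¬r  = ~-iter (suc n) (fwd-run ω (suc n) (unrefuted-below ω ¬r))
    entered ζ n r = backwards n r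
    go : ∀ x → decode z ≡ x → code x ≡ z → junk z ~ junk (suc z)
    go x e ce = ~-trans (~-step (cong (slot z) e)) (slot-~ x ce T refl)
      where
      slot-~ : ∀ x → code x ≡ z → ∀ t → T ≡ t → slot z x ~ junk (suc z)
      slot-~ (junk _)     ce _ _    = ~-refl
      slot-~ (bwd _ _)    ce _ _    = ~-refl
      slot-~ (backJunk p) ce ω refl = ~-step (cong (junk ∘ suc) ce)
      slot-~ (backJunk p) ce ζ refl = ~-refl
      slot-~ (fwd t c n)  ce _ _ with refuted? t c n
      ... | yes r = ~-trans (entered t n r) (exit t r ce)
      ... | no  _ = ~-refl
      slot-~ (cyc a k)    ce _ _ with period? a k in eqp
      ... | yes _ = ~-refl
      ... | no  _ = ~-step (trans (cong (λ d → if does d then cyc (f a) k else junk (suc (code (cyc a k)))) eqp)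
                                  (cong (junk ∘ suc) ce))

  junk-~-0 : ∀ z → junk z ~ junk 0
  junk-~-0 zero    = ~-refl
  junk-~-0 (suc z) = ~-trans (~-sym (junk-~-suc z)) (junk-~-0 z)

  to-junk : ∀ {x z} → next x ≡ junk z → x ~ junk 0
  to-junk e = ~-trans (~-step e) (junk-~-0 _)

  backJunk-~ : ∀ p → backJunk p ~ junk 0
  backJunk-~ p = go T refl p
    where
    go : ∀ t → T ≡ t → ∀ p → backJunk p ~ junk 0
    go ω refl p       = to-junk refl
    go ζ refl zero    = ~-step refl
    go ζ refl (suc p) = ~-trans (~-step refl) (go ζ refl p)

  fwd-refuted-~ : ∀ t {c n} → Refuted t c n → ∀ m → fwd t c m ~ junk 0
  fwd-refuted-~ t {c} {n} r m = climb n m (persist-≤ t (m≤n+m n m) r)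
    where
    climb : ∀ d m → Refuted t c (m + d) → fwd t c m ~ junk 0
    climb zero    m r = to-junk (next-exit t (subst (Refuted t c) (+-identityʳ m) r))
    climb (suc d) m r with em {Refuted t c m}
    ... | yes r′ = to-junk (next-exit t r′)
    ... | no ¬r  = ~-trans (~-step (next-fwd t ¬r)) (climb d (suc m) (subst (Refuted t c) (+-suc m d) r))

  bwd-~-fwd : ∀ {c} n → ∃ λ m → bwd c n ~ fwd ζ c m
  bwd-~-fwd zero = 0 , ~-step refl
  bwd-~-fwd {c} (suc n) with em {Refuted ζ c n}
  ... | yes r = suc n , ~-step (next-turn r)
  ... | no ¬r = proj₁ (bwd-~-fwd n) , ~-trans (~-step (next-bwd ¬r)) (proj₂ (bwd-~-fwd n))

  data Location (y : Element) : Set where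
    inCycle : ∀ a k → Period f a k → y ≡ cyc a k → Location y
    inJunk  : y ~ junk 0 → Location y
    inChain : ∀ t c → True t c → y ~ fwd t c 0 → Location y

  locate : ∀ y → Location y
  locate (junk z)     = inJunk (junk-~-0 z)
  locate (backJunk p) = inJunk (backJunk-~ p)
  locate (cyc a k) with period? a k in eqp
  ... | yes p = inCycle a k p refl
  ... | no ¬p = inJunk (to-junk (cong (λ d → if does d then cyc (f a) k else junk (suc (code (cyc a k)))) eqp))
  locate (fwd t c m) = locate-fwd t c m
    where
    locate-fwd : ∀ t c m → Location (fwd t c m)
    locate-fwd t c m with em {∃ (Refuted t c)}
    ... | yes (n , r) = inJunk (fwd-refuted-~ t r m)
    ... | no ∄        = inChain t c (λ n r → ∄ (n , r)) (~-sym (~-iter m (fwd-run t m (λ j _ r → ∄ (j , r)))))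
  locate (bwd c n) with bwd-~-fwd {c} n | em {∃ (Refuted ζ c)}
  ... | m , b~f | yes (_ , r) = inJunk (~-trans b~f (fwd-refuted-~ ζ r m))
  ... | m , b~f | no ∄        = inChain ζ c (λ n r → ∄ (n , r))
    (~-trans b~f (~-sym (~-iter m (fwd-run ζ m (λ j _ r → ∄ (j , r))))))

  data Label : Set where
    junkL cycleL : Label
    chainL       : OrbitType → ℕ → Label

  chainLabel : ∀ t c → Dec (True t c) → Label
  chainLabel t c (yes _) = chainL t c
  chainLabel t c (no  _) = junkL

  -- An orbit invariant that separates the junk orbit, the cycles taken together and each surviving
  -- chain. It is classical, since survival is a Π₁ property; distinct cycles are told apart by
  -- `cyc-~`.
  label : Element → Label
  label (junk _)     = junkL
  label (backJunk _) = junkL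
  label (fwd t c _)  = chainLabel t c em
  label (bwd c _)    = chainLabel ζ c em
  label (cyc a k)    = if does (period? a k) then cycleL else junkL

  chainLabel-true : ∀ t {c} → True t c → chainLabel t c em ≡ chainL t c
  chainLabel-true t {c} tr = lem em
    where
    lem : ∀ d → chainLabel t c d ≡ chainL t c
    lem (yes _) = refl
    lem (no ¬t) = ⊥-elim (¬t tr)

  chainLabel-refuted : ∀ t {c n} → Refuted t c n → chainLabel t c em ≡ junkL
  chainLabel-refuted t {c} r = lem em
    where
    lem : ∀ d → chainLabel t c d ≡ junkL
    lem (yes tr) = ⊥-elim (tr _ r)
    lem (no _)   = refl

  label-cyc : ∀ {a k} → Period f a k → label (cyc a k) ≡ cycleL
  label-cyc {a} {k} p with period? a k
  ... | yes _ = refl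
  ... | no ¬p = ⊥-elim (¬p p)

  label-next : ∀ x → label (next x) ≡ label x
  label-next (junk z) = go (decode z) T refl
    where
    entered : ∀ t c n → Refuted t c n → label (enter t c n) ≡ junkL
    entered ω c zero    r = chainLabel-refuted ω r
    entered ω c (suc n) r with refuted? ω c n
    ... | yes _ = chainLabel-refuted ω r
    ... | no  _ = chainLabel-refuted ω r
    entered ζ c n       r = chainLabel-refuted ζ r
    go : ∀ x t → T ≡ t → label (slot z x) ≡ junkL
    go (junk _)     _ _ = refl
    go (bwd _ _)    _ _ = refl
    go (backJunk p) ω refl = refl
    go (backJunk p) ζ refl = refl
    go (fwd t c n)  _ _ with refuted? t c n
    ... | yes r = entered t c n r
    ... | no  _ = refl
    go (cyc a k)    _ _ with period? a k in eqp
    ... | yes _ = refl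
    ... | no  _ = cong (λ d → if does d then cycleL else junkL) eqp
  label-next (backJunk p) = go T p
    where
    go : ∀ t p → label (nextBack t p) ≡ junkL
    go ω p       = refl
    go ζ zero    = refl
    go ζ (suc p) = refl
  label-next (fwd t c n) with refuted? t c n
  ... | yes r = sym (chainLabel-refuted t r)
  ... | no  _ = refl
  label-next (bwd c zero) = refl
  label-next (bwd c (suc n)) with refuted? ζ c n
  ... | yes _ = refl
  ... | no  _ = refl
  label-next (cyc a k) with period? a k
  ... | yes p = label-cyc (Period-~ f-inj (~-step refl) p)
  ... | no  _ = refl

  label-~ : ∀ {x y} → x ~ y → label x ≡ label y
  label-~ (p , q , e) = trans (sym (label-iter p _)) (trans (cong label e) (label-iter q _))
    where
    label-iter : ∀ n x → label (iter next n x) ≡ label x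
    label-iter zero    x = refl
    label-iter (suc n) x = trans (label-next (iter next n x)) (label-iter n x)

  -- Every element of a surviving chain carries the index of the chain in its code. So the guess can
  -- be read off primitive recursively, although survival cannot be decided.
  label-chainOf : ∀ {t c} y → label y ≡ chainL t c → chainOf y ≡ c
  label-chainOf (fwd t c n) e = lem em e
    where
    lem : ∀ d {t′ c′} → chainLabel t c d ≡ chainL t′ c′ → c ≡ c′
    lem (yes _) refl = refl
  label-chainOf (bwd c n) e = lem em e
    where
    lem : ∀ d {t′ c′} → chainLabel ζ c d ≡ chainL t′ c′ → c ≡ c′
    lem (yes _) refl = refl
  label-chainOf (cyc a k) e with period? a k
  label-chainOf (cyc a k) () | yes _
  label-chainOf (cyc a k) () | no _

  -- If `x` had period k + 1, it would be its own (k + 1)-fold preimage, and by injectivity the only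
  -- one.
  no-return : ∀ {x} → (∀ p → ∃ λ u → iter next (suc p) u ≡ x × ¬ u ≡ x) → Deep next x × ¬ Periodic next x
  no-return {x} pre = deep , λ (k , e) → proj₂ (proj₂ (pre k))
      (iter-injective next-inj (suc k) (trans (proj₁ (proj₂ (pre k))) (sym e)))
    where
    deep : Deep next x
    deep zero    = x , refl
    deep (suc p) = proj₁ (pre p) , proj₁ (proj₂ (pre p))

  chain-type : ∀ t {c} → True t c → HasType t next (fwd t c 0)
  -- A predecessor `u` would equal `prev (fwd ω c 0)`, which is `fwd ω c 0` itself, but `next` moves
  -- that element on.
  chain-type ω {c} tr u e = lem (trans (sym (cong next (trans (sym (prev-next em f-inj u)) (trans (cong (prev em f-inj) e)
      (prevRoot-true em f-inj tr em))))) e)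
    where
    lem : ¬ next (fwd ω c 0) ≡ fwd ω c 0
    lem e′ with trans (sym (next-fwd ω (tr 0))) e′
    ... | ()
  chain-type ζ {c} tr = no-return λ p → bwd c p , bwd-run p (λ j _ → tr j) , λ ()

  junk-type : HasType T next (junk 0)
  junk-type = go T refl
    where
    go : ∀ t → T ≡ t → HasType t next (junk 0)
    -- The only possible predecessor is the default `backJunk 0`, whose successor is a later junk
    -- element when `T` is `ω`.
    go ω refl u e with trans (sym e) (cong next (trans (sym (prev-next em f-inj u)) (cong (prev em f-inj) e)))
    ... | ()
    go ζ refl = no-return λ p → backJunk p , run p , λ ()
      where
      run : ∀ p → iter next (suc p) (backJunk p) ≡ junk 0
      run zero    = refl
      run (suc p) = trans (sym (iter-suc next (suc p) (backJunk (suc p)))) (run p)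

  cyc-iter : ∀ {a k} → Period f a k → ∀ n → iter next n (cyc a k) ≡ cyc (iter f n a) k
  cyc-iter p zero    = refl
  cyc-iter p (suc n) = trans (cong next (cyc-iter p n)) (next-cyc (Period-~ f-inj (~-iter n refl) p))

  cyc-period : ∀ {a k} → Period f a k → Period next (cyc a k) k
  cyc-period {a} {k} p@(0<k , e , h) = 0<k , trans (cyc-iter p k) (cong (λ b → cyc b k) e) ,
    λ j j<k 0<j e′ → h j j<k 0<j (lem (trans (sym (cyc-iter p j)) e′))
    where
    lem : ∀ {a b k} → cyc a k ≡ cyc b k → a ≡ b
    lem refl = refl

  cyc-~ : ∀ {a b k l} → Period f a k → Period f b l → cyc a k ~ cyc b l → SameOrbit f a b × k ≡ l
  cyc-~ pa pb (p , q , e) = (p , q , proj₁ (lem e′)) , proj₂ (lem e′)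
    where
    e′ = trans (sym (cyc-iter pa p)) (trans e (cyc-iter pb q))
    lem : ∀ {a b k l} → cyc a k ≡ cyc b l → a ≡ b × k ≡ l
    lem refl = refl , refl

-- Enumerating the infinite orbits of the given structure

module Positions (em : ExcludedMiddle 0ℓ) (f : ℕ → ℕ) where

  opaque
    position : OrbitType → ℕ → ℕ
    position t = count {P = Representative t f} (λ _ → em)

  At : OrbitType → ℕ → Set
  At t i = ∃ λ a → Representative t f a × position t a ≡ i

  Infinite : OrbitType → Set
  Infinite t = ∀ n → ∃ λ a → n ≤ a × Representative t f a

  bounded : ∀ {t} → ¬ Infinite t → ∃ λ N → ∀ {a} → Representative t f a → a < N
  bounded {t} ¬inf with em {∃ λ N → ¬ ∃ λ a → N ≤ a × Representative t f a}
  ... | yes (N , ∄) = N , λ {a} r → ≰⇒> λ N≤a → ∄ (a , N≤a , r)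
  ... | no ∄        = ⊥-elim (¬inf λ n → decidable-stable em λ ¬∃ → ∄ (n , ¬∃))

  opaque
    unfolding position

    position-injective : ∀ {t a b} → Representative t f a → Representative t f b → position t a ≡ position t b → a ≡ b
    position-injective {t} = count-injective {P = Representative t f} (λ _ → em)

    position-infinite : ∀ {t} → Infinite t → ∀ i → At t i
    position-infinite {t} = count-infinite {P = Representative t f} (λ _ → em)

    position-finite : ∀ {t N} → (∀ {a} → Representative t f a → a < N) → ∃ λ m → (∀ i → i < m → At t i) × (∀ i → At t i → i < m)
    position-finite {t} {N} h = position t N , (λ i → count-nth {P = Representative t f} (λ _ → em) N) ,
      λ { i (a , r , refl) → count-< {P = Representative t f} (λ _ → em) r (h r) }

  opaque
    -- The scheme is chosen non-uniformly: either every position is taken, or exactly those below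
    -- some constant `m` are.
    absentᴿ : ∀ t → PRel none {2} (λ xs → ¬ At t (lookup xs zero))
    absentᴿ t with em {Infinite t}
    ... | yes inf = retract (const 0 ≡ᴿ const 1) (λ ()) (λ {xs} h → ⊥-elim (h (position-infinite inf (lookup xs zero))))
    ... | no ¬inf with bounded ¬inf
    ...   | N , b with position-finite {t} b
    ...     | m , present , below = retract (¬ᴿ (v₀ <ᴿ const m)) (λ {xs} h at → h (below _ at)) (λ {xs} h l → h (present _ l))

-- Guessing moduli of convergence

module Guessing {G : ℕ → ℕ → ℕ} (PR-G : IsPR none (binary G)) where

  -- The index pair x t stands for the guess that t is the least stage from
  -- which on G y is constant for all y ≤ x.
  TooLate : ℕ → Set
  TooLate c = ∃ λ s → s < π₂ c × π₂ c ≡ suc s × (∀ y → y < suc (π₁ c) → G y s ≡ G y (π₂ c))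

  ChangesBy : ℕ → ℕ → Set
  ChangesBy c n = ∃ λ k → k < suc n × ∃ λ y → y < suc (π₁ c) × ¬ G y (k + π₂ c) ≡ G y (π₂ c)

  Wrong : ℕ → ℕ → Set
  Wrong c n = TooLate c ⊎ ChangesBy c n

  opaque
    wrongᴿ : PRel none {2} (λ xs → Wrong (lookup xs zero) (lookup xs (suc zero)))
    wrongᴿ =
        ∃<ᴿ (PR-π₂ v₀) ((PR-π₂ v₁ ≡ᴿ PR-suc v₀)
          ×ᴿ ∀<ᴿ (PR-suc (PR-π₁ v₁)) (apply PR-G (v₀ ∷ v₁ ∷ []) ≡ᴿ apply PR-G (v₀ ∷ PR-π₂ v₂ ∷ [])))
      ⊎ᴿ ∃<ᴿ (PR-suc v₁) (∃<ᴿ (PR-suc (PR-π₁ v₁))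
          (¬ᴿ (apply PR-G (v₀ ∷ PR-+ v₁ (PR-π₂ v₂) ∷ []) ≡ᴿ apply PR-G (v₀ ∷ PR-π₂ v₂ ∷ []))))

  Wrong-persist : ∀ {c n} → Wrong c n → Wrong c (suc n)
  Wrong-persist (inj₁ l)              = inj₁ l
  Wrong-persist (inj₂ (k , k≤n , ch)) = inj₂ (k , m≤n⇒m≤1+n k≤n , ch)

  Right : ℕ → Set
  Right c = ∀ n → ¬ Wrong c n

  Stable : ℕ → ℕ → Set
  Stable x t = ∀ s → t ≤ s → ∀ y → y ≤ x → G y s ≡ G y t

  Right-stable : ∀ {c} → Right c → Stable (π₁ c) (π₂ c)
  Right-stable {c} right s t≤s y y≤x = decidable-stable (_ ≟ _) λ ≢ →
    right (s ∸ π₂ c) (inj₂ (s ∸ π₂ c , ≤-refl , y , s≤s y≤x ,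
      subst (λ r → ¬ G y r ≡ G y (π₂ c)) (sym (m∸n+n≡m t≤s)) ≢))

  -- With `π₂ d` equal to `suc s`, the guess `c` makes G constant from `π₂ c` on, hence at `s` and
  -- `suc s`, and so `d` is too late. Comparing two consecutive stages thus detects every guess that
  -- is stable but not least.
  Right-least : ∀ {c d} → Right c → Right d → π₁ c ≡ π₁ d → ¬ π₂ c < π₂ d
  Right-least {c} {d} rc rd e = go (π₂ d) refl
    where
    go : ∀ t → π₂ d ≡ t → ¬ π₂ c < t
    go (suc s) eqd (s≤s l) = rd 0 (inj₁ (s , ≤-reflexive (sym eqd) , eqd , λ y y≤x →
      let y≤ = subst (y ≤_) (sym e) (s≤s⁻¹ y≤x)
          s≤ = ≤-trans (n≤1+n s) (≤-reflexive (sym eqd))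
      in trans (Right-stable rc s l y y≤) (sym (Right-stable rc (π₂ d) (≤-trans l s≤) y y≤))))

  Right-unique : ∀ {c d} → Right c → Right d → π₁ c ≡ π₁ d → c ≡ d
  Right-unique {c} {d} rc rd e with <-cmp (π₂ c) (π₂ d)
  ... | tri≈ _ e′ _ = trans (sym (pair-π c)) (trans (cong₂ pair e e′) (pair-π d))
  ... | tri< l _ _  = ⊥-elim (Right-least rc rd e l)
  ... | tri> _ _ l  = ⊥-elim (Right-least rd rc (sym e) l)

  Right-exists : ExcludedMiddle 0ℓ → (∀ x → ∃ λ y → Eventually (λ s → G x s ≡ y)) → ∀ x → ∃ λ c → Right c × π₁ c ≡ x
  Right-exists em lim x with leastOf {Stable x} (λ _ → em) stable
    where
    stable : ∃ (Stable x)
    stable with ev-< (suc x) {λ y s → G y s ≡ proj₁ (lim y)} (λ y _ → proj₂ (lim y))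
    ... | t , h = t , λ s t≤s y y≤x → trans (h s t≤s y (s≤s y≤x)) (sym (h t ≤-refl y (s≤s y≤x)))
  ... | t , st , least = pair x t , right , π₁-pair x t
    where
    right : Right (pair x t)
    -- If G did not change between `s` and t = s + 1, stability would begin at `s`, against the
    -- choice of t.
    right n (inj₁ (s , _ , e , same)) rewrite π₁-pair x t | π₂-pair x t | e = least s ≤-refl λ r s≤r y y≤x → helper r s≤r y y≤x
      where
      helper : ∀ r → s ≤ r → ∀ y → y ≤ x → G y r ≡ G y s
      helper r s≤r y y≤x with s ≟ r
      ... | yes refl = refl
      ... | no  s≢r  = trans (st r (≤∧≢⇒< s≤r s≢r) y y≤x) (sym (same y (s≤s y≤x)))
    right n (inj₂ (k , _ , y , y≤x , ≢)) rewrite π₁-pair x t | π₂-pair x t = ≢ (st (k + t) (m≤n+m t k) y (s≤s⁻¹ y≤x))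

-- The copy that carries guesses, and its isomorphism with the given structure

_≟ᵗ_ : (t u : OrbitType) → Dec (t ≡ u)
ω ≟ᵗ ω = yes refl
ω ≟ᵗ ζ = no λ ()
ζ ≟ᵗ ω = no λ ()
ζ ≟ᵗ ζ = yes refl

-- Chains of type T carry guesses; those of the other type, the orbits of that
-- type, enumerated in order of position.
module GuessingCopy (em : ExcludedMiddle 0ℓ) {f : ℕ → ℕ} (f-inj : Injective _≡_ _≡_ f)
                    (S : PRel none (SameIterate f)) (T : OrbitType) {G : ℕ → ℕ → ℕ} (PR-G : IsPR none (binary G)) where
  open Positions em f
  open Guessing PR-G

  -- The decision is an argument so that it can be split on while `T` is a variable. For the other
  -- type the stage plays no part: a chain is junk from the outset if the structure has no orbit at
  -- its position.
  RefutedIf : ∀ {t} → Dec (t ≡ T) → ℕ → ℕ → Set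
  RefutedIf     (yes _) c n = Wrong c n
  RefutedIf {t} (no  _) c n = ¬ At t c

  chains : Chains
  chains = record
    { Refuted  = λ t → RefutedIf (t ≟ᵗ T)
    ; refutedᴿ = λ t → refutedIfᴿ (t ≟ᵗ T)
    ; persist  = λ t → persistIf (t ≟ᵗ T)
    }
    where
    refutedIfᴿ : ∀ {t} (d : Dec (t ≡ T)) → PRel none {2} (λ xs → RefutedIf d (lookup xs zero) (lookup xs (suc zero)))
    refutedIfᴿ     (yes _) = wrongᴿ
    refutedIfᴿ {t} (no  _) = absentᴿ t
    persistIf : ∀ {t} (d : Dec (t ≡ T)) {c n} → RefutedIf d c n → RefutedIf d c (suc n)
    persistIf (yes _) w = Wrong-persist w
    persistIf (no  _) h = h

  open CopyOrbits em f-inj S T chains public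
  open Copy S T chains public

  TrueIf : ∀ {t} → Dec (t ≡ T) → ℕ → Set
  TrueIf d c = ∀ n → ¬ RefutedIf d c n

  -- Position 0 of type T is reserved for the junk orbit.
  numberIf : ∀ {t} → Dec (t ≡ T) → ℕ → ℕ
  numberIf (yes _) c = suc (π₁ c)
  numberIf (no  _) c = c

  number : OrbitType → ℕ → ℕ
  number t = numberIf (t ≟ᵗ T)

  number-injective : ∀ t {c d} → True t c → True t d → number t c ≡ number t d → c ≡ d
  number-injective t = go (t ≟ᵗ T)
    where
    go : ∀ (d : Dec (t ≡ T)) {c c′} → TrueIf d c → TrueIf d c′ → numberIf d c ≡ numberIf d c′ → c ≡ c′
    go (yes _) r r′ e = Right-unique r r′ (suc-injective e)
    go (no  _) _ _  e = e

  number-T : ∀ {c} → ¬ number T c ≡ 0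
  number-T = go (T ≟ᵗ T)
    where
    go : ∀ (d : Dec (T ≡ T)) {c} → ¬ numberIf d c ≡ 0
    go (no T≢T) _ = T≢T refl

  True⇒Right : ∀ {c} → True T c → Right c
  True⇒Right = go (T ≟ᵗ T)
    where
    go : ∀ (d : Dec (T ≡ T)) {c} → TrueIf d c → Right c
    go (yes _)  r = r
    go (no T≢T) _ = ⊥-elim (T≢T refl)

  Right⇒True : ∀ {c} → Right c → True T c
  Right⇒True = go (T ≟ᵗ T)
    where
    go : ∀ (d : Dec (T ≡ T)) {c} → Right c → TrueIf d c
    go (yes _)  r = r
    go (no T≢T) _ = ⊥-elim (T≢T refl)

  module _ (inf : Infinite T) (lim : ∀ x → ∃ λ y → Eventually (λ s → G x s ≡ y)) where

    -- With `number-injective` and `number-position`, this makes `number` a bijection from the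
    -- surviving chains of each type to the positions of that type, except position 0 of type `T`.
    number-surjective : ∀ {t a} → Representative t f a →
                        (t ≡ T × position t a ≡ 0) ⊎ ∃ λ c → True t c × position t a ≡ number t c
    number-surjective {t} {a} r = go (t ≟ᵗ T) (position t a) refl
      where
      go : ∀ (d : Dec (t ≡ T)) i → position t a ≡ i →
           (t ≡ T × position t a ≡ 0) ⊎ ∃ λ c → TrueIf d c × position t a ≡ numberIf d c
      go (yes e) zero    p = inj₁ (e , p)
      go (yes e) (suc i) p with Right-exists em lim i
      ... | c , right , refl = inj₂ (c , right , p)
      go (no _)  i       p = inj₂ (i , (λ _ h → h (a , r , p)) , p)

    number-position : ∀ t {c} → True t c → ∃ λ a → Representative t f a × position t a ≡ number t c
    number-position t = go (t ≟ᵗ T)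
      where
      go : ∀ (d : Dec (t ≡ T)) {c} → TrueIf d c → ∃ λ a → Representative t f a × position t a ≡ numberIf d c
      go (yes refl) _  = position-infinite inf _
      go (no _)     tr = decidable-stable em (tr 0)

    data M : ℕ → Element → Set where
      cycleM : ∀ {k a} → CycleLeast f k a → M a (cyc a k)
      junkM  : ∀ {a} → Representative T f a → position T a ≡ 0 → M a (junk 0)
      chainM : ∀ {t a c} → Representative t f a → True t c → position t a ≡ number t c → M a (fwd t c 0)

    infiniteM : ∀ {a b} → M a b → (∃ λ t → Representative t f a × HasType t next b)
                                 ⊎ (∃ λ k → CycleLeast f k a × b ≡ cyc a k)
    infiniteM (cycleM c)      = inj₂ (_ , c , refl)
    infiniteM (junkM r _)     = inj₁ (T , r , junk-type)
    infiniteM (chainM r tr _) = inj₁ (_ , r , chain-type _ tr)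

    opaque
      copy-matches : Matches f next M
      copy-matches = record { total = total ; unique = unique ; exponents = λ m → exponents (infiniteM m)
                            ; preimages = λ m → preimages (infiniteM m) }
        where
        total : ∀ x → ∃ λ a → ∃ λ b → M a b × SameOrbit f x a
        total x with em {Periodic f x}
        ... | yes per with Periodic⇒Period em per
        ...   | k , p with CycleLeast-exists em f-inj p
        ...     | a , ca , x~a = a , cyc a k , cycleM ca , x~a
        total x | no ¬per with Representative-exists f-inj em ¬per
        ... | t , a , r , x~a with number-surjective r
        ...   | inj₁ (refl , e)   = a , junk 0 , junkM r e , x~a
        ...   | inj₂ (c , tr , e) = a , fwd t c 0 , chainM r tr e , x~a
        not-cycle : ∀ {t k a b} → Representative t f a → CycleLeast f k b → ¬ SameOrbit f a b
        not-cycle {t} r (p , _) a~b =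
          Representative⇒¬Periodic t r (Periodic-~ f-inj (~-sym a~b) (Period⇒Periodic p))
        unique : ∀ {a b a′ b′} → M a b → M a′ b′ → SameOrbit f a a′ → a ≡ a′ × b ≡ b′
        unique (cycleM c) (cycleM c′) a~a′ with CycleLeast-unique f-inj c c′ a~a′
        ... | refl , refl = refl , refl
        unique (cycleM c)      (junkM r _)    a~a′ = ⊥-elim (not-cycle r c (~-sym a~a′))
        unique (cycleM c)      (chainM r _ _) a~a′ = ⊥-elim (not-cycle r c (~-sym a~a′))
        unique (junkM r _)     (cycleM c)     a~a′ = ⊥-elim (not-cycle r c a~a′)
        unique (chainM r _ _)  (cycleM c)     a~a′ = ⊥-elim (not-cycle r c a~a′)
        unique (junkM r _)     (junkM r′ _)   a~a′ = proj₁ (Representative-unique f-inj r r′ a~a′) , refl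
        unique (junkM r e)     (chainM r′ _ e′) a~a′ with Representative-unique f-inj r r′ a~a′
        ... | refl , refl = ⊥-elim (number-T (trans (sym e′) e))
        unique (chainM r′ _ e′) (junkM r e)   a~a′ with Representative-unique f-inj r r′ (~-sym a~a′)
        ... | refl , refl = ⊥-elim (number-T (trans (sym e′) e))
        unique (chainM r tr e) (chainM r′ tr′ e′) a~a′ with Representative-unique f-inj r r′ a~a′
        ... | refl , refl = refl , cong (λ c → fwd _ c 0) (number-injective _ tr tr′ (trans (sym e) e′))
        Rep : ℕ → Element → Set
        Rep a b = (∃ λ t → Representative t f a × HasType t next b) ⊎ (∃ λ k → CycleLeast f k a × b ≡ cyc a k)
        exponents : ∀ {a b} → Rep a b → ∀ p q → iter f p a ≡ iter f q a → iter next p b ≡ iter next q b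
        exponents (inj₁ (t , r , h)) = HasType-exponents t f-inj (Representative⇒HasType t r)
        exponents (inj₂ (k , (p , _) , refl)) = Period-exponents f-inj p (cyc-period p)
        preimages : ∀ {a b} → Rep a b → ∀ p → (∃ λ u → iter f p u ≡ a) → ∃ λ v → iter next p v ≡ b
        preimages (inj₁ (t , r , h)) = HasType-preimages t (Representative⇒HasType t r) h
        preimages (inj₂ (k , (p , _) , refl)) q _ = Periodic⇒Deep (Period⇒Periodic (cyc-period p)) q

    opaque
      copy-matches⁻ : Matches next f (flip M)
      copy-matches⁻ = record { total = total ; unique = unique ; exponents = λ m → exponents (infiniteM m)
                             ; preimages = λ m → preimages (infiniteM m) }
        where
        total : ∀ y → ∃ λ b → ∃ λ a → M a b × SameOrbit next y b
        total y with locate y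
        ... | inCycle a k p refl with CycleLeast-exists em f-inj p
        ...   | a′ , ca , a~a′ with Period-orbit f-inj p a~a′
        ...     | j , _ , e = cyc a′ k , a′ , cycleM ca , ~-iter j (trans (cyc-iter p j) (cong (λ b → cyc b k) e))
        total y | inJunk y~0 with position-infinite inf 0
        ... | a , r , e = junk 0 , a , junkM r e , y~0
        total y | inChain t c tr y~c with number-position t tr
        ... | a , r , e = fwd t c 0 , a , chainM r tr e , y~c
        labels : ∀ {x y l m} → x ~ y → label x ≡ l → label y ≡ m → l ≡ m
        labels x~y e e′ = trans (sym e) (trans (label-~ x~y) e′)
        unique : ∀ {b a b′ a′} → M a b → M a′ b′ → SameOrbit next b b′ → b ≡ b′ × a ≡ a′
        unique (cycleM (p , h)) (cycleM (p′ , h′)) b~b′ with cyc-~ p p′ b~b′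
        ... | a~a′ , refl with CycleLeast-unique f-inj (p , h) (p′ , h′) a~a′
        ...   | refl , _ = refl , refl
        unique (cycleM (p , _)) (junkM _ _)       b~b′ with labels b~b′ (label-cyc p) refl
        ... | ()
        unique (cycleM (p , _)) (chainM {t} _ tr _)   b~b′ with labels b~b′ (label-cyc p) (chainLabel-true t tr)
        ... | ()
        unique (junkM _ _)      (cycleM (p , _))  b~b′ with labels b~b′ refl (label-cyc p)
        ... | ()
        unique (junkM r e)      (junkM r′ e′)     b~b′ = refl , position-injective r r′ (trans e (sym e′))
        unique (junkM _ _)      (chainM {t} _ tr _)   b~b′ with labels b~b′ refl (chainLabel-true t tr)
        ... | ()
        unique (chainM {t} _ tr _)  (cycleM (p , _))  b~b′ with labels b~b′ (chainLabel-true t tr) (label-cyc p)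
        ... | ()
        unique (chainM {t} _ tr _)  (junkM _ _)       b~b′ with labels b~b′ (chainLabel-true t tr) refl
        ... | ()
        unique (chainM {t} r tr e)  (chainM {t′} r′ tr′ e′) b~b′ with labels b~b′ (chainLabel-true t tr) (chainLabel-true t′ tr′)
        ... | refl = refl , position-injective r r′ (trans e (sym e′))
        Rep : Element → ℕ → Set
        Rep b a = (∃ λ t → Representative t f a × HasType t next b) ⊎ (∃ λ k → CycleLeast f k a × b ≡ cyc a k)
        exponents : ∀ {b a} → Rep b a → ∀ p q → iter next p b ≡ iter next q b → iter f p a ≡ iter f q a
        exponents (inj₁ (t , r , h)) = HasType-exponents t next-inj h
        exponents (inj₂ (k , (p , _) , refl)) = Period-exponents next-inj (cyc-period p) p
        preimages : ∀ {b a} → Rep b a → ∀ p → (∃ λ u → iter next p u ≡ b) → ∃ λ v → iter f p v ≡ a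
        preimages (inj₁ (t , r , h)) = HasType-preimages t h (Representative⇒HasType t r)
        preimages (inj₂ (k , (p , _) , refl)) q _ = Periodic⇒Deep (Period⇒Periodic p) q

    opaque
      copy-iso : Iso f next
      copy-iso = proj₁ (matching-iso f-inj next-inj copy-matches copy-matches⁻)

  -- The hypotheses are what an isomorphism transports: being aperiodic rules out cycles, and being
  -- deep exactly for `ζ` rules out chains of the other type.
  typeT-label : ∀ {y} → ¬ Periodic next y → (Deep next y → T ≡ ζ) → (T ≡ ζ → Deep next y) →
                (y ~ junk 0) ⊎ (∃ λ c → Right c × y ~ fwd T c 0)
  typeT-label {y} ¬per deep⇒ζ ζ⇒deep with locate y
  ... | inCycle a k p refl = ⊥-elim (¬per (Period⇒Periodic (cyc-period p)))
  ... | inJunk y~0 = inj₁ y~0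
  ... | inChain t c tr y~c = go t T refl tr y~c
    where
    go : ∀ t u → u ≡ T → True t c → y ~ fwd t c 0 → (y ~ junk 0) ⊎ (∃ λ c → Right c × y ~ fwd T c 0)
    go ω ω refl tr y~c = inj₂ (c , True⇒Right tr , y~c)
    go ζ ζ refl tr y~c = inj₂ (c , True⇒Right tr , y~c)
    go ω ζ refl tr y~c = ⊥-elim (Root⇒¬Deep (chain-type ω tr) (Deep-~ next-inj y~c (ζ⇒deep refl)))
    go ζ ω refl tr y~c with deep⇒ζ (Deep-~ next-inj (~-sym y~c) (proj₁ (chain-type ζ tr)))
    ... | ()

-- Punctuality of the copy

select : ℕ → ℕ → ℕ → ℕ → ℕ → ℕ → ℕ → ℕ
select 0 a b c d e g = a
select 1 a b c d e g = b
select 2 a b c d e g = c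
select 3 a b c d e g = d
select 4 a b c d e g = e
select (suc (suc (suc (suc (suc _))))) a b c d e g = g

module _ {α : Oracle O} where

  PR-select : ∀ {u a b c d e g : Vec ℕ n → ℕ} → IsPR α u → IsPR α a → IsPR α b → IsPR α c → IsPR α d → IsPR α e → IsPR α g →
              IsPR α (λ xs → select (u xs) (a xs) (b xs) (c xs) (d xs) (e xs) (g xs))
  PR-select {u = u} {a} {b} {c} {d} {e} {g} pu pa pb pc pd pe pg = ext
    (PR-if (pu ≡ᴿ const 0) pa (PR-if (pu ≡ᴿ const 1) pb (PR-if (pu ≡ᴿ const 2) pc
      (PR-if (pu ≡ᴿ const 3) pd (PR-if (pu ≡ᴿ const 4) pe pg)))))
    (λ xs → lem (u xs) (a xs) (b xs) (c xs) (d xs) (e xs) (g xs))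
    where
    lem : ∀ u a b c d e g → (if does (u ≟ 0) then a else if does (u ≟ 1) then b else if does (u ≟ 2) then c
            else if does (u ≟ 3) then d else if does (u ≟ 4) then e else g) ≡ select u a b c d e g
    lem 0 a b c d e g = refl
    lem 1 a b c d e g = refl
    lem 2 a b c d e g = refl
    lem 3 a b c d e g = refl
    lem 4 a b c d e g = refl
    lem (suc (suc (suc (suc (suc _))))) a b c d e g = refl

  PR-junk : ∀ {g : Vec ℕ n → ℕ} → IsPR α g → IsPR α (λ xs → code (junk (g xs)))
  PR-junk p = PR-pair (const 0) p

  PR-backJunk : ∀ {g : Vec ℕ n → ℕ} → IsPR α g → IsPR α (λ xs → code (backJunk (g xs)))
  PR-backJunk p = PR-pair (const 1) p

  PR-fwd : ∀ t {g h : Vec ℕ n → ℕ} → IsPR α g → IsPR α h → IsPR α (λ xs → code (fwd t (g xs) (h xs)))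
  PR-fwd ω p q = PR-pair (const 2) (PR-pair p q)
  PR-fwd ζ p q = PR-pair (const 3) (PR-pair p q)

  PR-bwd : ∀ {g h : Vec ℕ n → ℕ} → IsPR α g → IsPR α h → IsPR α (λ xs → code (bwd (g xs) (h xs)))
  PR-bwd p q = PR-pair (const 4) (PR-pair p q)

  PR-cyc : ∀ {g h : Vec ℕ n → ℕ} → IsPR α g → IsPR α h → IsPR α (λ xs → code (cyc (g xs) (h xs)))
  PR-cyc p q = PR-pair (PR-+ (const 5) p) q

  -- Decoding is a case distinction on the first component of a pair, so definitions by pattern
  -- matching on `Element` may be checked one constructor at a time.
  PR-cases : (k : Vec ℕ n → Element → ℕ) {g : Vec ℕ n → ℕ} → IsPR α g →
             (∀ {h : Vec ℕ n → ℕ} → IsPR α h → IsPR α (λ xs → k xs (junk (h xs)))) →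
             (∀ {h : Vec ℕ n → ℕ} → IsPR α h → IsPR α (λ xs → k xs (backJunk (h xs)))) →
             (∀ t {h i : Vec ℕ n → ℕ} → IsPR α h → IsPR α i → IsPR α (λ xs → k xs (fwd t (h xs) (i xs)))) →
             (∀ {h i : Vec ℕ n → ℕ} → IsPR α h → IsPR α i → IsPR α (λ xs → k xs (bwd (h xs) (i xs)))) →
             (∀ {h i : Vec ℕ n → ℕ} → IsPR α h → IsPR α i → IsPR α (λ xs → k xs (cyc (h xs) (i xs)))) →
             IsPR α (λ xs → k xs (decode (g xs)))
  PR-cases k {g} p pj pn pf pb pc = ext
    (PR-select (PR-π₁ p) (pj v) (pn v) (pf ω (PR-π₁ v) (PR-π₂ v)) (pf ζ (PR-π₁ v) (PR-π₂ v)) (pb (PR-π₁ v) (PR-π₂ v))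
               (pc (PR-∸ (PR-π₁ p) (const 5)) v))
    (λ xs → lem xs (π₁ (g xs)) (π₂ (g xs)))
    where
    v : IsPR α (λ xs → π₂ (g xs))
    v = PR-π₂ p
    lem : ∀ xs u v → select u (k xs (junk v)) (k xs (backJunk v)) (k xs (fwd ω (π₁ v) (π₂ v))) (k xs (fwd ζ (π₁ v) (π₂ v)))
                         (k xs (bwd (π₁ v) (π₂ v))) (k xs (cyc (u ∸ 5) v)) ≡ k xs (fromPair u v)
    lem xs 0 v = refl
    lem xs 1 v = refl
    lem xs 2 v = refl
    lem xs 3 v = refl
    lem xs 4 v = refl
    lem xs (suc (suc (suc (suc (suc a))))) v = refl

  PR-chainOf : ∀ {g : Vec ℕ n → ℕ} → IsPR α g → IsPR α (λ xs → chainOf (decode (g xs)))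
  PR-chainOf p = PR-cases (λ _ → chainOf) p (λ _ → const 0) (λ _ → const 0) (λ _ q _ → q) (λ q _ → q) (λ _ _ → const 0)

module CopyPR {f : ℕ → ℕ} (PR-f : IsPR none (unary f)) (T : OrbitType) (chains : Chains) where
  open Copy (sameIterateᴿ PR-f) T chains

  refutedOf : ∀ t {g h : Vec ℕ n → ℕ} → IsPR none g → IsPR none h → PRel none (λ xs → Refuted t (g xs) (h xs))
  refutedOf t p q = applyᴿ (refutedᴿ t) (p ∷ q ∷ [])

  periodOf : ∀ {g h : Vec ℕ n → ℕ} → IsPR none g → IsPR none h → PRel none (λ xs → Period f (g xs) (h xs))
  periodOf p q = applyᴿ (periodᴿ (sameIterateᴿ PR-f)) (p ∷ q ∷ [])

  PR-code-if : ∀ {P : Vec ℕ n → Set} {x y : Vec ℕ n → Element} (R : PRel none P) →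
               IsPR none (λ xs → code (x xs)) → IsPR none (λ xs → code (y xs)) →
               IsPR none (λ xs → code (if does (decide R xs) then x xs else y xs))
  PR-code-if R p q = ext (PR-if R p q) (λ xs → sym (if-float code (does (decide R xs))))

  PR-enter : ∀ t {g h : Vec ℕ n → ℕ} → IsPR none g → IsPR none h → IsPR none (λ xs → code (enter t (g xs) (h xs)))
  PR-enter ζ         p q = PR-bwd p q
  PR-enter ω {g} {h} p q = ext
    (PR-if (q ≡ᴿ const 0) (PR-fwd ω p (const 0)) (PR-code-if (refutedOf ω p (PR-pred q)) (PR-fwd ω p q) (PR-fwd ω p (const 0))))
    (λ xs → lem (g xs) (h xs))
    where
    lem : ∀ c n → (if does (n ≟ 0) then code (fwd ω c 0)
                   else code (if does (refuted? ω c (pred n)) then fwd ω c n else fwd ω c 0)) ≡ code (enter ω c n)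
    lem c zero    = refl
    lem c (suc n) = refl

  PR-slot : ∀ {g h : Vec ℕ n → ℕ} → IsPR none g → IsPR none h → IsPR none (λ xs → code (slot (g xs) (decode (h xs))))
  PR-slot {g = g} p q = PR-cases (λ xs x → code (slot (g xs) x)) q
    (λ _ → skip)
    (back T)
    (λ t r s → PR-code-if (refutedOf t r s) (PR-enter t r s) skip)
    (λ _ _ → skip)
    (λ r s → PR-code-if (periodOf r s) skip (PR-cyc r s))
    where
    skip : IsPR none (λ xs → code (junk (suc (g xs))))
    skip = PR-junk (PR-suc p)
    back : ∀ t {h} → IsPR none h → IsPR none (λ xs → code (slotBack t (g xs) (h xs)))
    back ω r = PR-backJunk r
    back ζ r = skip

  PR-nextBack : ∀ t {h : Vec ℕ n → ℕ} → IsPR none h → IsPR none (λ xs → code (nextBack t (h xs)))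
  PR-nextBack ω     p = PR-junk (PR-suc (PR-backJunk p))
  PR-nextBack ζ {h} p = ext (PR-if (p ≡ᴿ const 0) (PR-junk (const 0)) (PR-backJunk (PR-pred p))) (λ xs → lem (h xs))
    where
    lem : ∀ p → (if does (p ≟ 0) then code (junk 0) else code (backJunk (pred p))) ≡ code (nextBack ζ p)
    lem zero    = refl
    lem (suc p) = refl

  PR-next-bwd : ∀ {g h : Vec ℕ n → ℕ} → IsPR none g → IsPR none h → IsPR none (λ xs → code (next (bwd (g xs) (h xs))))
  PR-next-bwd {g = g} {h} p q = ext
    (PR-if (q ≡ᴿ const 0) (PR-fwd ζ p (const 0)) (PR-code-if (refutedOf ζ p (PR-pred q)) (PR-fwd ζ p q) (PR-bwd p (PR-pred q))))
    (λ xs → lem (g xs) (h xs))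
    where
    lem : ∀ c n → (if does (n ≟ 0) then code (fwd ζ c 0)
                   else code (if does (refuted? ζ c (pred n)) then fwd ζ c n else bwd c (pred n))) ≡ code (next (bwd c n))
    lem c zero    = refl
    lem c (suc n) = refl

  operation : ℕ → ℕ
  operation n = code (next (decode n))

  PR-operation : IsPR none (unary operation)
  PR-operation = ext (PR-cases {n = 1} (λ _ x → code (next x)) v₀
      (λ p → PR-slot p p)
      (PR-nextBack T)
      (λ t p q → PR-code-if (refutedOf t p q) (PR-junk (PR-suc (PR-fwd t p q))) (PR-fwd t p (PR-suc q)))
      PR-next-bwd
      (λ p q → PR-code-if (periodOf p q) (PR-cyc (apply PR-f (p ∷ [])) q) (PR-junk (PR-suc (PR-cyc p q)))))
    λ { (_ ∷ []) → refl }

  code-iso : Iso next operation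
  code-iso = record
    { to = code ; from = decode ; to-from = code-decode ; from-to = decode-code
    ; homo = λ x → cong (code ∘ next) (sym (decode-code x)) }

-- From the cone to the categoricity spectrum

Δ⁰-trans : ∀ {n} {g : Vec ℕ k → ℕ} {β : Oracle O} {P : Vec ℕ m → Set} →
           Computable β g → Δ⁰ n (single g) P → Δ⁰ n β P
Δ⁰-trans g-comp ((h , h-comp , P⇔) , (h′ , h′-comp , P⇔′)) =
  (h , computable-trans h-comp g-comp , P⇔) , (h′ , computable-trans h′-comp g-comp , P⇔′)

-- The two quantified variables come first and stay in place; argument and value are exchanged.
swap : Fin 4 → Fin 4
swap zero                   = zero
swap (suc zero)             = suc zero
swap (suc (suc zero))       = suc (suc (suc zero))
swap (suc (suc (suc zero))) = suc (suc zero)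

Δ⁰-inverse : ∀ {f g : ℕ → ℕ} {α : Oracle O} → (∀ y → f (g y) ≡ y) → (∀ x → g (f x) ≡ x) →
             Δ⁰-function 2 α f → Δ⁰-function 2 α g
Δ⁰-inverse {f = f} {g} f∘g g∘f ((h , h-comp , P⇔) , (h′ , h′-comp , P⇔′)) =
    (_ , computable-permute swap h-comp , λ { (x ∷ y ∷ []) → mk⇔
      (λ e → Equivalence.to (P⇔ (y ∷ x ∷ [])) (invert e)) (λ e → revert (Equivalence.from (P⇔ (y ∷ x ∷ [])) e)) })
  , (_ , computable-permute swap h′-comp , λ { (x ∷ y ∷ []) → mk⇔
      (λ e → Equivalence.to (P⇔′ (y ∷ x ∷ [])) (invert e)) (λ e → revert (Equivalence.from (P⇔′ (y ∷ x ∷ [])) e)) })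
  where
  invert : ∀ {x y} → g x ≡ y → f y ≡ x
  invert refl = f∘g _
  revert : ∀ {x y} → f y ≡ x → g x ≡ y
  revert refl = g∘f _

opaque
  cone⇒spectrum : ∀ A → RelativelyΔ⁰Categorical 2 A → ∀ {d} → Cone 2 d → PRCatSpec A d
  cone⇒spectrum A Δ₂-cat d∈ B (p , p≗) B≅A with Δ₂-cat B B≅A
  ... | φ , Δφ = φ , d∈ to Δto , d∈ from (Δ⁰-inverse (Iso.to-from ψ) (Iso.from-to ψ) Δto)
    where
    open _≅_ φ
    ψ : Iso (op A) (op B)
    ψ = ≅⇒Iso φ
    diagram : IsPR none (atomicDiagram B)
    diagram = ext (char (sameIterateᴿ (isPR p p≗))) λ { (_ ∷ _ ∷ _ ∷ _ ∷ []) → refl }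
    Δto : Δ⁰-function 2 none to
    Δto = Δ⁰-trans (PR⇒computable diagram) Δφ

-- From the categoricity spectrum to the cone

-- Otherwise n + 1 arguments would be sent injectively into n values.
pigeonhole-ℕ : ∀ n (h : ℕ → ℕ) → (∀ {i j} → h i ≡ h j → i ≡ j) → ∃ λ i → i < suc n × n ≤ h i
pigeonhole-ℕ n h inj with anyUpTo? (λ i → n ≤? h i) (suc n)
... | yes found = found
... | no  ∄ with pigeonhole ≤-refl (λ (i : Fin (suc n)) → fromℕ< (small i))
  where
  small : ∀ (i : Fin (suc n)) → h (toℕ i) < n
  small i = ≰⇒> λ n≤ → ∄ (toℕ i , toℕ<n i , n≤)
... | i , j , i<j , e = ⊥-elim (<-irrefl (inj (trans (sym (toℕ-fromℕ< _)) (trans (cong toℕ e) (toℕ-fromℕ< _)))) i<j)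

module _ (em : ExcludedMiddle 0ℓ) {f : ℕ → ℕ} (f-inj : Injective _≡_ _≡_ f) (PR-f : IsPR none (unary f)) (T : OrbitType) where

  S : PRel none (SameIterate f)
  S = sameIterateᴿ PR-f

  PR-zero : IsPR none (binary λ _ _ → 0)
  PR-zero = ext (const 0) λ { (_ ∷ _ ∷ []) → refl }

  module _ {G : ℕ → ℕ → ℕ} (PR-G : IsPR none (binary G)) where

    private
      module B₀ = GuessingCopy em f-inj S T PR-zero
      module B₁ = GuessingCopy em f-inj S T PR-G
      module G₀ = Guessing PR-zero
      module G₁ = Guessing PR-G

    -- For G = 0 stage 0 is the least stable stage for every `i`, so these chains all survive and
    -- give an explicit list of elements of distinct orbits.
    start : ℕ → Element
    start i = fwd T (pair i 0) 0

    start-right : ∀ i → G₀.Right (pair i 0)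
    start-right i n (inj₁ (s , s< , _))             = n≮0 (subst (s <_) (π₂-pair i 0) s<)
    start-right i n (inj₂ (_ , _ , _ , _ , ≢)) = ≢ refl

    start-true : ∀ i → B₀.True T (pair i 0)
    start-true i = B₀.Right⇒True (start-right i)

    start-distinct : ∀ {i j} → start i B₀.~ start j → i ≡ j
    start-distinct {i} {j} i~j = trans (sym (π₁-pair i 0)) (trans (cong π₁ (lem
      (trans (sym (B₀.chainLabel-true T (start-true i))) (trans (B₀.label-~ i~j) (B₀.chainLabel-true T (start-true j))))))
      (π₁-pair j 0))
      where
      lem : ∀ {c d} → B₀.chainL T c ≡ B₀.chainL T d → c ≡ d
      lem refl = refl

    module _ (θ : Iso B₀.next B₁.next) where

      image : ℕ → Element
      image i = Iso.to θ (start i)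

      Place : Element → Set
      Place y = (y B₁.~ junk 0) ⊎ (∃ λ c → G₁.Right c × y B₁.~ fwd T c 0)

      opaque
        image-place : ∀ i → Place (image i)
        image-place i = B₁.typeT-label
          (λ per → HasType⇒¬Periodic T type (Iso-Periodic⁻ θ per))
          (λ deep → onlyζ T refl type (Iso-Deep⁻ θ deep))
          (λ { refl → Iso-Deep θ (proj₁ type) })
          where
          type : HasType T B₀.next (start i)
          type = B₀.chain-type T (start-true i)
          onlyζ : ∀ t → T ≡ t → ∀ {x} → HasType t B₀.next x → Deep B₀.next x → T ≡ ζ
          onlyζ ω e root deep = ⊥-elim (Root⇒¬Deep root deep)
          onlyζ ζ e _    _    = e

      -- The junk orbit gets 0 and the right guess for y gets y + 1, so `suc x ≤ place p` excludes
      -- junk and ensures that the guess covers `x`.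
      place : ∀ {y} → Place y → ℕ
      place (inj₁ _)       = 0
      place (inj₂ (c , _)) = suc (π₁ c)

      place-injective : ∀ {y z} (p : Place y) (q : Place z) → place p ≡ place q → y B₁.~ z
      place-injective (inj₁ y~0) (inj₁ z~0) e = ~-trans y~0 (~-sym z~0)
      place-injective {z = z} (inj₂ (c , rc , y~c)) (inj₂ (d , rd , z~d)) e =
        ~-trans y~c (~-sym (subst (λ c → z B₁.~ fwd T c 0) (G₁.Right-unique rd rc (sym (suc-injective e))) z~d))

      -- 2 + x elements in distinct orbits: at most one of them is junk, and the others
      -- lie in chains with right guesses for distinct y, of which one is at least x.
      modulus : ℕ → ℕ
      modulus x = sum< (2 + x) (λ i → π₂ (chainOf (image i)))

      opaque
        modulus-stable : ∀ x s → modulus x ≤ s → G x s ≡ G x (modulus x)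
        modulus-stable x s m≤s = fromPlace (proj₁ far) (image-place (proj₁ far)) (proj₁ (proj₂ far)) (proj₂ (proj₂ far))
          where
          far : ∃ λ i → i < 2 + x × suc x ≤ place (image-place i)
          far = pigeonhole-ℕ (suc x) (λ i → place (image-place i))
            λ {i} {j} e → start-distinct (Iso-~⁻ θ (place-injective (image-place i) (image-place j) e))
          fromPlace : ∀ i (p : Place (image i)) → i < 2 + x → suc x ≤ place p → G x s ≡ G x (modulus x)
          fromPlace i (inj₂ (c , right , y~c)) i< x<place =
            trans (stable s (≤-trans c≤m m≤s)) (sym (stable (modulus x) c≤m))
            where
            chain : chainOf (image i) ≡ c
            chain = B₁.label-chainOf (image i) (trans (B₁.label-~ y~c) (B₁.chainLabel-true T (B₁.Right⇒True right)))
            c≤m : π₂ c ≤ modulus x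
            -- The sum dominates each summand. Elements in the junk orbit may contribute arbitrary
            -- numbers, which only enlarge a bound.
            c≤m = subst (λ c → π₂ c ≤ modulus x) chain (≤-sum (λ i → π₂ (chainOf (image i))) i<)
            stable : ∀ s → π₂ c ≤ s → G x s ≡ G x (π₂ c)
            stable s c≤s = G₁.Right-stable right s c≤s x (s≤s⁻¹ x<place)

  module _ (inf : Positions.Infinite em f T) where

    private
      module Op {G : ℕ → ℕ → ℕ} (PR-G : IsPR none (binary G)) =
        CopyPR PR-f T (GuessingCopy.chains em f-inj S T PR-G)

    copy : {G : ℕ → ℕ → ℕ} → IsPR none (binary G) → Structure
    copy PR-G = ⟨ω, Op.operation PR-G ⟩

    copy-punctual : ∀ {G} (PR-G : IsPR none (binary G)) → Punctual (copy PR-G)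
    copy-punctual PR-G = scheme (Op.PR-operation PR-G) , correct (Op.PR-operation PR-G)

    copy-≅ : ∀ {G} (PR-G : IsPR none (binary G)) → (∀ x → ∃ λ y → Eventually (λ s → G x s ≡ y)) → copy PR-G ≅ ⟨ω, f ⟩
    copy-≅ PR-G lim = Iso⇒≅ (Iso-sym (Iso-trans (GuessingCopy.copy-iso em f-inj S T PR-G inf lim) (Op.code-iso PR-G)))

    module _ {d : ℕ → ℕ} {G : ℕ → ℕ → ℕ} {g : ℕ → ℕ} (PR-G : IsPR none (binary G)) (lim : LimitOf g G)
             (φ₀ : ⟨ω, f ⟩ ≅ copy PR-zero) (φ₁ : ⟨ω, f ⟩ ≅ copy PR-G)
             (PR-from : IsPR (single (unary d)) (unary (_≅_.from φ₀)))
             (PR-to : IsPR (single (unary d)) (unary (_≅_.to φ₁))) where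

      -- Both isomorphisms start from the given structure, so the first is inverted; this is where
      -- the bound on `from` is used.
      between : Iso (GuessingCopy.next em f-inj S T PR-zero) (GuessingCopy.next em f-inj S T PR-G)
      between = Iso-trans (Op.code-iso PR-zero) (Iso-trans (Iso-sym (≅⇒Iso φ₀))
                  (Iso-trans (≅⇒Iso φ₁) (Iso-sym (Op.code-iso PR-G))))

      limit-at-modulus : ∀ x → G x (modulus PR-G between x) ≡ g x
      -- At the stage `s₀ ⊔ b` the limit has been reached, and since `b` the value of `G x` has not
      -- changed.
      limit-at-modulus x = trans (sym (modulus-stable PR-G between x (s₀ ⊔ b) (m≤n⊔m s₀ b))) (proj₂ (lim x) (s₀ ⊔ b) (m≤m⊔n s₀ b))
        where
        s₀ b : ℕ
        s₀ = proj₁ (lim x)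
        b  = modulus PR-G between x

      PR-modulus : IsPR (single (unary d)) (unary (modulus PR-G between))
      PR-modulus = ext (PR-sum {n = 1} (PR-π₂ (PR-chainOf (apply PR-to (apply PR-from (PR-fwd T (PR-pair v₀ (const 0)) (const 0) ∷ []) ∷ []))))
                               (PR-suc (PR-suc v₀))) λ { (_ ∷ []) → refl }

      limit-≤PR : g ≤PR d
      limit-≤PR = scheme PR-g , λ x → correct PR-g (x ∷ [])
        where
        PR-g : IsPR (single (unary d)) (unary g)
        PR-g = ext (apply {n = 1} (fromNone PR-G) (v₀ ∷ apply PR-modulus (v₀ ∷ []) ∷ [])) λ { (x ∷ []) → limit-at-modulus x }

    opaque
      spectrum⇒limits : ∀ {d} → PRCatSpec ⟨ω, f ⟩ d → ∀ {G g} → IsPR none (binary G) → LimitOf g G → g ≤PR d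
      spectrum⇒limits {d} d∈ {G} {g} PR-G lim = limit-≤PR PR-G lim (proj₁ ψ₀) (proj₁ ψ₁)
          (isPR (proj₁ (proj₂ (proj₂ ψ₀))) λ { (x ∷ []) → proj₂ (proj₂ (proj₂ ψ₀)) x })
          (isPR (proj₁ (proj₁ (proj₂ ψ₁))) λ { (x ∷ []) → proj₂ (proj₁ (proj₂ ψ₁)) x })
        where
        ψ₀ : Σ (⟨ω, f ⟩ ≅ copy PR-zero) λ φ → _≅_.to φ ≤PR d × _≅_.from φ ≤PR d
        ψ₀ = d∈ (copy PR-zero) (copy-punctual PR-zero) (copy-≅ PR-zero (λ _ → 0 , 0 , λ _ _ → refl))
        ψ₁ : Σ (⟨ω, f ⟩ ≅ copy PR-G) λ φ → _≅_.to φ ≤PR d × _≅_.from φ ≤PR d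
        ψ₁ = d∈ (copy PR-G) (copy-punctual PR-G) (copy-≅ PR-G (λ x → g x , lim x))

theorem2p3 : ExcludedMiddle 0ℓ →
    (A : Structure) →
    Punctual A →
    IsInjectionStructure A →
    RelativelyΔ⁰Categorical 2 A →
    ¬ RelativelyΔ⁰Categorical 1 A →
    PRCatSpec A ≐ Cone 2
theorem2p3 em A pA@(p , p≗) A-inj Δ₂-cat ¬Δ₁-cat = cone em em , cone⇒spectrum A Δ₂-cat
  where
  open Positions em (op A)
  infinite⇒cone : ∀ T → Infinite T → ∀ {d} → PRCatSpec A d → Cone 2 d
  infinite⇒cone T inf d∈ f (Σf , _) =
    spectrum⇒limits em A-inj (isPR p p≗) T inf d∈ (proj₁ (proj₂ approximation)) (proj₂ (proj₂ approximation))
    where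
    approximation : ∃ λ G → IsPR none (binary G) × LimitOf f G
    approximation = limit-lemma em Σf
  finite⇒⊥ : ¬ Infinite ω → ¬ Infinite ζ → ⊥
  finite⇒⊥ ¬ω ¬ζ = ¬Δ₁-cat (finite⇒Δ₁-categorical em A pA A-inj (Nω ⊔ Nζ) bound)
    where
    Nω = proj₁ (bounded ¬ω)
    Nζ = proj₁ (bounded ¬ζ)
    bound : ∀ t {a} → Representative t (op A) a → a < Nω ⊔ Nζ
    bound ω r = <-≤-trans (proj₂ (bounded ¬ω) r) (m≤m⊔n Nω Nζ)
    bound ζ r = <-≤-trans (proj₂ (bounded ¬ζ) r) (m≤n⊔m Nω Nζ)
  cone : Dec (Infinite ω) → Dec (Infinite ζ) → ∀ {d} → PRCatSpec A d → Cone 2 d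
  cone (yes inf) _         = infinite⇒cone ω inf
  cone (no _)    (yes inf) = infinite⇒cone ζ inf
  cone (no ¬ω)   (no ¬ζ)   = ⊥-elim (finite⇒⊥ ¬ω ¬ζ)
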